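{- Let $m,n\ge 1$ and let $K_{m,n}$ be the complete bipartite graph with parts of sizes $m$ and $n$. Fix any total ordering of $E(K_{m,n})$ and any field $\Bbbk$. Then $$h_{K_{m,n}}(z)=\sum_{k=1}^{m}(-1)^{m+k}\left\{{m\atop k}\right\} z^{m-k}\left(\prod_{a=1}^{k-2}(1+az)\right)(1+(k-1)z)^n,$$ with the empty product interpreted as $1$, and $$\mathrm{Hilb}(\Bbbk[\mathrm{BC}(K_{m,n})];z)=\frac{h_{K_{m,n}}(z)}{(1-z)^{m+n-1}}.$$
   Context: $\left\{{m\atop k}\right\}$ denotes the Stirling number of the second kind (the number of partitions of an $m$-element set into $k$ nonempty blocks). For a finite connected loopless graph $G$ with a fixed total order on $E(G)$, a broken circuit is a set $C\setminus\{\max C\}$, where $C$ is the edge set of a cycle of $G$ and $\max C$ is its largest edge. The broken-circuit complex $\mathrm{BC}(G)$ is the simplicial complex on $E(G)$ whose faces are the edge sets containing no broken circuit. Its Stanley--Reisner ring is $\Bbbk[\mathrm{BC}(G)]=\Bbbk[x_e:e\in E(G)]/I_{\mathrm{BC}(G)}$, with $I_{\mathrm{BC}(G)}$ generated by the monomials $\prod_{e\in C\setminus\{\max C\}}x_e$ over all cycles $C$ of $G$; it is graded by $\deg x_e=1$, and $\mathrm{Hilb}$ denotes its Hilbert series. With $r=|V(G)|-1$ and $b_i$ the number of faces of $\mathrm{BC}(G)$ having exactly $i$ elements, the $h$-polynomial of $\mathrm{BC}(G)$ is $h_G(z)=\sum_{i=0}^{r}b_i z^i(1-z)^{r-i}$.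 -}

module Defs where

open import Algebra.Apartness.Bundles using (HeytingField)
open import Data.Bool.Base using (if_then_else_)
import Data.Bool.Properties as Bool
open import Data.Fin.Base using (Fin; toℕ; _↑ˡ_; _↑ʳ_; remQuot; splitAt)
import Data.Fin.Properties as Fin
open import Data.Fin.Subset
  using (Subset; inside; outside; ⊤; ⁅_⁆; _∈_; _⊆_; _∩_; _-_; ⋃; ∣_∣; Nonempty; Empty)
open import Data.Fin.Subset.Properties using (_∈?_; _⊆?_; nonempty?; anySubset?)
open import Data.Integer.Base as ℤ using (ℤ; +_; 0ℤ; 1ℤ)
import Data.Integer.Properties as ℤ
open import Data.List.Base as List using (List; []; _∷_; _++_; length; filter; foldr; upTo)
open import Data.List.Relation.Unary.All as All using (All)
open import Data.List.Relation.Unary.AllPairs as AllPairs using (AllPairs)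
open import Data.Nat.Base using (ℕ; zero; suc; _+_; _*_; _∸_)
open import Data.Nat.DivMod using (_mod_)
import Data.Nat.Properties as ℕ
open import Data.Product using (Σ; ∃; _×_; _,_; proj₁; proj₂)
open import Data.Sum.Base using (_⊎_)
open import Data.Vec.Base as Vec using (Vec; []; _∷_; lookup; toList)
import Data.Vec.Properties as Vec
import Data.Vec.Relation.Unary.AllPairs as VecAllPairs
open import Data.Vec.Relation.Unary.Unique.Propositional using (Unique)
open import Data.Vec.Relation.Unary.Unique.Propositional.Properties using (lookup-injective)
open import Function.Base using (_∘_)
open import Level using (Level; _⊔_)
open import Relation.Binary.Consequences using (total∧dec⇒dec)
open import Relation.Binary.Core using (Rel)
open import Relation.Binary.PropositionalEquality
  using (_≡_; _≢_; _≗_; refl; sym; trans; cong)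
open import Relation.Binary.Structures using (IsTotalOrder)
open import Relation.Nullary.Decidable
  using (Dec; does; map′; _×-dec_; _⊎-dec_; _→-dec_; ¬?)
open import Relation.Nullary.Negation using (¬_)

-- Integer polynomials in z are regarded as elements of ℤ⟦z⟧, represented by
-- their coefficient sequences and compared with _≗_.
Series : Set
Series = ℕ → ℤ

infixl 6 _⊕_ _⊖_
infixl 7 _⊗_ _÷_
infixr 8 _^ˢ_

const : ℤ → Series
const c zero    = c
const c (suc _) = 0ℤ

0ˢ 1ˢ z : Series
0ˢ = const 0ℤ
1ˢ = const 1ℤ
z (suc zero) = 1ℤ
z _          = 0ℤ

_⊕_ _⊖_ _⊗_ _÷_ : Series → Series → Series
(f ⊕ g) i = f i ℤ.+ g i
(f ⊖ g) i = f i ℤ.- g i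

-- Cauchy product: (f ⊗ g) d = f 0 * g d + f 1 * g (d ∸ 1) + … + f d * g 0.
(f ⊗ g) zero    = f 0 ℤ.* g 0
(f ⊗ g) (suc d) = f 0 ℤ.* g (suc d) ℤ.+ ((f ∘ suc) ⊗ g) d

-- Long division; only meaningful when the denominator has constant term 1
-- (see ÷-⊗).
(f ÷ g) zero    = f 0
(f ÷ g) (suc d) = ((λ i → f (suc i) ℤ.- f 0 ℤ.* g (suc i)) ÷ g) d

÷-⊗ : ∀ f g → g 0 ≡ 1ℤ → (f ÷ g) ⊗ g ≗ f
÷-⊗ f g g₀≡1 zero    = trans (cong (f 0 ℤ.*_) g₀≡1) (ℤ.*-identityʳ (f 0))
÷-⊗ f g g₀≡1 (suc d) =
  trans (cong (ℤ._+_ (f 0 ℤ.* g (suc d))) (÷-⊗ _ g g₀≡1 d))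
        (trans (ℤ.+-comm (f 0 ℤ.* g (suc d)) _)
        (trans (ℤ.+-assoc (f (suc d)) _ _)
        (trans (cong (ℤ._+_ (f (suc d))) (ℤ.+-inverseˡ (f 0 ℤ.* g (suc d))))
               (ℤ.+-identityʳ (f (suc d))))))

_^ˢ_ : Series → ℕ → Series
f ^ˢ zero  = 1ˢ
f ^ˢ suc n = f ⊗ f ^ˢ n

-- [ a , a + 1 , … , b ], which is empty when b < a.
range : ℕ → ℕ → List ℕ
range a b = List.map (λ i → a + i) (upTo (suc b ∸ a))

∑[_to_] ∏[_to_] : ℕ → ℕ → (ℕ → Series) → Series
∑[ a to b ] f = foldr _⊕_ 0ˢ (List.map f (range a b))
∏[ a to b ] f = foldr _⊗_ 1ˢ (List.map f (range a b))

subsets : ∀ n → List (Subset n)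
subsets zero    = [] ∷ []
subsets (suc n) =
  List.map (outside ∷_) (subsets n) ++ List.map (inside ∷_) (subsets n)

-- As subsets n has no repetitions, sublists (subsets n) lists every set of
-- subsets of Fin n exactly once.
sublists : ∀ {a} {A : Set a} → List A → List (List A)
sublists []       = [] ∷ []
sublists (x ∷ xs) = sublists xs ++ List.map (x ∷_) (sublists xs)

_≟ˢ_ : ∀ {n} (p q : Subset n) → Dec (p ≡ q)
_≟ˢ_ = Vec.≡-dec Bool._≟_

IsPartition : ∀ {n} → List (Subset n) → Set
IsPartition P =
  All Nonempty P × AllPairs (λ p q → Empty (p ∩ q)) P × ⋃ P ≡ ⊤

isPartition? : ∀ {n} (P : List (Subset n)) → Dec (IsPartition P)
isPartition? P =
  All.all? nonempty? P
    ×-dec AllPairs.allPairs? (λ p q → ¬? (nonempty? (p ∩ q))) P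
    ×-dec ⋃ P ≟ˢ ⊤

stirling₂ : ℕ → ℕ → ℕ
stirling₂ m k =
  length (filter (λ P → (length P ℕ.≟ k) ×-dec isPartition? P)
                 (sublists (subsets m)))

-- Finite loopless graphs, parallel edges allowed.  The order in which the
-- two endpoints of an edge are listed is irrelevant (see Joins).
record Graph : Set where
  field
    #V #E     : ℕ
    endpoints : Fin #E → Fin #V × Fin #V
    loopless  : ∀ e → proj₁ (endpoints e) ≢ proj₂ (endpoints e)

  Joins : Fin #E → Fin #V → Fin #V → Set
  Joins e u v = endpoints e ≡ (u , v) ⊎ endpoints e ≡ (v , u)

  -- The i-th edge joins the i-th vertex to the cyclically next one.  Since
  -- there are no loops, the length suc l is at least 2.
  IsCycle : ∀ {l} → Vec (Fin #V) (suc l) → Vec (Fin #E) (suc l) → Set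
  IsCycle {l} vs es =
    Unique vs × Unique es ×
    (∀ i → Joins (lookup es i) (lookup vs i) (lookup vs (suc (toℕ i) mod suc l)))

  IsCycleEdgeSet : Subset #E → Set
  IsCycleEdgeSet C =
    ∃ λ l → Σ (Vec (Fin #V) (suc l)) λ vs → Σ (Vec (Fin #E) (suc l)) λ es →
      IsCycle vs es × C ≡ ⋃ (List.map ⁅_⁆ (toList es))

-- K_{m,n}: edge number combine i j joins vertex i of the first part to
-- vertex j of the second.
K : ℕ → ℕ → Graph
K m n = record
  { #V        = m + n
  ; #E        = m * n
  ; endpoints = λ e → let (i , j) = remQuot {m} n e in i ↑ˡ n , m ↑ʳ j
  ; loopless  = λ e → let (i , j) = remQuot {m} n e in ↑ˡ≢↑ʳ i j
  }
  where
  ↑ˡ≢↑ʳ : ∀ (i : Fin m) (j : Fin n) → i ↑ˡ n ≢ m ↑ʳ j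
  ↑ˡ≢↑ʳ i j eq
    with () ← trans (sym (Fin.splitAt-↑ˡ m i n))
                    (trans (cong (splitAt m) eq) (Fin.splitAt-↑ʳ m n j))

anyVec? : ∀ {k n p} {P : Vec (Fin k) n → Set p} →
          (∀ v → Dec (P v)) → Dec (∃ P)
anyVec? {n = zero}  P? = map′ (λ p → [] , p) (λ { ([] , p) → p }) (P? [])
anyVec? {n = suc n} P? =
  map′ (λ { (x , v , p) → x ∷ v , p }) (λ { (x ∷ v , p) → x , v , p })
       (Fin.any? λ x → anyVec? λ v → P? (x ∷ v))

unique? : ∀ {k n} (v : Vec (Fin k) n) → Dec (Unique v)
unique? = VecAllPairs.allPairs? λ x y → ¬? (x Fin.≟ y)

module CycleSearch (G : Graph) where
  open Graph G

  private
    _≟ₑ_ : (p q : Fin #V × Fin #V) → Dec (p ≡ q)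
    (a , b) ≟ₑ (c , d) =
      map′ (λ { (refl , refl) → refl }) (λ { refl → refl , refl })
           ((a Fin.≟ c) ×-dec (b Fin.≟ d))

  joins? : ∀ e u v → Dec (Joins e u v)
  joins? e u v = (endpoints e ≟ₑ (u , v)) ⊎-dec (endpoints e ≟ₑ (v , u))

  isCycle? : ∀ {l} (vs : Vec (Fin #V) (suc l)) (es : Vec (Fin #E) (suc l)) →
             Dec (IsCycle vs es)
  isCycle? vs es =
    unique? vs ×-dec unique? es ×-dec Fin.all? (λ _ → joins? _ _ _)

  -- A cycle has at most #V vertices, so the search is finite.
  isCycleEdgeSet? : ∀ C → Dec (IsCycleEdgeSet C)
  isCycleEdgeSet? C =
    map′ (λ { (l , _ , c) → l , c })
         (λ { (l , c@(_ , _ , (uniq , _) , _)) →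
              l , Fin.injective⇒≤ (λ {i} {j} → lookup-injective uniq i j) , c })
         (ℕ.anyUpTo? (λ l → anyVec? λ vs → anyVec? λ es →
                        isCycle? vs es ×-dec (C ≟ˢ _))
                     #V)

module BrokenCircuitComplex
  (G : Graph) {ℓ} (_≼_ : Rel (Fin (Graph.#E G)) ℓ)
  (≼-isTotalOrder : IsTotalOrder _≡_ _≼_)
  where

  open Graph G
  open CycleSearch G using (isCycleEdgeSet?)
  private module ≼ = IsTotalOrder ≼-isTotalOrder

  IsMax : Subset #E → Fin #E → Set ℓ
  IsMax C e = e ∈ C × (∀ f → f ∈ C → f ≼ e)

  IsBrokenCircuit : Subset #E → Set ℓ
  IsBrokenCircuit B =
    ∃ λ C → IsCycleEdgeSet C × ∃ λ e → IsMax C e × B ≡ C - e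

  IsFace : Subset #E → Set ℓ
  IsFace S = ∀ B → IsBrokenCircuit B → ¬ (B ⊆ S)

  _≼?_ : ∀ e f → Dec (e ≼ f)
  _≼?_ = total∧dec⇒dec ≼.reflexive ≼.antisym ≼.total Fin._≟_

  isMax? : ∀ C e → Dec (IsMax C e)
  isMax? C e = (e ∈? C) ×-dec Fin.all? λ f → (f ∈? C) →-dec (f ≼? e)

  isBrokenCircuit? : ∀ B → Dec (IsBrokenCircuit B)
  isBrokenCircuit? B =
    anySubset? λ C →
      isCycleEdgeSet? C ×-dec Fin.any? λ e → isMax? C e ×-dec (B ≟ˢ (C - e))

  isFace? : ∀ S → Dec (IsFace S)
  isFace? S =
    map′ (λ none B bc B⊆S → none (B , bc , (λ {x} → B⊆S {x})))
         (λ face (B , bc , B⊆S) → face B bc (λ {x} → B⊆S {x}))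
         (¬? (anySubset? λ B → isBrokenCircuit? B ×-dec (B ⊆? S)))

  faceNumber : ℕ → ℕ
  faceNumber i =
    length (filter (λ S → (∣ S ∣ ℕ.≟ i) ×-dec isFace? S) (subsets #E))

  -- Intended for connected G, where #V ∸ 1 is the size of a spanning tree.
  hPolynomial : Series
  hPolynomial =
    ∑[ 0 to r ] λ i → const (+ faceNumber i) ⊗ z ^ˢ i ⊗ (1ˢ ⊖ z) ^ˢ (r ∸ i)
    where r = #V ∸ 1

-- The library's notion of field: an apartness # that is tight, with x # y
-- exactly when x - y is invertible.  For an ordinary (discrete) field take #
-- to be ≉; irreflexivity of # excludes the zero ring.
module Polynomials {c ℓ₁ ℓ₂} (𝕜 : HeytingField c ℓ₁ ℓ₂) (N : ℕ) where

  private module 𝕜 = HeytingField 𝕜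
  open 𝕜 using (Carrier; _≈_; 0#; 1#)

  -- Exponent vectors of monomials in x_0, …, x_{N-1}.
  Monomial : Set
  Monomial = Vec ℕ N

  -- Polynomials are finite formal sums of terms; the same monomial may occur
  -- several times, and only the resulting coefficients matter (see _≈ₚ_).
  Poly : Set c
  Poly = List (Carrier × Monomial)

  coeff : Poly → Monomial → Carrier
  coeff []            α = 0#
  coeff ((a , β) ∷ p) α =
    (if does (Vec.≡-dec ℕ._≟_ β α) then a else 0#) 𝕜.+ coeff p α

  infix  4 _≈ₚ_
  infixl 6 _+ₚ_ _-ₚ_
  infixl 7 _*ₚ_ _·ₚ_

  _≈ₚ_ : Poly → Poly → Set ℓ₁
  p ≈ₚ q = ∀ α → coeff p α ≈ coeff q α

  0ₚ : Poly
  0ₚ = []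

  _+ₚ_ _-ₚ_ _*ₚ_ : Poly → Poly → Poly
  p +ₚ q = p ++ q
  p -ₚ q = p ++ List.map (λ { (a , α) → 𝕜.- a , α }) q
  p *ₚ q = List.cartesianProductWith
             (λ { (a , α) (b , β) → a 𝕜.* b , Vec.zipWith _+_ α β }) p q

  _·ₚ_ : Carrier → Poly → Poly
  a ·ₚ p = List.map (λ { (b , β) → a 𝕜.* b , β }) p

  linearCombination : ∀ {n} → (Fin n → Carrier) → (Fin n → Poly) → Poly
  linearCombination a b = List.concat (List.tabulate λ i → a i ·ₚ b i)

  IsHomogeneous : ℕ → Poly → Set ℓ₁
  IsHomogeneous d p = ∀ α → Vec.sum α ≢ d → coeff p α ≈ 0#

  squarefree : Subset N → Poly
  squarefree B = (1# , Vec.map (λ s → if s then 1 else 0) B) ∷ []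

  -- The quotient of the polynomial ring by the ideal generated by the
  -- monomials squarefree B with B in Gens.
  module Quotient {g} (Gens : Subset N → Set g) where

    data Ideal : Poly → Set (c ⊔ ℓ₁ ⊔ g) where
      generator : ∀ {B} → Gens B → Ideal (squarefree B)
      zero      : Ideal 0ₚ
      sum       : ∀ {p q} → Ideal p → Ideal q → Ideal (p +ₚ q)
      multiple  : ∀ q {p} → Ideal p → Ideal (q *ₚ p)
      resp      : ∀ {p q} → p ≈ₚ q → Ideal p → Ideal q

    infix 4 _∼_

    -- Elements of the quotient ring are polynomials up to _∼_.
    _∼_ : Poly → Poly → Set (c ⊔ ℓ₁ ⊔ g)
    p ∼ q = Ideal (p -ₚ q)

    -- The classes of b 0, …, b (n - 1) form a 𝕜-basis of the image in the
    -- quotient of the space of homogeneous polynomials of degree d.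
    IsBasis : ℕ → ∀ {n} → (Fin n → Poly) → Set (c ⊔ ℓ₁ ⊔ g)
    IsBasis d b =
      (∀ i → IsHomogeneous d (b i)) ×
      (∀ a → linearCombination a b ∼ 0ₚ → ∀ i → a i ≈ 0#) ×
      (∀ p → IsHomogeneous d p → ∃ λ a → p ∼ linearCombination a b)

    HasDimension : ℕ → ℕ → Set (c ⊔ ℓ₁ ⊔ g)
    HasDimension d n = Σ (Fin n → Poly) (IsBasis d)

    -- The dimension n in each degree is unique because 𝕜 is a field.
    IsHilbertSeries : Series → Set (c ⊔ ℓ₁ ⊔ g)
    IsHilbertSeries H = ∀ d → ∃ λ n → H d ≡ + n × HasDimension d n

module StanleyReisner
  {c ℓ₁ ℓ₂} (𝕜 : HeytingField c ℓ₁ ℓ₂)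
  (G : Graph) {ℓ} (_≼_ : Rel (Fin (Graph.#E G)) ℓ)
  (≼-isTotalOrder : IsTotalOrder _≡_ _≼_)
  where

  open BrokenCircuitComplex G _≼_ ≼-isTotalOrder using (IsBrokenCircuit)
  open Polynomials 𝕜 (Graph.#E G)
  open Quotient IsBrokenCircuit public

module Submission where

-- By Whitney's broken circuit theorem the signed face numbers of BC(G) are the coefficients of the
-- chromatic polynomial χ.  For a colouring f, the faces consisting of f-monochromatic edges have
-- signed count 1 if f is proper and 0 otherwise: toggling the least edge that completes a broken
-- circuit inside S to its cycle cancels all non-faces S.  Faces are forests, so each face S is
-- monochromatic for exactly q ^ (#V ∸ ∣S∣) colourings with q colours, and summing over f gives χ.
-- For K m n, colouring the first part with exactly k colours leaves q - k colours for each vertex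
-- of the other part, so χ(q) = Σ_k S(m,k) q(q-1)⋯(q-k+1) (q-k)ⁿ.  Substituting q = (z-1)/z and
-- clearing denominators gives ±(1-z) h(z).  For the Hilbert series, the monomials of degree d whose
-- support is a face form a basis in degree d, and those with support S have generating function
-- (z/(1-z))^∣S∣.

open import Algebra.Apartness.Bundles using (HeytingCommutativeRing; HeytingField)
open import Algebra.Bundles using (CommutativeRing)
import Algebra.Properties.Group as GroupProperties
import Algebra.Properties.CommutativeSemigroup as CommutativeSemigroupProperties
import Algebra.Properties.Ring as RingProperties
open import Data.Bool.Base using (Bool; true; false; not; if_then_else_)
open import Data.Bool.Properties using (not-involutive)
open import Data.Fin.Base as Fin using (Fin; zero; suc; toℕ; fromℕ<; punchIn; punchOut; _↑ˡ_; _↑ʳ_; combine; remQuot)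
import Data.Fin.Properties as Fin
open import Data.Fin.Subset using (Subset; inside; outside; ⊤; ⊥; ⁅_⁆; _∈_; _∉_; _⊆_; _∪_; _∩_; _─_; _-_; ⋃; ∣_∣; Nonempty; Empty)
open import Data.Fin.Subset.Properties using (_∈?_; _⊆?_; drop-∷-⊆; anySubset?; x∈p∪q⁺; x∈p∪q⁻; x∈⁅x⁆; x∈⁅y⁆⇒x≡y; x∈p∧x≢y⇒x∈p-y; ∉⊥; ∣⊥∣≡0; nonempty?; drop-there; ∪-comm; ∪-assoc; ∪-identityʳ; ⊆-antisym; x∈p∩q⁺; x∈p∩q⁻; x∈p∧x∉q⇒x∈p─q)
open import Data.Integer.Base as ℤ using (ℤ; +_; 0ℤ; 1ℤ; -1ℤ)
import Data.Integer.Properties as ℤ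
open import Data.Integer.Tactic.RingSolver using (solve-∀)
open import Data.List.Base as List using (List; []; _∷_; _++_; length; filter; allFin; upTo)
import Data.List.Properties as List
open import Data.List.Membership.Propositional using () renaming (_∈_ to _∈ˡ_)
open import Data.List.Membership.Propositional.Properties using (∈-allFin; ∈-map⁺; ∈-map⁻; ∈-++⁺ˡ; ∈-++⁺ʳ; ∈-++⁻; ∈-lookup; ∈-cartesianProductWith⁺; ∈-upTo⁺; ∈-upTo⁻; ∈-filter⁺; ∈-filter⁻)
open import Data.List.Relation.Unary.All as All using (All; []; _∷_)
open import Data.List.Relation.Unary.AllPairs using (AllPairs; []; _∷_; allPairs?) renaming (map to mapAllPairs)
open import Data.List.Relation.Unary.Any as Any using (here; there)
import Data.List.Relation.Unary.Any.Properties as Any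
import Data.List.Relation.Unary.All.Properties as All
import Data.List.Relation.Unary.AllPairs.Properties as AllPairs
import Data.List.Relation.Unary.Unique.Propositional as List
import Data.List.Relation.Unary.Unique.Propositional.Properties as List
open import Data.Nat.Base as ℕ using (ℕ; zero; suc)
open import Data.Nat.Divisibility using (divides; ∣⇒≤)
open import Data.Nat.DivMod using (_%_; _/_; _mod_; m%n<n; m≡m%n+[m/n]*n; [m+kn]%n≡m%n; m<n⇒m%n≡m; [m+n]%n≡m%n; n%n≡0)
import Data.Nat.Properties as ℕ
open import Data.Product using (Σ; ∃; _×_; _,_; proj₁; proj₂)
open import Data.Sum.Base using (_⊎_; inj₁; inj₂; [_,_]′)
open import Data.Vec.Base as Vec using (Vec; []; _∷_; lookup; tabulate; toList; updateAt; here; there)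
import Data.Vec.Properties as Vec
open import Data.Vec.Relation.Unary.All as VecAll using ([]; _∷_)
import Data.Vec.Relation.Unary.All.Properties as VecAll
open import Data.Vec.Relation.Unary.AllPairs using ([]; _∷_)
open import Data.Vec.Relation.Unary.Unique.Propositional using (Unique)
open import Data.Vec.Relation.Unary.Unique.Propositional.Properties using (lookup-injective)
open import Function.Base using (_∘_; id)
open import Level using (Level)
open import Relation.Binary.Construct.Closure.ReflexiveTransitive as Star using (Star; ε; _◅_; _◅◅_)
import Relation.Binary.Construct.Flip.EqAndOrd as Flip
open import Relation.Binary.Core using (Rel)
open import Relation.Binary.PropositionalEquality as ≡ using (_≡_; _≢_; _≗_; refl; sym; trans; cong; cong₂; subst)
open import Relation.Binary.Structures using (IsTotalOrder)
open import Relation.Nullary.Decidable using (Dec; yes; no; does; _×-dec_; _→-dec_; ¬?)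
open import Relation.Nullary.Negation using (¬_; contradiction)
open import Relation.Unary using (Decidable)
import Relation.Binary.Reasoning.Setoid as SetoidReasoning

open import Defs

-- The counting argument gives one integer identity for each natural number q of colours, whereas q
-- = (z-1)/z is not even a power series. The bridge is `Homogenises`: a polynomial function of
-- degree at most d is paired with its degree-d homogenisation in x = 1 - z and y = -z, and
-- functions that agree on the natural numbers have equal homogenisations. No division by z occurs.
--
-- In degree `#V` a face S turns (-1)^|S| q^(#V-|S|) into z^|S| (1-z)^(#V-|S|), and a factor q - a
-- turns into 1 + (a-1)z. For a = 0 that is 1 - z, the factor cancelled at the end; for a = 1 it is
-- 1, so a falling factorial of length k leaves the product from 1 to k - 2. The k-th term has
-- degree n + k in q, and padding it to degree m + n supplies (-z)^(m-k), hence both the power of z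
-- and the sign in the formula.
--
-- The toggle is an involution because every edge of a broken circuit is smaller than the edge
-- completing it: toggling the least completing edge affects neither its own broken circuit nor that
-- of any smaller edge.

private variable
  a b p q : Level
  A : Set a
  B : Set b
  P : Set p
  Q : Set q

-- Sums over lists in a commutative ring

module ListSum {c ℓ} (R : CommutativeRing c ℓ) where

  open CommutativeRing R renaming (refl to ≈-refl; sym to ≈-sym; trans to ≈-trans)

  +-interchange : ∀ w x y v → (w + x) + (y + v) ≈ (w + y) + (x + v)
  +-interchange w x y v =
    ≈-trans (+-assoc w x _) (≈-trans (+-congˡ
      (≈-trans (≈-sym (+-assoc x y v)) (≈-trans (+-congʳ (+-comm x y)) (+-assoc y x v))))
      (≈-sym (+-assoc w y _)))

  ∑ : List A → (A → Carrier) → Carrier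
  ∑ []       f = 0#
  ∑ (x ∷ xs) f = f x + ∑ xs f

  ∑-cong-∈ : ∀ (xs : List A) {f g} → (∀ {x} → x ∈ˡ xs → f x ≈ g x) → ∑ xs f ≈ ∑ xs g
  ∑-cong-∈ []       eq = ≈-refl
  ∑-cong-∈ (x ∷ xs) eq = +-cong (eq (here refl)) (∑-cong-∈ xs (eq ∘ there))

  ∑-cong : ∀ (xs : List A) {f g} → (∀ x → f x ≈ g x) → ∑ xs f ≈ ∑ xs g
  ∑-cong xs eq = ∑-cong-∈ xs (λ {x} _ → eq x)

  ∑-zero-∈ : ∀ (xs : List A) {f} → (∀ {x} → x ∈ˡ xs → f x ≈ 0#) → ∑ xs f ≈ 0#
  ∑-zero-∈ []       eq = ≈-refl
  ∑-zero-∈ (x ∷ xs) eq =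
    ≈-trans (+-cong (eq (here refl)) (∑-zero-∈ xs (eq ∘ there))) (+-identityˡ 0#)

  ∑-zero : ∀ (xs : List A) {f} → (∀ x → f x ≈ 0#) → ∑ xs f ≈ 0#
  ∑-zero xs eq = ∑-zero-∈ xs (λ {x} _ → eq x)

  ∑-+ : ∀ (xs : List A) f g → ∑ xs (λ x → f x + g x) ≈ ∑ xs f + ∑ xs g
  ∑-+ []       f g = ≈-sym (+-identityˡ 0#)
  ∑-+ (x ∷ xs) f g = ≈-trans (+-congˡ (∑-+ xs f g)) (+-interchange _ _ _ _)

  ∑-*ˡ : ∀ (xs : List A) k f → ∑ xs (λ x → k * f x) ≈ k * ∑ xs f
  ∑-*ˡ []       k f = ≈-sym (zeroʳ k)
  ∑-*ˡ (x ∷ xs) k f = ≈-trans (+-congˡ (∑-*ˡ xs k f)) (≈-sym (distribˡ k _ _))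

  ∑-*ʳ : ∀ (xs : List A) k f → ∑ xs (λ x → f x * k) ≈ ∑ xs f * k
  ∑-*ʳ xs k f =
    ≈-trans (∑-cong xs (λ x → *-comm (f x) k)) (≈-trans (∑-*ˡ xs k f) (*-comm k _))

  ∑-swap : ∀ (xs : List A) (ys : List B) (f : A → B → Carrier) →
           ∑ xs (λ x → ∑ ys (f x)) ≈ ∑ ys (λ y → ∑ xs (λ x → f x y))
  ∑-swap []       ys f = ≈-sym (∑-zero ys (λ _ → ≈-refl))
  ∑-swap (x ∷ xs) ys f = ≈-trans (+-congˡ (∑-swap xs ys f)) (≈-sym (∑-+ ys _ _))

  ∑-++ : ∀ (xs ys : List A) f → ∑ (xs ++ ys) f ≈ ∑ xs f + ∑ ys f
  ∑-++ []       ys f = ≈-sym (+-identityˡ _)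
  ∑-++ (x ∷ xs) ys f = ≈-trans (+-congˡ (∑-++ xs ys f)) (≈-sym (+-assoc _ _ _))

  ∑-map : ∀ (g : B → A) (xs : List B) (f : A → Carrier) → ∑ (List.map g xs) f ≡ ∑ xs (f ∘ g)
  ∑-map g []       f = refl
  ∑-map g (x ∷ xs) f = cong (λ y → f (g x) + y) (∑-map g xs f)

  ∑-single : ∀ {xs : List A} {e} (f : A → Carrier) → List.Unique xs → e ∈ˡ xs →
             (∀ {x} → x ∈ˡ xs → x ≢ e → f x ≈ 0#) → ∑ xs f ≈ f e
  ∑-single f (x≢ ∷ u) (here refl) eq =
    ≈-trans (+-congˡ (∑-zero-∈ _ (λ y∈ → eq (there y∈) (λ { refl → All.lookup x≢ y∈ refl }))))
            (+-identityʳ _)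
  ∑-single f (x≢ ∷ u) (there e∈) eq =
    ≈-trans (+-cong (eq (here refl) (All.lookup x≢ e∈)) (∑-single f u e∈ (eq ∘ there)))
            (+-identityˡ _)

  -- The Iverson bracket, through which cardinalities become sums that can be interchanged.
  ⟦_⟧ : Dec P → Carrier
  ⟦ P? ⟧ = if does P? then 1# else 0#

  ⟦⟧-yes : (P? : Dec P) → P → ⟦ P? ⟧ ≡ 1#
  ⟦⟧-yes (yes _) _ = refl
  ⟦⟧-yes (no ¬p) p = contradiction p ¬p

  ⟦⟧-no : (P? : Dec P) → ¬ P → ⟦ P? ⟧ ≡ 0#
  ⟦⟧-no (yes p) ¬p = contradiction p ¬p
  ⟦⟧-no (no _)  _  = refl

  ⟦⟧-cong : (P? : Dec P) (Q? : Dec Q) → (P → Q) → (Q → P) → ⟦ P? ⟧ ≡ ⟦ Q? ⟧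
  ⟦⟧-cong (yes p) Q? to from = sym (⟦⟧-yes Q? (to p))
  ⟦⟧-cong (no ¬p) Q? to from = sym (⟦⟧-no Q? (¬p ∘ from))

  ⟦⟧-× : (P? : Dec P) (Q? : Dec Q) → ⟦ P? ×-dec Q? ⟧ ≈ ⟦ P? ⟧ * ⟦ Q? ⟧
  ⟦⟧-× (yes _) Q? = ≈-sym (*-identityˡ _)
  ⟦⟧-× (no _)  Q? = ≈-sym (zeroˡ _)

open ListSum ℤ.+-*-commutativeRing public

length-filter : ∀ {P : A → Set p} (P? : ∀ x → Dec (P x)) (xs : List A) →
                + length (filter P? xs) ≡ ∑ xs (λ x → ⟦ P? x ⟧)
length-filter P? []       = refl
length-filter P? (x ∷ xs) with P? x
... | yes _ = cong (ℤ._+_ 1ℤ) (length-filter P? xs)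
... | no  _ = trans (length-filter P? xs) (sym (ℤ.+-identityˡ _))

-- The ring of formal power series

⊗-cong : ∀ {f f′ g g′} → f ≗ f′ → g ≗ g′ → f ⊗ g ≗ f′ ⊗ g′
⊗-cong f≗ g≗ zero    = cong₂ ℤ._*_ (f≗ 0) (g≗ 0)
⊗-cong f≗ g≗ (suc d) =
  cong₂ ℤ._+_ (cong₂ ℤ._*_ (f≗ 0) (g≗ (suc d))) (⊗-cong (f≗ ∘ suc) g≗ d)

⊗-distribʳ : ∀ f g h → (g ⊕ h) ⊗ f ≗ g ⊗ f ⊕ h ⊗ f
⊗-distribʳ f g h zero    = ℤ.*-distribʳ-+ (f 0) (g 0) (h 0)
⊗-distribʳ f g h (suc d) =
  trans (cong₂ ℤ._+_ (ℤ.*-distribʳ-+ (f (suc d)) (g 0) (h 0)) (⊗-distribʳ f (g ∘ suc) (h ∘ suc) d))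
        (+-interchange (g 0 ℤ.* f (suc d)) _ _ _)

scale-⊗ : ∀ k f g → (λ i → k ℤ.* f i) ⊗ g ≗ λ i → k ℤ.* (f ⊗ g) i
scale-⊗ k f g zero    = ℤ.*-assoc k (f 0) (g 0)
scale-⊗ k f g (suc d) =
  trans (cong₂ ℤ._+_ (ℤ.*-assoc k (f 0) (g (suc d))) (scale-⊗ k (f ∘ suc) g d))
        (sym (ℤ.*-distribˡ-+ k _ _))

zero-⊗ : ∀ g → (λ _ → 0ℤ) ⊗ g ≗ λ _ → 0ℤ
zero-⊗ g zero    = refl
zero-⊗ g (suc d) = trans (ℤ.+-identityˡ _) (zero-⊗ g d)

const-⊗ : ∀ k g → const k ⊗ g ≗ λ i → k ℤ.* g i
const-⊗ k g zero    = refl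
const-⊗ k g (suc d) = trans (cong (ℤ._+_ (k ℤ.* g (suc d))) (zero-⊗ g d)) (ℤ.+-identityʳ _)

-- The definition of `_⊗_` recurses on its left factor. This is the mirror image, with recursion on
-- the right factor, and it is what commutativity needs.
⊗-suc : ∀ f g d → (f ⊗ g) (suc d) ≡ (f ⊗ (g ∘ suc)) d ℤ.+ f (suc d) ℤ.* g 0
⊗-suc f g zero    = refl
⊗-suc f g (suc d) =
  trans (cong (ℤ._+_ (f 0 ℤ.* g (suc (suc d)))) (⊗-suc (f ∘ suc) g d))
        (sym (ℤ.+-assoc (f 0 ℤ.* g (suc (suc d))) _ _))

⊗-comm : ∀ f g → f ⊗ g ≗ g ⊗ f
⊗-comm f g zero    = ℤ.*-comm (f 0) (g 0)
⊗-comm f g (suc d) =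
  trans (cong₂ ℤ._+_ (ℤ.*-comm (f 0) (g (suc d))) (⊗-comm (f ∘ suc) g d))
        (trans (ℤ.+-comm (g (suc d) ℤ.* f 0) _) (sym (⊗-suc g f d)))

⊗-assoc : ∀ f g h → (f ⊗ g) ⊗ h ≗ f ⊗ (g ⊗ h)
⊗-assoc f g h zero    = ℤ.*-assoc (f 0) (g 0) (h 0)
⊗-assoc f g h (suc d) =
  trans (cong₂ ℤ._+_ (ℤ.*-assoc (f 0) (g 0) (h (suc d)))
          (trans (⊗-distribʳ h (λ i → f 0 ℤ.* g (suc i)) ((f ∘ suc) ⊗ g) d)
                 (cong₂ ℤ._+_ (scale-⊗ (f 0) (g ∘ suc) h d) (⊗-assoc (f ∘ suc) g h d))))
        (trans (sym (ℤ.+-assoc (f 0 ℤ.* (g 0 ℤ.* h (suc d))) _ _))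
               (cong (ℤ._+ ((f ∘ suc) ⊗ (g ⊗ h)) d)
                 (sym (ℤ.*-distribˡ-+ (f 0) (g 0 ℤ.* h (suc d)) _))))

⊗-identityˡ : ∀ f → 1ˢ ⊗ f ≗ f
⊗-identityˡ f i = trans (const-⊗ 1ℤ f i) (ℤ.*-identityˡ (f i))

0ˢ≗0 : ∀ i → 0ˢ i ≡ 0ℤ
0ˢ≗0 zero    = refl
0ˢ≗0 (suc _) = refl

seriesRing : CommutativeRing _ _
seriesRing = record
  { Carrier = Series
  ; _≈_ = _≗_
  ; _+_ = _⊕_
  ; _*_ = _⊗_
  ; -_  = λ f i → ℤ.- f i
  ; 0#  = 0ˢ
  ; 1#  = 1ˢ
  ; isCommutativeRing = record
    { isRing = record
      { +-isAbelianGroup = record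
        { isGroup = record
          { isMonoid = record
            { isSemigroup = record
              { isMagma = record
                { isEquivalence = record
                  { refl  = λ _ → refl
                  ; sym   = λ eq i → sym (eq i)
                  ; trans = λ eq₁ eq₂ i → trans (eq₁ i) (eq₂ i)
                  }
                ; ∙-cong = λ eq₁ eq₂ i → cong₂ ℤ._+_ (eq₁ i) (eq₂ i)
                }
              ; assoc = λ f g h i → ℤ.+-assoc (f i) (g i) (h i)
              }
            ; identity = (λ f i → trans (cong (ℤ._+ f i) (0ˢ≗0 i)) (ℤ.+-identityˡ (f i)))
                       , (λ f i → trans (cong (ℤ._+_ (f i)) (0ˢ≗0 i)) (ℤ.+-identityʳ (f i)))
            }
          ; inverse = (λ f i → trans (ℤ.+-inverseˡ (f i)) (sym (0ˢ≗0 i)))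
                    , (λ f i → trans (ℤ.+-inverseʳ (f i)) (sym (0ˢ≗0 i)))
          ; ⁻¹-cong = λ eq i → cong ℤ.-_ (eq i)
          }
        ; comm = λ f g i → ℤ.+-comm (f i) (g i)
        }
      ; *-cong = ⊗-cong
      ; *-assoc = ⊗-assoc
      ; *-identity = ⊗-identityˡ , λ f i → trans (⊗-comm f 1ˢ i) (⊗-identityˡ f i)
      ; distrib = (λ f g h i → trans (⊗-comm f (g ⊕ h) i)
                     (trans (⊗-distribʳ f g h i) (cong₂ ℤ._+_ (⊗-comm g f i) (⊗-comm h f i))))
                , ⊗-distribʳ
      }
    ; *-comm = ⊗-comm
    }
  }

open GroupProperties (CommutativeRing.+-group ℤ.+-*-commutativeRing) public using () renaming (∙-cancelˡ to +-cancelˡ)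

module 𝕊 = CommutativeRing seriesRing
module ∑ˢ = ListSum seriesRing

∑ˢ-at : ∀ (xs : List A) (f : A → Series) d → ∑ˢ.∑ xs f d ≡ ∑ xs (λ x → f x d)
∑ˢ-at []       f d = 0ˢ≗0 d
∑ˢ-at (x ∷ xs) f d = cong (ℤ._+_ (f x d)) (∑ˢ-at xs f d)

-- Compare coefficients from the bottom: as `g` has constant term 1, the heads agree, and removing
-- `f 0` times `g` from both products leaves the same equation for the tails.
⊗-cancelʳ : ∀ {f f′} g → g 0 ≡ 1ℤ → f ⊗ g ≗ f′ ⊗ g → f ≗ f′
⊗-cancelʳ {f} {f′} g g₀≡1 eq zero =
  trans (sym (ℤ.*-identityʳ (f 0))) (trans (cong (f 0 ℤ.*_) (sym g₀≡1))
    (trans (eq 0) (trans (cong (f′ 0 ℤ.*_) g₀≡1) (ℤ.*-identityʳ (f′ 0)))))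
⊗-cancelʳ {f} {f′} g g₀≡1 eq (suc d) = ⊗-cancelʳ g g₀≡1 tails d
  where
  heads : f 0 ≡ f′ 0
  heads = ⊗-cancelʳ g g₀≡1 eq 0

  tails : (f ∘ suc) ⊗ g ≗ (f′ ∘ suc) ⊗ g
  tails i = +-cancelˡ (f 0 ℤ.* g (suc i)) _ _
    (trans (eq (suc i)) (cong (λ x → x ℤ.* g (suc i) ℤ.+ ((f′ ∘ suc) ⊗ g) i) (sym heads)))

÷-unique : ∀ {f g h} → g 0 ≡ 1ℤ → h ⊗ g ≗ f → f ÷ g ≗ h
÷-unique {f} {g} g₀≡1 eq =
  ⊗-cancelʳ g g₀≡1 (λ i → trans (÷-⊗ f g g₀≡1 i) (sym (eq i)))

-- Broken circuits and colourings

module _ {ℓ} {_≼_ : Rel A ℓ} (≼-isTotalOrder : IsTotalOrder _≡_ _≼_) where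

  private module ≼ = IsTotalOrder ≼-isTotalOrder

  leastIn : ∀ {P : A → Set p} (P? : Decidable P) xs →
            (∀ {x} → x ∈ˡ xs → ¬ P x) ⊎ ∃ λ x → P x × (∀ {y} → y ∈ˡ xs → P y → x ≼ y)
  leastIn P? [] = inj₁ λ ()
  leastIn P? (x ∷ xs) with P? x | leastIn P? xs
  ... | no ¬px | inj₁ none = inj₁ λ { (here refl) → ¬px ; (there y∈) → none y∈ }
  ... | no ¬px | inj₂ (m , pm , least) =
    inj₂ (m , pm , λ { (here refl) px → contradiction px ¬px ; (there y∈) → least y∈ })
  ... | yes px | inj₁ none =
    inj₂ (x , px , λ { (here refl) _ → ≼.refl ; (there y∈) py → contradiction py (none y∈) })
  ... | yes px | inj₂ (m , pm , least) with ≼.total x m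
  ...   | inj₁ x≼m =
    inj₂ (x , px , λ { (here refl) _ → ≼.refl ; (there y∈) py → ≼.trans x≼m (least y∈ py) })
  ...   | inj₂ m≼x = inj₂ (m , pm , λ { (here refl) _ → m≼x ; (there y∈) → least y∈ })

least : ∀ {n ℓ} {_≼_ : Rel (Fin n) ℓ} → IsTotalOrder _≡_ _≼_ →
        ∀ {P : Fin n → Set p} (P? : Decidable P) → ∃ P → ∃ λ x → P x × (∀ y → P y → x ≼ y)
least {n = n} tot P? (x , px) with leastIn tot P? (allFin n)
... | inj₁ none           = contradiction px (none (∈-allFin x))
... | inj₂ (m , pm , min) = m , pm , λ y → min (∈-allFin y)

-- Signed sums over subsets

toggle : ∀ {n} → Fin n → Subset n → Subset n
toggle e S = updateAt S e not

toggle-involutive : ∀ {n} (e : Fin n) S → toggle e (toggle e S) ≡ S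
toggle-involutive e S =
  trans (Vec.updateAt-updateAt-local e S (not-involutive _)) (Vec.updateAt-id e S)

∈-toggle : ∀ {n} {e x : Fin n} {S} → x ≢ e → x ∈ S → x ∈ toggle e S
∈-toggle {e = e} {x} {S} x≢e = Vec.updateAt-minimal x e S x≢e

sign : ∀ {n} → Subset n → ℤ
sign S = -1ℤ ℤ.^ ∣ S ∣

sign-inside : ∀ {n} (S : Subset n) → sign (inside ∷ S) ≡ ℤ.- sign S
sign-inside S = ℤ.-1*i≡-i (sign S)

sign-toggle : ∀ {n} (e : Fin n) S → sign (toggle e S) ≡ ℤ.- sign S
sign-toggle zero    (inside  ∷ S) = sym (trans (cong ℤ.-_ (sign-inside S)) (ℤ.neg-involutive _))
sign-toggle zero    (outside ∷ S) = sign-inside S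
sign-toggle (suc e) (inside  ∷ S) =
  trans (sign-inside (toggle e S))
        (cong ℤ.-_ (trans (sign-toggle e S) (sym (sign-inside S))))
sign-toggle (suc e) (outside ∷ S) = sign-toggle e S

∑-subsets : ∀ {n} (w : Subset (suc n) → ℤ) →
            ∑ (subsets (suc n)) w ≡
            ∑ (subsets n) (w ∘ (outside ∷_)) ℤ.+ ∑ (subsets n) (w ∘ (inside ∷_))
∑-subsets {n} w =
  trans (∑-++ (List.map (outside ∷_) (subsets n)) _ w)
        (cong₂ ℤ._+_ (∑-map (outside ∷_) (subsets n) w) (∑-map (inside ∷_) (subsets n) w))

-- A sign-reversing involution without fixed points. Recursion on the position of `e` reduces to the
-- first position, where the two halves of `subsets (suc n)` cancel term by term.
∑-toggle-odd : ∀ {n} (e : Fin n) (w : Subset n → ℤ) →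
               (∀ S → w (toggle e S) ≡ ℤ.- w S) → ∑ (subsets n) w ≡ 0ℤ
∑-toggle-odd {suc n} zero w odd =
  trans (∑-subsets w) (trans (sym (∑-+ (subsets n) _ _)) (∑-zero (subsets n) λ S →
    trans (cong (ℤ._+_ (w (outside ∷ S))) (odd (outside ∷ S))) (ℤ.+-inverseʳ (w (outside ∷ S)))))
∑-toggle-odd {suc n} (suc e) w odd =
  trans (∑-subsets w) (cong₂ ℤ._+_ (∑-toggle-odd e _ (odd ∘ (outside ∷_)))
                                   (∑-toggle-odd e _ (odd ∘ (inside ∷_))))

infix 4 _⊆′_ _⊆′?_

_⊆′_ : ∀ {n} → Subset n → (Fin n → Set p) → Set p
S ⊆′ M = ∀ x → x ∈ S → M x

_⊆′?_ : ∀ {n} (S : Subset n) {M : Fin n → Set p} → Decidable M → Dec (S ⊆′ M)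
S ⊆′? M? = Fin.all? λ x → (x ∈? S) →-dec M? x

⊆′-toggle : ∀ {n} {e : Fin n} {S} {M : Fin n → Set p} → M e → S ⊆′ M → toggle e S ⊆′ M
⊆′-toggle {e = e} {S} {M} me S⊆M x x∈ with x Fin.≟ e
... | yes refl = me
... | no  x≢e  = S⊆M x (subst (x ∈_) (toggle-involutive e S) (∈-toggle x≢e x∈))

-- This is (1-1)^|M|: any element of `M` can be toggled to cancel everything, and if there is none,
-- only the empty set contributes.
∑-⊆′-sign : ∀ {n} {M : Fin n → Set p} (M? : Decidable M) →
            ∑ (subsets n) (λ S → ⟦ S ⊆′? M? ⟧ ℤ.* sign S) ≡ ⟦ Fin.all? (¬? ∘ M?) ⟧
∑-⊆′-sign {n = n} {M} M? with Fin.any? M?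
... | yes (e , me) =
  trans (∑-toggle-odd e _ λ S →
           trans (cong₂ ℤ._*_
                    (⟦⟧-cong (toggle e S ⊆′? M?) (S ⊆′? M?)
                      (subst (_⊆′ M) (toggle-involutive e S) ∘ ⊆′-toggle {M = M} me)
                      (⊆′-toggle {M = M} me))
                    (sign-toggle e S))
                 (sym (ℤ.neg-distribʳ-* ⟦ S ⊆′? M? ⟧ (sign S))))
        (sym (⟦⟧-no (Fin.all? (¬? ∘ M?)) λ none → none e me))
... | no none =
  trans (∑-empty n (λ x mx → none (x , mx)) M?)
        (sym (⟦⟧-yes (Fin.all? (¬? ∘ M?)) λ x mx → none (x , mx)))
  where
  ∑-empty : ∀ n {M : Fin n → Set _} → (∀ x → ¬ M x) → (M? : Decidable M) →
            ∑ (subsets n) (λ S → ⟦ S ⊆′? M? ⟧ ℤ.* sign S) ≡ 1ℤ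
  ∑-empty zero    none M? = cong (λ c → c ℤ.* 1ℤ ℤ.+ 0ℤ) (⟦⟧-yes ([] ⊆′? M?) λ ())
  ∑-empty (suc n) none M? =
    trans (∑-subsets {n} _) (trans (cong₂ ℤ._+_
      (trans (∑-cong (subsets n) λ S → cong (ℤ._* sign S)
                (⟦⟧-cong ((outside ∷ S) ⊆′? M?) (S ⊆′? (M? ∘ suc))
                   (λ S⊆ x x∈ → S⊆ (suc x) (there x∈))
                   (λ { S⊆ (suc x) (there x∈) → S⊆ x x∈ })))
             (∑-empty n (none ∘ suc) (M? ∘ suc)))
      (∑-zero (subsets n) λ S → cong (ℤ._* sign (inside ∷ S))
         (⟦⟧-no ((inside ∷ S) ⊆′? M?) λ S⊆ → none zero (S⊆ zero here))))
      (ℤ.+-identityʳ 1ℤ))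

∈-─⁻ : ∀ {n} {x : Fin n} S T → x ∈ S ─ T → x ∈ S × x ∉ T
∈-─⁻ (s ∷ S) (outside ∷ T) here       = here , λ ()
∈-─⁻ (s ∷ S) (t       ∷ T) (there x∈) with ∈-─⁻ S T x∈
... | x∈S , x∉T = there x∈S , λ { (there x∈T) → x∉T x∈T }

lookup∈⋃ : ∀ {n k} (xs : Vec (Fin n) k) i → lookup xs i ∈ ⋃ (List.map ⁅_⁆ (toList xs))
lookup∈⋃ (x ∷ xs) zero    = x∈p∪q⁺ (inj₁ (x∈⁅x⁆ x))
lookup∈⋃ (x ∷ xs) (suc i) = x∈p∪q⁺ (inj₂ (lookup∈⋃ xs i))

∈⋃⇒lookup : ∀ {n k} (xs : Vec (Fin n) k) {x} → x ∈ ⋃ (List.map ⁅_⁆ (toList xs)) →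
            ∃ λ i → lookup xs i ≡ x
∈⋃⇒lookup []       x∈ = contradiction x∈ ∉⊥
∈⋃⇒lookup (y ∷ xs) x∈ with x∈p∪q⁻ ⁅ y ⁆ _ x∈
... | inj₁ x∈y = zero , sym (x∈⁅y⁆⇒x≡y y x∈y)
... | inj₂ x∈⋃ with ∈⋃⇒lookup xs x∈⋃
...   | i , eq = suc i , eq

-- Going round a cycle with indices modulo its length

module _ {l : ℕ} where

  private
    L = suc l

  toℕ-mod : ∀ k → toℕ (k mod L) ≡ k % L
  toℕ-mod k = Fin.toℕ-fromℕ< (m%n<n k L)

  suc-mod : ∀ k → suc (toℕ (k mod L)) mod L ≡ suc k mod L
  suc-mod k = Fin.toℕ-injective (begin
    toℕ (suc (toℕ (k mod L)) mod L)  ≡⟨ toℕ-mod (suc (toℕ (k mod L))) ⟩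
    suc (toℕ (k mod L)) % L          ≡⟨ cong (λ i → suc i % L) (toℕ-mod k) ⟩
    suc (k % L) % L                  ≡⟨ [m+kn]%n≡m%n (suc (k % L)) (k / L) L ⟨
    suc (k % L ℕ.+ k / L ℕ.* L) % L  ≡⟨ cong (λ i → suc i % L) (m≡m%n+[m/n]*n k L) ⟨
    suc k % L                        ≡⟨ toℕ-mod (suc k) ⟨
    toℕ (suc k mod L)                ∎)
    where open ≡.≡-Reasoning

  -- Equality would make `suc l` divide `suc t`, which is positive and smaller.
  +-mod-≢ : ∀ (i : Fin L) t → t ℕ.< l → (toℕ i ℕ.+ suc t) mod L ≢ i
  +-mod-≢ i t t<l eq = ℕ.<⇒≱ (ℕ.s≤s t<l) (∣⇒≤ (divides (k / L) (ℕ.+-cancelˡ-≡ (toℕ i) _ _ (begin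
    k                         ≡⟨ m≡m%n+[m/n]*n k L ⟩
    k % L ℕ.+ k / L ℕ.* L     ≡⟨ cong (ℕ._+ k / L ℕ.* L) (trans (sym (toℕ-mod k)) (cong toℕ eq)) ⟩
    toℕ i ℕ.+ k / L ℕ.* L     ∎))))
    where
    open ≡.≡-Reasoning
    k = toℕ i ℕ.+ suc t

  -- Go round the other way: the `l` steps that lead from the successor of `i` back to `i` all start
  -- at an index other than `i`.
  around : ∀ (g : Fin L → A) i → (∀ j → j ≢ i → g j ≡ g (suc (toℕ j) mod L)) →
           g i ≡ g (suc (toℕ i) mod L)
  around g i step = begin
    g i                              ≡⟨ cong g (Fin.toℕ-injective (sym
                                          (trans (toℕ-mod (toℕ i ℕ.+ L)) (trans ([m+n]%n≡m%n (toℕ i) L)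
                                                    (m<n⇒m%n≡m (Fin.toℕ<n i)))))) ⟩
    g ((toℕ i ℕ.+ suc l) mod L)      ≡⟨ walk l ℕ.≤-refl ⟨
    g ((toℕ i ℕ.+ 1) mod L)          ≡⟨ cong (λ k → g (k mod L)) (ℕ.+-comm (toℕ i) 1) ⟩
    g (suc (toℕ i) mod L)            ∎
    where
    open ≡.≡-Reasoning
    walk : ∀ t → t ℕ.≤ l → g ((toℕ i ℕ.+ 1) mod L) ≡ g ((toℕ i ℕ.+ suc t) mod L)
    walk zero    _   = refl
    walk (suc t) t<l = begin
      g ((toℕ i ℕ.+ 1) mod L)             ≡⟨ walk t (ℕ.<⇒≤ t<l) ⟩
      g ((toℕ i ℕ.+ suc t) mod L)         ≡⟨ step _ (+-mod-≢ i t t<l) ⟩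
      g (suc (toℕ ((toℕ i ℕ.+ suc t) mod L)) mod L)  ≡⟨ cong g (suc-mod (toℕ i ℕ.+ suc t)) ⟩
      g (suc (toℕ i ℕ.+ suc t) mod L)     ≡⟨ cong (λ k → g (k mod L)) (sym (ℕ.+-suc (toℕ i) (suc t))) ⟩
      g ((toℕ i ℕ.+ suc (suc t)) mod L)   ∎

module Colouring (G : Graph) {c} (colour : Fin (Graph.#V G) → Fin c) where

  open Graph G

  Mono : Fin #E → Set
  Mono e = colour (proj₁ (endpoints e)) ≡ colour (proj₂ (endpoints e))

  mono? : Decidable Mono
  mono? e = colour _ Fin.≟ colour _

  mono⇒≡ : ∀ {e u v} → Joins e u v → Mono e → colour u ≡ colour v
  mono⇒≡ (inj₁ refl) eq = eq
  mono⇒≡ (inj₂ refl) eq = sym eq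

  ≡⇒mono : ∀ {e u v} → Joins e u v → colour u ≡ colour v → Mono e
  ≡⇒mono (inj₁ refl) eq = eq
  ≡⇒mono (inj₂ refl) eq = sym eq

  -- The other edges of the cycle form a path between the ends of `e`, and the colour is constant
  -- along it.
  mono-closed : ∀ {C e} → IsCycleEdgeSet C → e ∈ C → (∀ x → x ∈ C → x ≢ e → Mono x) → Mono e
  mono-closed {e = e} (l , vs , es , (_ , es-unique , joins) , refl) e∈C mono
    with ∈⋃⇒lookup es e∈C
  ... | i , refl = ≡⇒mono (joins i) (around (colour ∘ lookup vs) i λ j j≢i →
          mono⇒≡ (joins j) (mono (lookup es j) (lookup∈⋃ es j)
                             (j≢i ∘ lookup-injective es-unique j i)))

-- Cancellation of the sets that are not faces

module Whitney (G : Graph) {ℓ} (_≼_ : Rel (Fin (Graph.#E G)) ℓ)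
  (≼-isTotalOrder : IsTotalOrder _≡_ _≼_) where

  open Graph G
  open CycleSearch G using (isCycleEdgeSet?)
  open BrokenCircuitComplex G _≼_ ≼-isTotalOrder
  private module ≼ = IsTotalOrder ≼-isTotalOrder

  -- `S` contains the broken circuit `C - e`. Whether `e` itself lies in `S` is left open, so that
  -- toggling `e` cannot change the relation.
  Breaks : Subset #E → Fin #E → Set ℓ
  Breaks S e = ∃ λ C → IsCycleEdgeSet C × IsMax C e × (∀ x → x ∈ C → x ≢ e → x ∈ S)

  breaks? : ∀ S e → Dec (Breaks S e)
  breaks? S e = anySubset? λ C →
    isCycleEdgeSet? C ×-dec isMax? C e ×-dec
    Fin.all? λ x → (x ∈? C) →-dec (¬? (x Fin.≟ e) →-dec (x ∈? S))

  breaks⇒¬face : ∀ {S e} → Breaks S e → ¬ IsFace S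
  breaks⇒¬face {S} {e} (C , cyc , max , ⊆S) face =
    face (C - e) (C , cyc , e , max , refl)
      (λ x∈ → let (x∈C , x∉e) = ∈-─⁻ C ⁅ e ⁆ x∈ in ⊆S _ x∈C λ { refl → x∉e (x∈⁅x⁆ e) })

  ¬breaks⇒face : ∀ {S} → (∀ e → ¬ Breaks S e) → IsFace S
  ¬breaks⇒face none B (C , cyc , e , max , refl) B⊆S =
    none e (C , cyc , max , λ x x∈C x≢e → B⊆S (x∈p∧x≢y⇒x∈p-y x∈C x≢e))

  -- The broken circuit completed by `x` consists of edges strictly below `x`, hence strictly below
  -- `e`. It therefore does not contain `e` and survives the toggle.
  breaks-toggle : ∀ {S e x} → x ≼ e → Breaks S x → Breaks (toggle e S) x
  breaks-toggle {S} {e} {x} x≼e (C , cyc , (x∈C , max) , ⊆S) =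
    C , cyc , (x∈C , max) , λ y y∈C y≢x →
      ∈-toggle {S = S} (λ { refl → y≢x (≼.antisym (max _ y∈C) x≼e) }) (⊆S y y∈C y≢x)

  LeastBreak : Subset #E → Fin #E → Set ℓ
  LeastBreak S e = Breaks S e × (∀ x → Breaks S x → e ≼ x)

  leastBreak? : ∀ S e → Dec (LeastBreak S e)
  leastBreak? S e = breaks? S e ×-dec Fin.all? λ x → breaks? S x →-dec (e ≼? x)

  -- An edge `x` below `e` that breaks the toggled set also breaks `S`, by toggling back; so
  -- minimality carries over and `e` is again the edge to toggle.
  leastBreak-toggle : ∀ {S e} → LeastBreak S e → LeastBreak (toggle e S) e
  leastBreak-toggle {S} {e} (br , min) = breaks-toggle ≼.refl br , min′
    where
    min′ : ∀ x → Breaks (toggle e S) x → e ≼ x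
    min′ x br′ with ≼.total e x
    ... | inj₁ e≼x = e≼x
    ... | inj₂ x≼e =
      min x (subst (λ T → Breaks T x) (toggle-involutive e S) (breaks-toggle x≼e br′))

  -- A partition of unity on edge sets: a set that is not a face has exactly one least breaking
  -- edge. Multiplied by a weight and summed, it splits the sum over all sets into the faces and one
  -- part for each edge.
  face+leastBreaks : ∀ S → ⟦ isFace? S ⟧ ℤ.+ ∑ (allFin #E) (λ e → ⟦ leastBreak? S e ⟧) ≡ 1ℤ
  face+leastBreaks S = cases (Fin.any? (breaks? S))
    where
    cases : Dec (∃ (Breaks S)) →
            ⟦ isFace? S ⟧ ℤ.+ ∑ (allFin #E) (λ e → ⟦ leastBreak? S e ⟧) ≡ 1ℤ
    cases (yes br) = let (e , bre , min) = least ≼-isTotalOrder (breaks? S) br in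
      cong₂ ℤ._+_ (⟦⟧-no (isFace? S) (breaks⇒¬face bre))
        (trans (∑-single (λ e → ⟦ leastBreak? S e ⟧) (List.allFin⁺ #E) (∈-allFin e)
                  (λ {x} _ x≢e → ⟦⟧-no (leastBreak? S x) λ (brx , minx) →
                     x≢e (≼.antisym (minx e bre) (min x brx))))
               (⟦⟧-yes (leastBreak? S e) (bre , min)))
    cases (no none) =
      cong₂ ℤ._+_ (⟦⟧-yes (isFace? S) (¬breaks⇒face λ e br → none (e , br)))
        (∑-zero (allFin #E) λ e → ⟦⟧-no (leastBreak? S e) λ (br , _) → none (e , br))

  -- Toggling the least edge completing a broken circuit of S to a cycle cancels all non-faces.
  -- Monochromatic edge sets are closed under such completions, so the toggle stays inside them.
  ∑-faces : ∀ {q} (colour : Fin #V → Fin q) → let open Colouring G colour in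
            ∑ (subsets #E) (λ S → ⟦ isFace? S ⟧ ℤ.* (⟦ S ⊆′? mono? ⟧ ℤ.* sign S)) ≡
            ⟦ Fin.all? (¬? ∘ mono?) ⟧
  ∑-faces colour = begin
    ∑ (subsets #E) (λ S → ⟦ isFace? S ⟧ ℤ.* w S)
      ≡⟨ ℤ.+-identityʳ _ ⟨
    ∑ (subsets #E) (λ S → ⟦ isFace? S ⟧ ℤ.* w S) ℤ.+ 0ℤ
      ≡⟨ cong (ℤ._+_ (∑ (subsets #E) (λ S → ⟦ isFace? S ⟧ ℤ.* w S))) nonfaces ⟨
    ∑ (subsets #E) (λ S → ⟦ isFace? S ⟧ ℤ.* w S) ℤ.+
    ∑ (subsets #E) (λ S → ∑ (allFin #E) (λ e → ⟦ leastBreak? S e ⟧) ℤ.* w S)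
      ≡⟨ ∑-+ (subsets #E) _ _ ⟨
    ∑ (subsets #E) (λ S → ⟦ isFace? S ⟧ ℤ.* w S ℤ.+ ∑ (allFin #E) (λ e → ⟦ leastBreak? S e ⟧) ℤ.* w S)
      ≡⟨ ∑-cong (subsets #E) (λ S → trans (sym (ℤ.*-distribʳ-+ (w S) ⟦ isFace? S ⟧ _))
           (trans (cong (ℤ._* w S) (face+leastBreaks S)) (ℤ.*-identityˡ (w S)))) ⟩
    ∑ (subsets #E) w
      ≡⟨ ∑-⊆′-sign mono? ⟩
    ⟦ Fin.all? (¬? ∘ mono?) ⟧
      ∎
    where
    open ≡.≡-Reasoning
    open Colouring G colour

    w : Subset #E → ℤ
    w S = ⟦ S ⊆′? mono? ⟧ ℤ.* sign S

    -- For fixed `e` these are the sets that contribute to the part of `e`; the toggle preserves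
    -- them and reverses the sign, so each part sums to zero.
    Good : Fin #E → Subset #E → Set ℓ
    Good e S = LeastBreak S e × S ⊆′ Mono

    good-toggle : ∀ {e S} → Good e S → Good e (toggle e S)
    good-toggle (lb@((C , cyc , (e∈C , _) , ⊆S) , _) , S⊆) =
      leastBreak-toggle lb ,
      ⊆′-toggle {M = Mono} (mono-closed cyc e∈C λ x x∈C x≢e → S⊆ x (⊆S x x∈C x≢e)) S⊆

    good? : ∀ e S → Dec (Good e S)
    good? e S = leastBreak? S e ×-dec (S ⊆′? mono?)

    good-sum : ∀ e → ∑ (subsets #E) (λ S → ⟦ leastBreak? S e ⟧ ℤ.* w S) ≡ 0ℤ
    good-sum e = begin
      ∑ (subsets #E) (λ S → ⟦ leastBreak? S e ⟧ ℤ.* w S)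
        ≡⟨ ∑-cong (subsets #E) (λ S → trans (sym (ℤ.*-assoc ⟦ leastBreak? S e ⟧ _ _))
             (cong (ℤ._* sign S) (sym (⟦⟧-× (leastBreak? S e) (S ⊆′? mono?))))) ⟩
      ∑ (subsets #E) (λ S → ⟦ good? e S ⟧ ℤ.* sign S)
        ≡⟨ ∑-toggle-odd e _ (λ S → trans
             (cong₂ ℤ._*_ (⟦⟧-cong (good? e (toggle e S)) (good? e S)
                (subst (Good e) (toggle-involutive e S) ∘ good-toggle) good-toggle)
                (sign-toggle e S))
             (sym (ℤ.neg-distribʳ-* ⟦ good? e S ⟧ (sign S)))) ⟩
      0ℤ ∎

    nonfaces : ∑ (subsets #E) (λ S → ∑ (allFin #E) (λ e → ⟦ leastBreak? S e ⟧) ℤ.* w S) ≡ 0ℤ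
    nonfaces = begin
      ∑ (subsets #E) (λ S → ∑ (allFin #E) (λ e → ⟦ leastBreak? S e ⟧) ℤ.* w S)
        ≡⟨ ∑-cong (subsets #E) (λ S → sym (∑-*ʳ (allFin #E) (w S) _)) ⟩
      ∑ (subsets #E) (λ S → ∑ (allFin #E) (λ e → ⟦ leastBreak? S e ⟧ ℤ.* w S))
        ≡⟨ ∑-swap (subsets #E) (allFin #E) _ ⟩
      ∑ (allFin #E) (λ e → ∑ (subsets #E) (λ S → ⟦ leastBreak? S e ⟧ ℤ.* w S))
        ≡⟨ ∑-zero (allFin #E) good-sum ⟩
      0ℤ ∎

-- Counting the colourings that are constant along the edges of a face

tuples : List A → ∀ n → List (Vec A n)
tuples xs zero    = [] ∷ []
tuples xs (suc n) = List.cartesianProductWith _∷_ xs (tuples xs n)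

∑-cartesianProductWith : ∀ {c} {C : Set c} (f : A → B → C) xs ys (w : C → ℤ) →
  ∑ (List.cartesianProductWith f xs ys) w ≡ ∑ xs (λ x → ∑ ys (λ y → w (f x y)))
∑-cartesianProductWith f []       ys w = refl
∑-cartesianProductWith f (x ∷ xs) ys w =
  trans (∑-++ (List.map (f x) ys) _ w)
        (cong₂ ℤ._+_ (∑-map (f x) ys w) (∑-cartesianProductWith f xs ys w))

tuples-unique : ∀ {xs : List A} → List.Unique xs → ∀ n → List.Unique (tuples xs n)
tuples-unique u zero    = [] ∷ []
tuples-unique u (suc n) = List.cartesianProductWith⁺ _∷_ (λ { refl → refl , refl }) u (tuples-unique u n)

∈-tuples : ∀ {xs : List A} {n} (v : Vec A n) → (∀ i → lookup v i ∈ˡ xs) → v ∈ˡ tuples xs n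
∈-tuples []      _  = here refl
∈-tuples (x ∷ v) v∈ = ∈-cartesianProductWith⁺ _∷_ (v∈ zero) (∈-tuples v (v∈ ∘ suc))

∑-const : ∀ (xs : List A) k → ∑ xs (λ _ → k) ≡ + length xs ℤ.* k
∑-const []       k = refl
∑-const (x ∷ xs) k = trans (cong (ℤ._+_ k) (∑-const xs k)) (sym (ℤ.suc-* (+ length xs) k))

∑-tuples-1 : ∀ (xs : List A) n → ∑ (tuples xs n) (λ _ → 1ℤ) ≡ + (length xs ℕ.^ n)
∑-tuples-1 xs zero    = refl
∑-tuples-1 xs (suc n) = begin
  ∑ (tuples xs (suc n)) (λ _ → 1ℤ)            ≡⟨ ∑-cartesianProductWith _∷_ xs (tuples xs n) _ ⟩
  ∑ xs (λ _ → ∑ (tuples xs n) (λ _ → 1ℤ))     ≡⟨ ∑-const xs _ ⟩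
  + length xs ℤ.* ∑ (tuples xs n) (λ _ → 1ℤ)  ≡⟨ cong (ℤ._*_ (+ length xs)) (∑-tuples-1 xs n) ⟩
  + length xs ℤ.* + (length xs ℕ.^ n)         ≡⟨ ℤ.pos-* (length xs) _ ⟨
  + (length xs ℕ.^ suc n)                     ∎
  where open ≡.≡-Reasoning

colourings : ∀ q n → List (Vec (Fin q) n)
colourings q = tuples (allFin q)

elements : ∀ {n} → Subset n → List (Fin n)
elements []            = []
elements (inside  ∷ S) = zero ∷ List.map suc (elements S)
elements (outside ∷ S) = List.map suc (elements S)

length-elements : ∀ {n} (S : Subset n) → length (elements S) ≡ ∣ S ∣
length-elements []            = refl
length-elements (inside  ∷ S) = cong suc (trans (List.length-map suc (elements S)) (length-elements S))
length-elements (outside ∷ S) = trans (List.length-map suc (elements S)) (length-elements S)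

elements-unique : ∀ {n} (S : Subset n) → List.Unique (elements S)
elements-unique []            = []
elements-unique (inside  ∷ S) =
  All.map⁺ (All.universal (λ _ ()) (elements S)) ∷ List.map⁺ Fin.suc-injective (elements-unique S)
elements-unique (outside ∷ S) = List.map⁺ Fin.suc-injective (elements-unique S)

∈-elements⁺ : ∀ {n} {x : Fin n} {S} → x ∈ S → x ∈ˡ elements S
∈-elements⁺ {S = inside  ∷ S} here       = here refl
∈-elements⁺ {S = inside  ∷ S} (there x∈) = there (∈-map⁺ suc (∈-elements⁺ x∈))
∈-elements⁺ {S = outside ∷ S} (there x∈) = ∈-map⁺ suc (∈-elements⁺ x∈)

∈-elements⁻ : ∀ {n} {x : Fin n} S → x ∈ˡ elements S → x ∈ S
∈-elements⁻ (inside  ∷ S) (here refl) = here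
∈-elements⁻ (inside  ∷ S) (there x∈) with ∈-map⁻ suc x∈
... | _ , y∈ , refl = there (∈-elements⁻ S y∈)
∈-elements⁻ (outside ∷ S) x∈ with ∈-map⁻ suc x∈
... | _ , y∈ , refl = there (∈-elements⁻ S y∈)

-- at xs y reads the sequence xs followed by y, y, y, …
at : ∀ {n} → Vec A n → A → ℕ → A
at []       y _       = y
at (x ∷ xs) y zero    = x
at (x ∷ xs) y (suc k) = at xs y k

at-lookup : ∀ {n} (xs : Vec A n) y i → at xs y (toℕ i) ≡ lookup xs i
at-lookup (x ∷ xs) y zero    = refl
at-lookup (x ∷ xs) y (suc i) = at-lookup xs y i

at-end : ∀ {n} (xs : Vec A n) y → at xs y n ≡ y
at-end []       y = refl
at-end (x ∷ xs) y = at-end xs y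

-- Translates between paths and cycles: the cyclic successor of the last index wraps round to `y`,
-- which is also the value that `at` takes beyond the end of `xs`.
lookup-cyclic : ∀ {l} (xs : Vec A l) y k → k ℕ.≤ l → lookup (y ∷ xs) (suc k mod suc l) ≡ at xs y k
lookup-cyclic {l = l} xs y k k≤l with ℕ.m≤n⇒m<n∨m≡n k≤l
... | inj₁ k<l = trans
  (cong (lookup (y ∷ xs)) {x = suc k mod suc l} {y = suc (fromℕ< k<l)} (Fin.toℕ-injective
    (trans (toℕ-mod {l} (suc k)) (trans (m<n⇒m%n≡m (ℕ.s≤s k<l)) (cong suc (sym (Fin.toℕ-fromℕ< k<l)))))))
  (trans (sym (at-lookup xs y (fromℕ< k<l))) (cong (at xs y) (Fin.toℕ-fromℕ< k<l)))
... | inj₂ refl = trans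
  (cong (lookup (y ∷ xs)) {x = suc l mod suc l} {y = zero} (Fin.toℕ-injective (trans (toℕ-mod {l} (suc l)) (n%n≡0 (suc l)))))
  (sym (at-end xs y))

-- Paths, forests and their components

module Paths (G : Graph) where

  open Graph G

  joins-end : ∀ {e u v x y} → Joins e u v → Joins e x y → u ≡ x ⊎ u ≡ y
  joins-end (inj₁ refl) (inj₁ refl) = inj₁ refl
  joins-end (inj₁ refl) (inj₂ refl) = inj₂ refl
  joins-end (inj₂ refl) (inj₁ refl) = inj₂ refl
  joins-end (inj₂ refl) (inj₂ refl) = inj₁ refl

  Connected : List (Fin #E) → Rel (Fin #V) _
  Connected es = Star (λ u v → ∃ λ e → e ∈ˡ es × Joins e u v)

  -- The vertices listed by a simple path exclude its last vertex w.
  data Path (es : List (Fin #E)) (w : Fin #V) :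
            Fin #V → ∀ {l} → Vec (Fin #V) l → Vec (Fin #E) l → Set where
    done : Path es w w [] []
    step : ∀ {e u v l} {vs : Vec _ l} {ps} → e ∈ˡ es → Joins e u v →
           u ≢ w → (∀ i → u ≢ lookup vs i) →
           Path es w v vs ps → Path es w u (u ∷ vs) (e ∷ ps)

  path-suffix : ∀ {es w v l} {vs : Vec _ l} {ps} → Path es w v vs ps → ∀ i →
                ∃ λ k → Σ (Vec _ k) λ vs′ → Σ (Vec _ k) λ ps′ → Path es w (lookup vs i) vs′ ps′
  path-suffix p@(step _ _ _ _ _) zero    = _ , _ , _ , p
  path-suffix (step _ _ _ _ p)   (suc i) = path-suffix p i

  -- Loop erasure: if the new first vertex `u` already lies on the simple path built so far, keep
  -- only the suffix from that vertex; if `u` is the end `w`, keep nothing.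
  toPath : ∀ {es u w} → Connected es u w →
           ∃ λ l → Σ (Vec _ l) λ vs → Σ (Vec _ l) λ ps → Path es w u vs ps
  toPath ε = _ , _ , _ , done
  toPath {u = u} {w} ((e , e∈ , j) ◅ rest) with toPath rest
  ... | l , vs , ps , p with u Fin.≟ w | Fin.any? (λ i → lookup vs i Fin.≟ u)
  ...   | yes refl | _              = _ , _ , _ , done
  ...   | no  _    | yes (i , refl) = path-suffix p i
  ...   | no  u≢w  | no  none       = _ , _ , _ , step e∈ j u≢w (λ i eq → none (i , sym eq)) p

  module _ {es : List (Fin #E)} {w : Fin #V} where

    path-start : ∀ {u l} {vs : Vec _ l} {ps} → Path es w u vs ps → at vs w 0 ≡ u
    path-start done             = refl
    path-start (step _ _ _ _ _) = refl

    path-start-∈ : ∀ {u l} {vs : Vec _ l} {ps} → Path es w u vs ps → u ≡ w ⊎ ∃ λ i → u ≡ lookup vs i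
    path-start-∈ done             = inj₁ refl
    path-start-∈ (step _ _ _ _ _) = inj₂ (zero , refl)

    path-joins : ∀ {u l} {vs : Vec _ l} {ps} → Path es w u vs ps → ∀ i →
                 Joins (lookup ps i) (lookup vs i) (at vs w (suc (toℕ i)))
    path-joins (step {e} {u} _ j _ _ p) zero = subst (Joins e u) (sym (path-start p)) j
    path-joins (step _ _ _ _ p) (suc i) = path-joins p i

    path-edges : ∀ {u l} {vs : Vec _ l} {ps} → Path es w u vs ps → ∀ i → lookup ps i ∈ˡ es
    path-edges (step e∈ _ _ _ _) zero    = e∈
    path-edges (step _ _ _ _ p)  (suc i) = path-edges p i

    path-avoids-end : ∀ {u l} {vs : Vec _ l} {ps} → Path es w u vs ps → ∀ i → w ≢ lookup vs i
    path-avoids-end (step _ _ u≢w _ _) zero    = u≢w ∘ sym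
    path-avoids-end (step _ _ _ _ p)   (suc i) = path-avoids-end p i

    path-vertices-unique : ∀ {u l} {vs : Vec _ l} {ps} → Path es w u vs ps → Unique vs
    path-vertices-unique done              = []
    path-vertices-unique (step _ _ _ new p) = VecAll.lookup⁻ new ∷ path-vertices-unique p

    path-incident : ∀ {u l} {vs : Vec _ l} {ps} → Path es w u vs ps → ∀ i {x y} →
                    Joins (lookup ps i) x y → x ≡ w ⊎ ∃ λ k → x ≡ lookup vs k
    path-incident (step _ j _ _ p) zero j′ with joins-end j′ j
    ... | inj₁ refl = inj₂ (zero , refl)
    ... | inj₂ refl with path-start-∈ p
    ...   | inj₁ eq       = inj₁ eq
    ...   | inj₂ (k , eq) = inj₂ (suc k , eq)
    path-incident (step _ _ _ _ p) (suc i) j′ with path-incident p i j′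
    ... | inj₁ eq       = inj₁ eq
    ... | inj₂ (k , eq) = inj₂ (suc k , eq)

    -- If the first edge occurred again, its end `u` would be incident with a later edge and so lie
    -- on the rest of the path, against the freshness of `u`.
    path-edges-unique : ∀ {u l} {vs : Vec _ l} {ps} → Path es w u vs ps → Unique ps
    path-edges-unique done = []
    path-edges-unique (step {e} _ j u≢w new p) =
      VecAll.lookup⁻ (λ i e≡ → [ u≢w , (λ (k , eq) → new k eq) ]′
                                (path-incident p i (subst (λ e → Joins e _ _) e≡ j)))
      ∷ path-edges-unique p

    -- Since a path does not list its last vertex `w`, putting `w` in front and `e` before the edges
    -- closes it up without repetition. The edge `e` is new because it is not in `es`.
    path-cycle : ∀ {u l e} {vs : Vec _ l} {ps} → Path es w u vs ps →
                 Joins e w u → ¬ e ∈ˡ es → IsCycle (w ∷ vs) (e ∷ ps)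
    path-cycle {u} {l} {e} {vs} {ps} p j e∉ =
      (VecAll.lookup⁻ (path-avoids-end p) ∷ path-vertices-unique p) ,
      (VecAll.lookup⁻ (λ i eq → e∉ (subst (_∈ˡ es) (sym eq) (path-edges p i))) ∷ path-edges-unique p) ,
      joins
      where
      joins : ∀ i → Joins (lookup (e ∷ ps) i) (lookup (w ∷ vs) i)
                          (lookup (w ∷ vs) (suc (toℕ i) mod suc l))
      joins zero    = subst (Joins e w)
        (sym (trans (lookup-cyclic vs w 0 ℕ.z≤n) (path-start p))) j
      joins (suc i) = subst (Joins (lookup ps i) (lookup vs i))
        (sym (lookup-cyclic vs w (suc (toℕ i)) (Fin.toℕ<n i))) (path-joins p i)

  Acyclic : List (Fin #E) → Set
  Acyclic es = ∀ {l} (vs : Vec _ (suc l)) ps → IsCycle vs ps → ¬ (∀ i → lookup ps i ∈ˡ es)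

  -- The section `rep` picks one vertex from each component, so that a colouring constant along `es`
  -- is determined by its values there. The size equation records that each edge of a forest lowers
  -- the number of components by one.
  record Components (es : List (Fin #E)) : Set where
    field
      k         : ℕ
      k+∣es∣≡∣V∣ : k ℕ.+ length es ≡ #V
      class     : Fin #V → Fin k
      rep       : Fin k → Fin #V
      class-rep : ∀ c → class (rep c) ≡ c
      joined    : ∀ {e u v} → e ∈ˡ es → Joins e u v → class u ≡ class v
      connected : ∀ {u v} → class u ≡ class v → Connected es u v

  module Merge {k} {x y : Fin (suc k)} (y≢x : y ≢ x) where

    -- Identifies the label `y` with `x` and closes the gap left by `y`.
    merge : Fin (suc k) → Fin k
    merge c with y Fin.≟ c
    ... | yes _  = punchOut y≢x
    ... | no y≢c = punchOut y≢c

    merge-y : merge y ≡ merge x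
    merge-y with y Fin.≟ y | y Fin.≟ x
    ... | yes _  | no _    = Fin.punchOut-cong y refl
    ... | no y≢y | _       = contradiction refl y≢y
    ... | yes _  | yes y≡x = contradiction y≡x y≢x

    merge-punchIn : ∀ c → merge (punchIn y c) ≡ c
    merge-punchIn c with y Fin.≟ punchIn y c
    ... | yes eq = contradiction (sym eq) (Fin.punchInᵢ≢i y c)
    ... | no _   = trans (Fin.punchOut-cong y refl) (Fin.punchOut-punchIn y)

    merge-injective : ∀ {c d} → merge c ≡ merge d → c ≡ d ⊎ (c ≡ y × d ≡ x) ⊎ (c ≡ x × d ≡ y)
    merge-injective {c} {d} eq with y Fin.≟ c | y Fin.≟ d
    ... | yes refl | yes refl = inj₁ refl
    ... | yes refl | no y≢d   = inj₂ (inj₁ (refl , sym (Fin.punchOut-injective y≢x y≢d eq)))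
    ... | no y≢c   | yes refl = inj₂ (inj₂ (Fin.punchOut-injective y≢c y≢x eq , refl))
    ... | no y≢c   | no y≢d   = inj₁ (Fin.punchOut-injective y≢c y≢d eq)

  -- Edges are added one at a time. The ends of a new edge lie in different components, since a path
  -- between them would close up with it to a cycle; merging these two components lowers `k` by
  -- exactly one.
  components : ∀ es → List.Unique es → Acyclic es → Components es
  components [] _ _ = record
    { k = #V ; k+∣es∣≡∣V∣ = ℕ.+-identityʳ #V ; class = id ; rep = id
    ; class-rep = λ _ → refl ; joined = λ () ; connected = λ { refl → ε } }
  components (e ∷ es) (e≢ ∷ unique) acyclic =
    extend (components es unique λ vs ps cyc ⊆es → acyclic vs ps cyc (there ∘ ⊆es))
    where
    x y : Fin #V
    x = proj₁ (endpoints e)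
    y = proj₂ (endpoints e)

    disconnected : ¬ Connected es y x
    disconnected y~x with toPath y~x
    ... | _ , vs , ps , p = acyclic _ _
      (path-cycle p (inj₁ refl) (λ e∈ → All.lookup e≢ e∈ refl))
      (λ { zero → here refl ; (suc i) → there (path-edges p i) })

    extend : Components es → Components (e ∷ es)
    extend record { k = zero ; class = class } = contradiction (class x) λ ()
    extend record { k = suc k ; k+∣es∣≡∣V∣ = size ; class = class ; rep = rep
                  ; class-rep = class-rep ; joined = joined ; connected = connected } = record
      { k = k
      ; k+∣es∣≡∣V∣ = trans (ℕ.+-suc k (length es)) size
      ; class = merge ∘ class
      ; rep = rep ∘ punchIn (class y)
      ; class-rep = λ c → trans (cong merge (class-rep _)) (merge-punchIn c)
      ; joined = λ { (here refl) (inj₁ refl) → sym merge-y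
                   ; (here refl) (inj₂ refl) → merge-y
                   ; (there e∈) j → cong merge (joined e∈ j) }
      ; connected = connected′
      }
      where
      open Merge {x = class x} {y = class y} (disconnected ∘ connected)

      weaken : ∀ {u v} → Connected es u v → Connected (e ∷ es) u v
      weaken = Star.map λ (f , f∈ , j) → f , there f∈ , j

      connected′ : ∀ {u v} → merge (class u) ≡ merge (class v) → Connected (e ∷ es) u v
      connected′ eq with merge-injective eq
      ... | inj₁ same = weaken (connected same)
      ... | inj₂ (inj₁ (u~y , v~x)) =
        weaken (connected u~y) ◅◅ ((e , here refl , inj₂ refl) ◅ weaken (connected (sym v~x)))
      ... | inj₂ (inj₂ (u~x , v~y)) =
        weaken (connected u~x) ◅◅ ((e , here refl , inj₁ refl) ◅ weaken (connected (sym v~y)))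

  module _ (S : Subset #E) (C : Components (elements S)) (q : ℕ) where

    open Components C

    Constant : Vec (Fin q) #V → Set
    Constant f = S ⊆′ Colouring.Mono G (lookup f)

    constant? : Decidable Constant
    constant? f = S ⊆′? Colouring.mono? G (lookup f)

    pull : Vec (Fin q) k → Vec (Fin q) #V
    pull g = tabulate (lookup g ∘ class)

    lookup-pull : ∀ g u → lookup (pull g) u ≡ lookup g (class u)
    lookup-pull g u = Vec.lookup∘tabulate (lookup g ∘ class) u

    pull-constant : ∀ g → Constant (pull g)
    pull-constant g e e∈S = trans (lookup-pull g _) (trans
      (cong (lookup g) (joined (∈-elements⁺ e∈S) (inj₁ refl))) (sym (lookup-pull g _)))

    constant⇒connected : ∀ f → Constant f → ∀ {u v} → Connected (elements S) u v → lookup f u ≡ lookup f v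
    constant⇒connected f const ε = refl
    constant⇒connected f const ((e , e∈ , j) ◅ rest) =
      trans (Colouring.mono⇒≡ G (lookup f) j (const e (∈-elements⁻ S e∈)))
            (constant⇒connected f const rest)

    _≟ᶜ_ : ∀ {n} (f g : Vec (Fin q) n) → Dec (f ≡ g)
    _≟ᶜ_ = Vec.≡-dec Fin._≟_

    -- A colouring is constant along `S` exactly when it factors through `class`, and then only
    -- `push`, its restriction to the representatives, can be the factor. So the sum on the right
    -- has at most one nonzero term.
    constant-pull : ∀ f → ⟦ constant? f ⟧ ≡ ∑ (colourings q k) (λ g → ⟦ f ≟ᶜ pull g ⟧)
    constant-pull f = cases (constant? f)
      where
      push : Vec (Fin q) k
      push = tabulate (lookup f ∘ rep)

      pull-push : Constant f → f ≡ pull push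
      pull-push const = trans (sym (Vec.tabulate∘lookup f)) (Vec.tabulate-cong λ u →
        trans (constant⇒connected f const (connected (sym (class-rep (class u)))))
              (sym (Vec.lookup∘tabulate (lookup f ∘ rep) (class u))))

      push-pull : ∀ g → f ≡ pull g → g ≡ push
      push-pull g refl = trans (sym (Vec.tabulate∘lookup g)) (Vec.tabulate-cong λ c →
        sym (trans (lookup-pull g (rep c)) (cong (lookup g) (class-rep c))))

      cases : Dec (Constant f) → _
      cases (yes const) = trans (⟦⟧-yes (constant? f) const) (sym (trans
        (∑-single _ (tuples-unique (List.allFin⁺ q) k) (∈-tuples push λ i → ∈-allFin _)
           (λ {g} _ g≢ → ⟦⟧-no (f ≟ᶜ pull g) (g≢ ∘ push-pull g)))
        (⟦⟧-yes (f ≟ᶜ pull push) (pull-push const))))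
      cases (no ¬const) = trans (⟦⟧-no (constant? f) ¬const) (sym
        (∑-zero (colourings q k) λ g → ⟦⟧-no (f ≟ᶜ pull g) λ { refl → ¬const (pull-constant g) }))

    -- Double counting in place of a bijection: after the interchange of sums, each of the q^k
    -- colourings `g` of the components contributes its single pull-back.
    ∑-constant : ∑ (colourings q #V) (λ f → ⟦ constant? f ⟧) ≡ + (q ℕ.^ k)
    ∑-constant = begin
      ∑ (colourings q #V) (λ f → ⟦ constant? f ⟧)
        ≡⟨ ∑-cong (colourings q #V) constant-pull ⟩
      ∑ (colourings q #V) (λ f → ∑ (colourings q k) (λ g → ⟦ f ≟ᶜ pull g ⟧))
        ≡⟨ ∑-swap (colourings q #V) (colourings q k) _ ⟩
      ∑ (colourings q k) (λ g → ∑ (colourings q #V) (λ f → ⟦ f ≟ᶜ pull g ⟧))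
        ≡⟨ ∑-cong (colourings q k) (λ g → trans
             (∑-single _ (tuples-unique (List.allFin⁺ q) #V) (∈-tuples (pull g) λ i → ∈-allFin _)
                (λ {f} _ f≢ → ⟦⟧-no (f ≟ᶜ pull g) f≢))
             (⟦⟧-yes (pull g ≟ᶜ pull g) refl)) ⟩
      ∑ (colourings q k) (λ _ → 1ℤ)
        ≡⟨ ∑-tuples-1 (allFin q) k ⟩
      + (length (allFin q) ℕ.^ k)
        ≡⟨ cong (λ n → + (n ℕ.^ k)) (List.length-tabulate id) ⟩
      + (q ℕ.^ k)
        ∎
      where open ≡.≡-Reasoning

-- From faces to the chromatic polynomial

module ChromaticPolynomial (G : Graph) {ℓ} (_≼_ : Rel (Fin (Graph.#E G)) ℓ)
  (≼-isTotalOrder : IsTotalOrder _≡_ _≼_) where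

  open Graph G
  open Paths G
  open BrokenCircuitComplex G _≼_ ≼-isTotalOrder
  open Whitney G _≼_ ≼-isTotalOrder

  -- Removing the largest edge of a cycle inside `S` exhibits a broken circuit inside `S`. The
  -- largest edge is the least one for the reversed order.
  face⇒acyclic : ∀ {S} → IsFace S → Acyclic (elements S)
  face⇒acyclic {S} face vs ps cyc ⊆S = broken
    (least (Flip.isTotalOrder ≼-isTotalOrder) (_∈? C) (lookup ps zero , lookup∈⋃ ps zero))
    where
    C : Subset #E
    C = ⋃ (List.map ⁅_⁆ (toList ps))

    C⊆S : ∀ {x} → x ∈ C → x ∈ S
    C⊆S x∈C with ∈⋃⇒lookup ps x∈C
    ... | i , refl = ∈-elements⁻ S (⊆S i)

    broken : ¬ ∃ λ e → e ∈ C × (∀ f → f ∈ C → f ≼ e)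
    broken (e , max) = breaks⇒¬face
      (C , (_ , vs , ps , cyc , refl) , max , λ x x∈C _ → C⊆S x∈C) face

  face-components : ∀ {S} → IsFace S → Components (elements S)
  face-components {S} face = components (elements S) (elements-unique S) (face⇒acyclic face)

  -- The map from the vertices to `Fin k` is carried along so that `k = 0` can be excluded once
  -- there is a vertex.
  face-size : ∀ {S} → IsFace S → ∃ λ k → k ℕ.+ ∣ S ∣ ≡ #V × (Fin #V → Fin k) ×
              (∀ q → ∑ (colourings q #V) (λ f → ⟦ S ⊆′? Colouring.mono? G (lookup f) ⟧) ≡ + (q ℕ.^ k))
  face-size {S} face =
    k , trans (cong (k ℕ.+_) (sym (length-elements S))) k+∣es∣≡∣V∣ , class , ∑-constant S (face-components face)
    where open Components (face-components face)

  proper? : ∀ {q} (f : Vec (Fin q) #V) → Dec (∀ e → ¬ Colouring.Mono G (lookup f) e)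
  proper? f = Fin.all? (¬? ∘ Colouring.mono? G (lookup f))

  face-≤ : ∀ {S} → IsFace S → ∣ S ∣ ℕ.≤ #V
  face-≤ {S} face = let (k , size , _) = face-size face in subst (∣ S ∣ ℕ.≤_) size (ℕ.m≤n+m ∣ S ∣ k)

  chromatic : ∀ q → ∑ (colourings q #V) (λ f → ⟦ proper? f ⟧) ≡
                    ∑ (subsets #E) (λ S → ⟦ isFace? S ⟧ ℤ.* (sign S ℤ.* + (q ℕ.^ (#V ℕ.∸ ∣ S ∣))))
  chromatic q = begin
    ∑ (colourings q #V) (λ f → ⟦ proper? f ⟧)
      ≡⟨ ∑-cong (colourings q #V) (λ f → sym (∑-faces (lookup f))) ⟩
    ∑ (colourings q #V) (λ f → ∑ (subsets #E) (λ S → ⟦ isFace? S ⟧ ℤ.* (ind f S ℤ.* sign S)))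
      ≡⟨ ∑-swap (colourings q #V) (subsets #E) _ ⟩
    ∑ (subsets #E) (λ S → ∑ (colourings q #V) (λ f → ⟦ isFace? S ⟧ ℤ.* (ind f S ℤ.* sign S)))
      ≡⟨ ∑-cong (subsets #E) (λ S → trans (∑-*ˡ (colourings q #V) ⟦ isFace? S ⟧ _)
           (trans (cong (ℤ._*_ ⟦ isFace? S ⟧) (∑-*ʳ (colourings q #V) (sign S) _)) (count S (isFace? S)))) ⟩
    ∑ (subsets #E) (λ S → ⟦ isFace? S ⟧ ℤ.* (sign S ℤ.* + (q ℕ.^ (#V ℕ.∸ ∣ S ∣))))
      ∎
    where
    open ≡.≡-Reasoning

    ind : Vec (Fin q) #V → Subset #E → ℤ
    ind f S = ⟦ S ⊆′? Colouring.mono? G (lookup f) ⟧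

    count : ∀ S (face? : Dec (IsFace S)) →
      ⟦ face? ⟧ ℤ.* (∑ (colourings q #V) (λ f → ind f S) ℤ.* sign S) ≡
      ⟦ face? ⟧ ℤ.* (sign S ℤ.* + (q ℕ.^ (#V ℕ.∸ ∣ S ∣)))
    count S (no _)     = refl
    count S (yes face) with face-size face
    ... | k , size , _ , number = cong (ℤ._*_ 1ℤ) (trans
      (cong (ℤ._* sign S) (trans (number q) (cong (λ n → + (q ℕ.^ n))
        (sym (trans (cong (ℕ._∸ ∣ S ∣) (sym size)) (ℕ.m+n∸n≡m k ∣ S ∣))))))
      (ℤ.*-comm _ (sign S)))

-- Stirling numbers

⊆′⇒⊆ : ∀ {n} {S T : Subset n} → S ⊆′ (_∈ T) → S ⊆ T
⊆′⇒⊆ S⊆T = S⊆T _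

∑-sublists-++ : ∀ (xs ys : List A) w →
  ∑ (sublists (xs ++ ys)) w ≡ ∑ (sublists xs) (λ as → ∑ (sublists ys) (λ bs → w (as ++ bs)))
∑-sublists-++ []       ys w = sym (ℤ.+-identityʳ _)
∑-sublists-++ (x ∷ xs) ys w = begin
  ∑ (sublists (xs ++ ys) ++ List.map (x ∷_) (sublists (xs ++ ys))) w
    ≡⟨ ∑-++ (sublists (xs ++ ys)) _ w ⟩
  ∑ (sublists (xs ++ ys)) w ℤ.+ ∑ (List.map (x ∷_) (sublists (xs ++ ys))) w
    ≡⟨ cong₂ ℤ._+_ (∑-sublists-++ xs ys w)
         (trans (∑-map (x ∷_) (sublists (xs ++ ys)) w) (∑-sublists-++ xs ys (w ∘ (x ∷_)))) ⟩
  ∑ (sublists xs) r ℤ.+ ∑ (sublists xs) (r ∘ (x ∷_))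
    ≡⟨ cong (ℤ._+_ (∑ (sublists xs) r)) (∑-map (x ∷_) (sublists xs) r) ⟨
  ∑ (sublists xs) r ℤ.+ ∑ (List.map (x ∷_) (sublists xs)) r
    ≡⟨ ∑-++ (sublists xs) _ r ⟨
  ∑ (sublists (x ∷ xs)) r
    ∎
  where
  open ≡.≡-Reasoning
  r : List _ → ℤ
  r as = ∑ (sublists ys) (λ bs → w (as ++ bs))

∑-sublists-∷ : ∀ (x : A) xs w →
  ∑ (sublists (x ∷ xs)) w ≡ ∑ (sublists xs) w ℤ.+ ∑ (sublists xs) (w ∘ (x ∷_))
∑-sublists-∷ x xs w =
  trans (∑-++ (sublists xs) _ w) (cong (ℤ._+_ (∑ (sublists xs) w)) (∑-map (x ∷_) (sublists xs) w))

∑-sublists-map : ∀ (f : A → B) xs w → ∑ (sublists (List.map f xs)) w ≡ ∑ (sublists xs) (w ∘ List.map f)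
∑-sublists-map f []       w = refl
∑-sublists-map f (x ∷ xs) w =
  trans (∑-sublists-∷ (f x) (List.map f xs) w)
    (trans (cong₂ ℤ._+_ (∑-sublists-map f xs w) (∑-sublists-map f xs (w ∘ (f x ∷_))))
      (sym (∑-sublists-∷ x xs (w ∘ List.map f))))

∑-sublists-[] : ∀ (xs : List A) w → (∀ x bs → w (x ∷ bs) ≡ 0ℤ) → ∑ (sublists xs) w ≡ w []
∑-sublists-[] []       w w∷≡0 = ℤ.+-identityʳ _
∑-sublists-[] (x ∷ xs) w w∷≡0 =
  trans (∑-sublists-∷ x xs w)
    (trans (cong₂ ℤ._+_ (∑-sublists-[] xs w w∷≡0) (∑-zero (sublists xs) (w∷≡0 x))) (ℤ.+-identityʳ _))

∑-sublists-singleton : ∀ (xs : List A) w → w [] ≡ 0ℤ → (∀ x y bs → w (x ∷ y ∷ bs) ≡ 0ℤ) →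
                       ∑ (sublists xs) w ≡ ∑ xs (λ x → w (x ∷ []))
∑-sublists-singleton []       w w[]≡0 w∷∷≡0 = trans (ℤ.+-identityʳ _) w[]≡0
∑-sublists-singleton (x ∷ xs) w w[]≡0 w∷∷≡0 =
  trans (∑-sublists-∷ x xs w)
    (trans (cong₂ ℤ._+_ (∑-sublists-singleton xs w w[]≡0 w∷∷≡0)
                        (∑-sublists-[] xs (w ∘ (x ∷_)) (w∷∷≡0 x)))
           (ℤ.+-comm _ (w (x ∷ []))))

Disjoint : ∀ {n} → Subset n → Subset n → Set
Disjoint p q = Empty (p ∩ q)

-- Relative to a subset `U` of the ground set, because removing the block of the first element
-- leaves a partition of a complement `U ─ p` rather than of a smaller `⊤`.
IsPartitionOf : ∀ {n} → Subset n → List (Subset n) → Set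
IsPartitionOf U P = All Nonempty P × AllPairs Disjoint P × ⋃ P ≡ U

isPartitionOf? : ∀ {n} (U : Subset n) P → Dec (IsPartitionOf U P)
isPartitionOf? U P =
  All.all? nonempty? P ×-dec allPairs? (λ p q → ¬? (nonempty? (p ∩ q))) P ×-dec (⋃ P ≟ˢ U)

∈-⋃⁺ : ∀ {n} {x : Fin n} {P p} → p ∈ˡ P → x ∈ p → x ∈ ⋃ P
∈-⋃⁺ (here refl) x∈ = x∈p∪q⁺ (inj₁ x∈)
∈-⋃⁺ (there p∈)  x∈ = x∈p∪q⁺ (inj₂ (∈-⋃⁺ p∈ x∈))

∈-⋃⁻ : ∀ {n} {x : Fin n} P → x ∈ ⋃ P → ∃ λ p → p ∈ˡ P × x ∈ p
∈-⋃⁻ []      x∈ = contradiction x∈ ∉⊥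
∈-⋃⁻ (p ∷ P) x∈ with x∈p∪q⁻ p (⋃ P) x∈
... | inj₁ x∈p = p , here refl , x∈p
... | inj₂ x∈⋃ with ∈-⋃⁻ P x∈⋃
...   | q , q∈ , x∈q = q , there q∈ , x∈q

outs : ∀ {n} → List (Subset n) → List (Subset (suc n))
outs = List.map (outside ∷_)

module _ {n : ℕ} where

  nonempty-out : ∀ {p : Subset n} → Nonempty (outside ∷ p) → Nonempty p
  nonempty-out (suc x , there x∈) = x , x∈

  nonempty-outs : ∀ {P : List (Subset n)} → All Nonempty P → All Nonempty (outs P)
  nonempty-outs = All.map⁺ ∘ All.map λ (x , x∈) → suc x , there x∈

  nonempty-outs⁻ : ∀ {P : List (Subset n)} → All Nonempty (outs P) → All Nonempty P
  nonempty-outs⁻ = All.map nonempty-out ∘ All.map⁻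

  disjoint-out : ∀ (p q : Subset n) s → Disjoint p q → Disjoint (outside ∷ p) (s ∷ q)
  disjoint-out p q s d = d ∘ nonempty-out

  disjoint-out⁻ : ∀ (p q : Subset n) s → Disjoint (outside ∷ p) (s ∷ q) → Disjoint p q
  disjoint-out⁻ p q s d (x , x∈) = d (suc x , there x∈)

  disjoint-outs : ∀ {P : List (Subset n)} → AllPairs Disjoint P → AllPairs Disjoint (outs P)
  disjoint-outs = AllPairs.map⁺ ∘ mapAllPairs (λ {p} {q} → disjoint-out p q outside)

  disjoint-outs⁻ : ∀ {P : List (Subset n)} → AllPairs Disjoint (outs P) → AllPairs Disjoint P
  disjoint-outs⁻ = mapAllPairs (λ {p} {q} → disjoint-out⁻ p q outside) ∘ AllPairs.map⁻

  ⋃-outs : ∀ (P : List (Subset n)) → ⋃ (outs P) ≡ outside ∷ ⋃ P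
  ⋃-outs []      = refl
  ⋃-outs (p ∷ P) = cong ((outside ∷ p) ∪_) (⋃-outs P)

  ⋃-outs-in : ∀ (P : List (Subset n)) p → ⋃ (outs P ++ (inside ∷ p) ∷ []) ≡ inside ∷ (⋃ P ∪ p)
  ⋃-outs-in []      p = cong (inside ∷_) (∪-comm p ⊥)
  ⋃-outs-in (q ∷ P) p =
    trans (cong ((outside ∷ q) ∪_) (⋃-outs-in P p)) (cong (inside ∷_) (sym (∪-assoc q (⋃ P) p)))

  partition-out⁺ : ∀ {U} {P : List (Subset n)} → IsPartitionOf U P → IsPartitionOf (outside ∷ U) (outs P)
  partition-out⁺ {P = P} (ne , dis , refl) = nonempty-outs ne , disjoint-outs dis , ⋃-outs P

  partition-out⁻ : ∀ {U} {P : List (Subset n)} → IsPartitionOf (outside ∷ U) (outs P) → IsPartitionOf U P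
  partition-out⁻ {P = P} (ne , dis , eq) =
    nonempty-outs⁻ ne , disjoint-outs⁻ dis , Vec.∷-injectiveʳ (trans (sym (⋃-outs P)) eq)

  ¬partition-out : ∀ {U} {P : List (Subset n)} {p Q} →
                   ¬ IsPartitionOf (outside ∷ U) (outs P ++ (inside ∷ p) ∷ Q)
  ¬partition-out {P = P} (_ , _ , eq)
    with () ← subst (zero ∈_) eq (∈-⋃⁺ (∈-++⁺ʳ (outs P) (here refl)) here)

  ¬partition-in : ∀ {U} {P : List (Subset n)} → ¬ IsPartitionOf (inside ∷ U) (outs P)
  ¬partition-in {P = P} (_ , _ , eq) with () ← trans (sym (⋃-outs P)) eq

  ¬partition-in-in : ∀ {U} {P : List (Subset n)} {p q Q} →
                     ¬ IsPartitionOf U (outs P ++ (inside ∷ p) ∷ (inside ∷ q) ∷ Q)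
  ¬partition-in-in {P = P} (_ , dis , _) = clash P dis
    where
    clash : ∀ P {p q Q} → ¬ AllPairs Disjoint (outs P ++ (inside ∷ p) ∷ (inside ∷ q) ∷ Q)
    clash []      ((d ∷ _) ∷ _) = d (zero , here)
    clash (_ ∷ P) (_ ∷ dis)     = clash P dis

  partition-in⁺ : ∀ {U p} {P : List (Subset n)} → p ⊆ U → IsPartitionOf (U ─ p) P →
                  IsPartitionOf (inside ∷ U) (outs P ++ (inside ∷ p) ∷ [])
  partition-in⁺ {U} {p} {P} p⊆U (ne , dis , eq) =
    All.++⁺ (nonempty-outs ne) ((zero , here) ∷ []) ,
    AllPairs.++⁺ (disjoint-outs dis) ([] ∷ [])
      (All.map⁺ (All.tabulate λ {a} a∈ → disjoint-out a p inside (λ (x , x∈) →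
        let (x∈a , x∈p) = x∈p∩q⁻ a p x∈ in
        proj₂ (∈-─⁻ U p (subst (x ∈_) eq (∈-⋃⁺ a∈ x∈a))) x∈p) ∷ [])) ,
    trans (⋃-outs-in P p) (cong (inside ∷_) (⊆-antisym
      (λ x∈ → [ (λ x∈⋃ → proj₁ (∈-─⁻ U p (subst (_ ∈_) eq x∈⋃))) , p⊆U ]′ (x∈p∪q⁻ (⋃ P) p x∈))
      (λ {x} x∈U → x∈p∪q⁺ (covered x∈U (x ∈? p)))))
    where
    covered : ∀ {x} → x ∈ U → Dec (x ∈ p) → x ∈ ⋃ P ⊎ x ∈ p
    covered x∈U (yes x∈p) = inj₂ x∈p
    covered x∈U (no x∉p)  = inj₁ (subst (_ ∈_) (sym eq) (x∈p∧x∉q⇒x∈p─q x∈U x∉p))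

  partition-in⁻ : ∀ {U p} {P : List (Subset n)} →
                  IsPartitionOf (inside ∷ U) (outs P ++ (inside ∷ p) ∷ []) →
                  p ⊆ U × IsPartitionOf (U ─ p) P
  partition-in⁻ {U} {p} {P} (ne , dis , eq) =
    (λ x∈p → subst (_ ∈_) ⋃∪p≡U (x∈p∪q⁺ (inj₂ x∈p))) ,
    nonempty-outs⁻ (All.++⁻ˡ (outs P) ne) ,
    disjoint-outs⁻ (proj₁ (split P dis)) ,
    ⊆-antisym
      (λ x∈⋃ → x∈p∧x∉q⇒x∈p─q (subst (_ ∈_) ⋃∪p≡U (x∈p∪q⁺ (inj₁ x∈⋃))) (λ x∈p →
        let (a , a∈ , x∈a) = ∈-⋃⁻ P x∈⋃ in All.lookup (proj₂ (split P dis)) a∈ (_ , x∈p∩q⁺ (x∈a , x∈p))))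
      (λ x∈ → let (x∈U , x∉p) = ∈-─⁻ U p x∈ in
        [ id , (λ x∈p → contradiction x∈p x∉p) ]′ (x∈p∪q⁻ (⋃ P) p (subst (_ ∈_) (sym ⋃∪p≡U) x∈U)))
    where
    ⋃∪p≡U : ⋃ P ∪ p ≡ U
    ⋃∪p≡U = Vec.∷-injectiveʳ (trans (sym (⋃-outs-in P p)) eq)

    split : ∀ P → AllPairs Disjoint (outs P ++ (inside ∷ p) ∷ []) →
            AllPairs Disjoint (outs P) × All (λ a → Disjoint a p) P
    split []      _        = [] , []
    split (a ∷ P) (d ∷ ds) = let (dis , disp) = split P ds in
      All.++⁻ˡ (outs P) d ∷ dis , disjoint-out⁻ a p inside (All.head (All.++⁻ʳ (outs P) d)) ∷ disp

partitionInto? : ∀ {n} k (U : Subset n) P → Dec (length P ≡ k × IsPartitionOf U P)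
partitionInto? k U P = (length P ℕ.≟ k) ×-dec isPartitionOf? U P

#partitions : ∀ {n} → ℕ → Subset n → ℤ
#partitions {n} k U = ∑ (sublists (subsets n)) (λ P → ⟦ partitionInto? k U P ⟧)

stirling₂-partitions : ∀ m k → + stirling₂ m k ≡ #partitions k (⊤ {m})
stirling₂-partitions m k = length-filter (partitionInto? k ⊤) (sublists (subsets m))

-- A set of subsets of `Fin (suc n)` consists of a set `P` of blocks that avoid the first element
-- and a set `Q` of blocks that contain it. In a partition, `Q` has no member or exactly one,
-- according as the first element is outside or inside the partitioned set.
∑-sublists-subsets : ∀ {n} w → ∑ (sublists (subsets (suc n))) w ≡
  ∑ (sublists (subsets n)) (λ P → ∑ (sublists (subsets n)) (λ Q → w (outs P ++ List.map (inside ∷_) Q)))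
∑-sublists-subsets {n} w = begin
  ∑ (sublists (subsets (suc n))) w
    ≡⟨ ∑-sublists-++ (outs (subsets n)) (List.map (inside ∷_) (subsets n)) w ⟩
  ∑ (sublists (outs (subsets n))) (λ P → ∑ (sublists (List.map (inside ∷_) (subsets n))) (λ Q → w (P ++ Q)))
    ≡⟨ ∑-sublists-map (outside ∷_) (subsets n) _ ⟩
  ∑ (sublists (subsets n)) (λ P → ∑ (sublists (List.map (inside ∷_) (subsets n))) (λ Q → w (outs P ++ Q)))
    ≡⟨ ∑-cong (sublists (subsets n)) (λ P → ∑-sublists-map (inside ∷_) (subsets n) _) ⟩
  ∑ (sublists (subsets n)) (λ P → ∑ (sublists (subsets n)) (λ Q → w (outs P ++ List.map (inside ∷_) Q)))
    ∎
  where open ≡.≡-Reasoning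

#partitions-out : ∀ {n} k (U : Subset n) → #partitions k (outside ∷ U) ≡ #partitions k U
#partitions-out {n} k U = trans (∑-sublists-subsets {n} _) (∑-cong (sublists (subsets n)) λ P → trans
  (∑-sublists-[] (subsets n) _ λ p Q →
    ⟦⟧-no (partitionInto? k (outside ∷ U) (outs P ++ (inside ∷ p) ∷ _)) (¬partition-out {P = P} ∘ proj₂))
  (trans (cong (λ P → ⟦ partitionInto? k (outside ∷ U) P ⟧) (List.++-identityʳ (outs P)))
    (⟦⟧-cong (partitionInto? k (outside ∷ U) (outs P)) (partitionInto? k U P)
      (λ (len , part) → trans (sym (List.length-map _ P)) len , partition-out⁻ part)
      (λ (len , part) → trans (List.length-map _ P) len , partition-out⁺ part))))

#partitions-in-0 : ∀ {n} (U : Subset n) → #partitions 0 (inside ∷ U) ≡ 0ℤ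
#partitions-in-0 {n} U = ∑-zero (sublists (subsets (suc n))) λ P →
  ⟦⟧-no (partitionInto? 0 (inside ∷ U) P) (empty P)
  where
  empty : ∀ P → ¬ (length P ≡ 0 × IsPartitionOf (inside ∷ U) P)
  empty [] (_ , _ , _ , ())

-- Sum over the set p of those elements that share a block with the first element.
#partitions-in-suc : ∀ {n} k (U : Subset n) → #partitions (suc k) (inside ∷ U) ≡
                     ∑ (subsets n) (λ p → ⟦ p ⊆′? (_∈? U) ⟧ ℤ.* #partitions k (U ─ p))
#partitions-in-suc {n} k U = begin
  #partitions (suc k) (inside ∷ U)
    ≡⟨ ∑-sublists-subsets {n} _ ⟩
  ∑ (sublists (subsets n)) (λ P → ∑ (sublists (subsets n)) (λ Q →
    ⟦ partitionInto? (suc k) (inside ∷ U) (outs P ++ List.map (inside ∷_) Q) ⟧))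
    ≡⟨ ∑-cong (sublists (subsets n)) (λ P → trans
         (∑-sublists-singleton (subsets n) _
           (trans (cong (λ P → ⟦ partitionInto? (suc k) (inside ∷ U) P ⟧) (List.++-identityʳ (outs P)))
             (⟦⟧-no (partitionInto? (suc k) (inside ∷ U) (outs P)) (¬partition-in {P = P} ∘ proj₂)))
           (λ p q Q → ⟦⟧-no (partitionInto? (suc k) (inside ∷ U) (outs P ++ (inside ∷ p) ∷ (inside ∷ q) ∷ _))
             (¬partition-in-in {P = P} ∘ proj₂)))
         (∑-cong (subsets n) (λ p → trans
           (⟦⟧-cong (partitionInto? (suc k) (inside ∷ U) (outs P ++ (inside ∷ p) ∷ []))
                    ((p ⊆′? (_∈? U)) ×-dec partitionInto? k (U ─ p) P)
             (λ (len , part) → let (p⊆U , part′) = partition-in⁻ {P = P} part in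
               (λ x x∈ → p⊆U x∈) , ℕ.suc-injective (trans (sym (size P p)) len) , part′)
             (λ (p⊆U , len , part) → trans (size P p) (cong suc len) , partition-in⁺ (⊆′⇒⊆ p⊆U) part))
           (⟦⟧-× (p ⊆′? (_∈? U)) (partitionInto? k (U ─ p) P))))) ⟩
  ∑ (sublists (subsets n)) (λ P → ∑ (subsets n) (λ p →
    ⟦ p ⊆′? (_∈? U) ⟧ ℤ.* ⟦ partitionInto? k (U ─ p) P ⟧))
    ≡⟨ ∑-swap (sublists (subsets n)) (subsets n) _ ⟩
  ∑ (subsets n) (λ p → ∑ (sublists (subsets n)) (λ P →
    ⟦ p ⊆′? (_∈? U) ⟧ ℤ.* ⟦ partitionInto? k (U ─ p) P ⟧))
    ≡⟨ ∑-cong (subsets n) (λ p → ∑-*ˡ (sublists (subsets n)) ⟦ p ⊆′? (_∈? U) ⟧ _) ⟩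
  ∑ (subsets n) (λ p → ⟦ p ⊆′? (_∈? U) ⟧ ℤ.* #partitions k (U ─ p))
    ∎
  where
  open ≡.≡-Reasoning
  size : ∀ P p → length (outs P ++ (inside ∷ p) ∷ []) ≡ suc (length P)
  size P p = trans (List.length-++ (outs P))
    (trans (ℕ.+-comm (length (outs P)) 1) (cong suc (List.length-map _ P)))

#partitions-[] : ∀ k → #partitions (suc k) [] ≡ 0ℤ
#partitions-[] k = cong₂ (λ a b → a ℤ.+ (b ℤ.+ 0ℤ))
  (⟦⟧-no (partitionInto? (suc k) [] []) λ ())
  (⟦⟧-no (partitionInto? (suc k) [] ([] ∷ [])) λ { (_ , (() , _) ∷ _ , _) })

-- The Stirling recurrence, by induction on the ground set through the sum over the block of the
-- first element. In the case `inside ∷ inside ∷ U` the second element either joins that block,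
-- which gives one more copy of `#partitions (suc k) (inside ∷ U)`, or is left to the remaining
-- blocks, where the induction hypothesis applies to `U ─ p`.
#partitions-suc : ∀ {n} k (U : Subset n) → #partitions (suc k) (inside ∷ U) ≡
                  + suc k ℤ.* #partitions (suc k) U ℤ.+ #partitions k U
#partitions-suc k [] = begin
  #partitions (suc k) (inside ∷ [])             ≡⟨ #partitions-in-suc k [] ⟩
  ⟦ [] ⊆′? (_∈? []) ⟧ ℤ.* #partitions k [] ℤ.+ 0ℤ
    ≡⟨ cong (λ c → c ℤ.* #partitions k [] ℤ.+ 0ℤ) (⟦⟧-yes ([] ⊆′? (_∈? [])) λ ()) ⟩
  1ℤ ℤ.* #partitions k [] ℤ.+ 0ℤ                ≡⟨ trans (ℤ.+-identityʳ _) (ℤ.*-identityˡ _) ⟩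
  #partitions k []                              ≡⟨ ℤ.+-identityˡ _ ⟨
  0ℤ ℤ.+ #partitions k []                       ≡⟨ cong (ℤ._+ #partitions k []) (trans
                                                     (cong (ℤ._*_ (+ suc k)) (#partitions-[] k)) (ℤ.*-zeroʳ (+ suc k))) ⟨
  + suc k ℤ.* #partitions (suc k) [] ℤ.+ #partitions k [] ∎
  where
  open ≡.≡-Reasoning
#partitions-suc {suc n} k (outside ∷ U) = begin
  #partitions (suc k) (inside ∷ outside ∷ U)
    ≡⟨ #partitions-in-suc k (outside ∷ U) ⟩
  ∑ (subsets (suc n)) (λ p → ⟦ p ⊆′? (_∈? (outside ∷ U)) ⟧ ℤ.* #partitions k ((outside ∷ U) ─ p))
    ≡⟨ ∑-subsets {n} _ ⟩
  ∑ (subsets n) (λ p → ⟦ (outside ∷ p) ⊆′? (_∈? (outside ∷ U)) ⟧ ℤ.* #partitions k (outside ∷ (U ─ p))) ℤ.+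
  ∑ (subsets n) (λ p → ⟦ (inside ∷ p) ⊆′? (_∈? (outside ∷ U)) ⟧ ℤ.* #partitions k (outside ∷ (U ─ p)))
    ≡⟨ cong₂ ℤ._+_
         (∑-cong (subsets n) λ p → cong₂ ℤ._*_
           (⟦⟧-cong ((outside ∷ p) ⊆′? (_∈? (outside ∷ U))) (p ⊆′? (_∈? U))
             (λ p⊆ x x∈ → drop-there (p⊆ (suc x) (there x∈)))
             (λ { p⊆ (suc x) (there x∈) → there (p⊆ x x∈) }))
           (#partitions-out k (U ─ p)))
         (∑-zero (subsets n) λ p → cong (ℤ._* #partitions k (outside ∷ (U ─ p)))
           (⟦⟧-no ((inside ∷ p) ⊆′? (_∈? (outside ∷ U))) λ p⊆ → contradiction (p⊆ zero here) λ ())) ⟩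
  ∑ (subsets n) (λ p → ⟦ p ⊆′? (_∈? U) ⟧ ℤ.* #partitions k (U ─ p)) ℤ.+ 0ℤ
    ≡⟨ trans (ℤ.+-identityʳ _) (sym (#partitions-in-suc k U)) ⟩
  #partitions (suc k) (inside ∷ U)
    ≡⟨ #partitions-suc k U ⟩
  + suc k ℤ.* #partitions (suc k) U ℤ.+ #partitions k U
    ≡⟨ cong₂ (λ a b → + suc k ℤ.* a ℤ.+ b) (#partitions-out (suc k) U) (#partitions-out k U) ⟨
  + suc k ℤ.* #partitions (suc k) (outside ∷ U) ℤ.+ #partitions k (outside ∷ U)
    ∎
  where open ≡.≡-Reasoning
#partitions-suc {suc n} k (inside ∷ U) = begin
  #partitions (suc k) (inside ∷ inside ∷ U)
    ≡⟨ #partitions-in-suc k (inside ∷ U) ⟩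
  ∑ (subsets (suc n)) (λ p → ⟦ p ⊆′? (_∈? (inside ∷ U)) ⟧ ℤ.* #partitions k ((inside ∷ U) ─ p))
    ≡⟨ ∑-subsets {n} _ ⟩
  ∑ (subsets n) (λ p → ⟦ (outside ∷ p) ⊆′? (_∈? (inside ∷ U)) ⟧ ℤ.* #partitions k (inside ∷ (U ─ p))) ℤ.+
  ∑ (subsets n) (λ p → ⟦ (inside ∷ p) ⊆′? (_∈? (inside ∷ U)) ⟧ ℤ.* #partitions k (outside ∷ (U ─ p)))
    ≡⟨ cong₂ ℤ._+_
         (∑-cong (subsets n) λ p → cong (ℤ._* #partitions k (inside ∷ (U ─ p)))
           (⟦⟧-cong ((outside ∷ p) ⊆′? (_∈? (inside ∷ U))) (p ⊆′? (_∈? U))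
             (λ p⊆ x x∈ → drop-there (p⊆ (suc x) (there x∈)))
             (λ { p⊆ (suc x) (there x∈) → there (p⊆ x x∈) })))
         (∑-cong (subsets n) λ p → cong₂ ℤ._*_
           (⟦⟧-cong ((inside ∷ p) ⊆′? (_∈? (inside ∷ U))) (p ⊆′? (_∈? U))
             (λ p⊆ x x∈ → drop-there (p⊆ (suc x) (there x∈)))
             (λ { p⊆ zero here → here ; p⊆ (suc x) (there x∈) → there (p⊆ x x∈) }))
           (#partitions-out k (U ─ p))) ⟩
  ∑ (subsets n) (λ p → ⟦ p ⊆′? (_∈? U) ⟧ ℤ.* #partitions k (inside ∷ (U ─ p))) ℤ.+
  ∑ (subsets n) (λ p → ⟦ p ⊆′? (_∈? U) ⟧ ℤ.* #partitions k (U ─ p))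
    ≡⟨ cong₂ ℤ._+_ (rest k) (sym (#partitions-in-suc k U)) ⟩
  (+ k ℤ.* #partitions (suc k) (inside ∷ U) ℤ.+ #partitions k (inside ∷ U)) ℤ.+ #partitions (suc k) (inside ∷ U)
    ≡⟨ regroup (+ k) _ _ ⟩
  + suc k ℤ.* #partitions (suc k) (inside ∷ U) ℤ.+ #partitions k (inside ∷ U)
    ∎
  where
  open ≡.≡-Reasoning

  regroup : ∀ k a b → (k ℤ.* a ℤ.+ b) ℤ.+ a ≡ (1ℤ ℤ.+ k) ℤ.* a ℤ.+ b
  regroup = solve-∀

  expand : ∀ c k a b → c ℤ.* (k ℤ.* a ℤ.+ b) ≡ k ℤ.* (c ℤ.* a) ℤ.+ c ℤ.* b
  expand = solve-∀

  -- The terms whose first block omits the second element. With no further block allowed they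
  -- vanish; otherwise the induction hypothesis is summed over `p` and folded back by
  -- `#partitions-in-suc`.
  rest : ∀ k → ∑ (subsets n) (λ p → ⟦ p ⊆′? (_∈? U) ⟧ ℤ.* #partitions k (inside ∷ (U ─ p))) ≡
               + k ℤ.* #partitions (suc k) (inside ∷ U) ℤ.+ #partitions k (inside ∷ U)
  rest zero = trans
    (∑-zero (subsets n) λ p → trans (cong (ℤ._*_ ⟦ p ⊆′? (_∈? U) ⟧) (#partitions-in-0 (U ─ p))) (ℤ.*-zeroʳ ⟦ p ⊆′? (_∈? U) ⟧))
    (sym (trans (ℤ.+-identityˡ _) (#partitions-in-0 U)))
  rest (suc k) = begin
    ∑ (subsets n) (λ p → ⟦ p ⊆′? (_∈? U) ⟧ ℤ.* #partitions (suc k) (inside ∷ (U ─ p)))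
      ≡⟨ ∑-cong (subsets n) (λ p → trans (cong (ℤ._*_ ⟦ p ⊆′? (_∈? U) ⟧) (#partitions-suc k (U ─ p)))
           (expand ⟦ p ⊆′? (_∈? U) ⟧ (+ suc k) _ _)) ⟩
    ∑ (subsets n) (λ p → + suc k ℤ.* (⟦ p ⊆′? (_∈? U) ⟧ ℤ.* #partitions (suc k) (U ─ p)) ℤ.+
                         ⟦ p ⊆′? (_∈? U) ⟧ ℤ.* #partitions k (U ─ p))
      ≡⟨ ∑-+ (subsets n) _ _ ⟩
    ∑ (subsets n) (λ p → + suc k ℤ.* (⟦ p ⊆′? (_∈? U) ⟧ ℤ.* #partitions (suc k) (U ─ p))) ℤ.+
    ∑ (subsets n) (λ p → ⟦ p ⊆′? (_∈? U) ⟧ ℤ.* #partitions k (U ─ p))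
      ≡⟨ cong₂ ℤ._+_
           (trans (∑-*ˡ (subsets n) (+ suc k) _) (cong (ℤ._*_ (+ suc k)) (sym (#partitions-in-suc (suc k) U))))
           (sym (#partitions-in-suc k U)) ⟩
    + suc k ℤ.* #partitions (suc (suc k)) (inside ∷ U) ℤ.+ #partitions (suc k) (inside ∷ U)
      ∎

S₂ : ℕ → ℕ → ℤ
S₂ m k = + stirling₂ m k

S₂-suc-0 : ∀ m → S₂ (suc m) 0 ≡ 0ℤ
S₂-suc-0 m = trans (stirling₂-partitions (suc m) 0) (#partitions-in-0 (⊤ {m}))

S₂-suc-suc : ∀ m k → S₂ (suc m) (suc k) ≡ + suc k ℤ.* S₂ m (suc k) ℤ.+ S₂ m k
S₂-suc-suc m k = trans (stirling₂-partitions (suc m) (suc k)) (trans (#partitions-suc k (⊤ {m}))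
  (sym (cong₂ (λ a b → + suc k ℤ.* a ℤ.+ b) (stirling₂-partitions m (suc k)) (stirling₂-partitions m k))))

S₂-> : ∀ m k → m ℕ.< k → S₂ m k ≡ 0ℤ
S₂-> zero    (suc k) _ = trans (stirling₂-partitions 0 (suc k)) (#partitions-[] k)
S₂-> (suc m) (suc k) (ℕ.s≤s m<k) = trans (S₂-suc-suc m k)
  (cong₂ ℤ._+_ (trans (cong (ℤ._*_ (+ suc k)) (S₂-> m (suc k) (ℕ.m<n⇒m<1+n m<k))) (ℤ.*-zeroʳ (+ suc k)))
               (S₂-> m k m<k))

-- Proper colourings of complete bipartite graphs

∑-allFin-suc : ∀ n (f : Fin (suc n) → ℤ) → ∑ (allFin (suc n)) f ≡ f zero ℤ.+ ∑ (allFin n) (f ∘ suc)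
∑-allFin-suc n f = cong (ℤ._+_ (f zero))
  (trans (cong (λ xs → ∑ xs f) (sym (List.map-tabulate id suc))) (∑-map suc (allFin n) f))

upTo-suc : ∀ n → upTo (suc n) ≡ 0 ∷ List.map suc (upTo n)
upTo-suc n = cong (0 ∷_) (sym (List.map-upTo suc n))

∑-upTo-head : ∀ n (f : ℕ → ℤ) → ∑ (upTo (suc n)) f ≡ f 0 ℤ.+ ∑ (upTo n) (f ∘ suc)
∑-upTo-head n f = trans (cong (λ xs → ∑ xs f) (upTo-suc n)) (cong (ℤ._+_ (f 0)) (∑-map suc (upTo n) f))

∑-upTo-last : ∀ n (f : ℕ → ℤ) → ∑ (upTo (suc n)) f ≡ ∑ (upTo n) f ℤ.+ f n
∑-upTo-last n f = trans (cong (λ xs → ∑ xs f) (sym (List.upTo-∷ʳ n)))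
  (trans (∑-++ (upTo n) (n ∷ []) f) (cong (ℤ._+_ (∑ (upTo n) f)) (ℤ.+-identityʳ (f n))))

∑-tuples-++ : ∀ (xs : List A) m {n} (w : Vec A (m ℕ.+ n) → ℤ) →
              ∑ (tuples xs (m ℕ.+ n)) w ≡ ∑ (tuples xs m) (λ g → ∑ (tuples xs n) (λ h → w (g Vec.++ h)))
∑-tuples-++ xs zero        w = sym (ℤ.+-identityʳ _)
∑-tuples-++ xs (suc m) {n} w = begin
  ∑ (tuples xs (suc m ℕ.+ n)) w
    ≡⟨ ∑-cartesianProductWith _∷_ xs (tuples xs (m ℕ.+ n)) w ⟩
  ∑ xs (λ x → ∑ (tuples xs (m ℕ.+ n)) (λ f → w (x ∷ f)))
    ≡⟨ ∑-cong xs (λ x → ∑-tuples-++ xs m (λ f → w (x ∷ f))) ⟩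
  ∑ xs (λ x → ∑ (tuples xs m) (λ g → ∑ (tuples xs n) (λ h → w (x ∷ g Vec.++ h))))
    ≡⟨ ∑-cartesianProductWith _∷_ xs (tuples xs m) _ ⟨
  ∑ (tuples xs (suc m)) (λ g → ∑ (tuples xs n) (λ h → w (g Vec.++ h)))
    ∎
  where open ≡.≡-Reasoning

∑-tuples-all : ∀ {P : A → Set p} (P? : Decidable P) xs n →
               ∑ (tuples xs n) (λ v → ⟦ Fin.all? (P? ∘ lookup v) ⟧) ≡ ∑ xs (λ x → ⟦ P? x ⟧) ℤ.^ n
∑-tuples-all P? xs zero    = cong (ℤ._+ 0ℤ) (⟦⟧-yes (Fin.all? (P? ∘ lookup [])) λ ())
∑-tuples-all P? xs (suc n) = begin
  ∑ (tuples xs (suc n)) (λ v → ⟦ Fin.all? (P? ∘ lookup v) ⟧)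
    ≡⟨ ∑-cartesianProductWith _∷_ xs (tuples xs n) _ ⟩
  ∑ xs (λ x → ∑ (tuples xs n) (λ v → ⟦ Fin.all? (P? ∘ lookup (x ∷ v)) ⟧))
    ≡⟨ ∑-cong xs (λ x → ∑-cong (tuples xs n) λ v → trans
         (⟦⟧-cong (Fin.all? (P? ∘ lookup (x ∷ v))) (P? x ×-dec Fin.all? (P? ∘ lookup v))
           (λ all → all zero , all ∘ suc)
           (λ { (px , all) zero → px ; (px , all) (suc i) → all i }))
         (⟦⟧-× (P? x) (Fin.all? (P? ∘ lookup v)))) ⟩
  ∑ xs (λ x → ∑ (tuples xs n) (λ v → ⟦ P? x ⟧ ℤ.* ⟦ Fin.all? (P? ∘ lookup v) ⟧))
    ≡⟨ ∑-cong xs (λ x → trans (∑-*ˡ (tuples xs n) ⟦ P? x ⟧ _) (cong (ℤ._*_ ⟦ P? x ⟧) (∑-tuples-all P? xs n))) ⟩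
  ∑ xs (λ x → ⟦ P? x ⟧ ℤ.* ∑ xs (λ x → ⟦ P? x ⟧) ℤ.^ n)
    ≡⟨ ∑-*ʳ xs (∑ xs (λ x → ⟦ P? x ⟧) ℤ.^ n) _ ⟩
  ∑ xs (λ x → ⟦ P? x ⟧) ℤ.^ suc n
    ∎
  where open ≡.≡-Reasoning

∑-∉ : ∀ {q} (W : Subset q) → ∑ (allFin q) (λ c → ⟦ ¬? (c ∈? W) ⟧) ≡ + q ℤ.- + ∣ W ∣
∑-∉ []                = refl
∑-∉ {suc q} (inside ∷ W) = begin
  ∑ (allFin (suc q)) (λ c → ⟦ ¬? (c ∈? (inside ∷ W)) ⟧)
    ≡⟨ ∑-allFin-suc q (λ c → ⟦ ¬? (c ∈? (inside ∷ W)) ⟧) ⟩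
  0ℤ ℤ.+ ∑ (allFin q) (λ c → ⟦ ¬? (suc c ∈? (inside ∷ W)) ⟧)
    ≡⟨ cong (ℤ._+_ 0ℤ) (trans (∑-cong (allFin q) λ c → ⟦⟧-cong (¬? (suc c ∈? (inside ∷ W))) (¬? (c ∈? W)) (_∘ there) (_∘ drop-there)) (∑-∉ W)) ⟩
  0ℤ ℤ.+ (+ q ℤ.- + ∣ W ∣)
    ≡⟨ identity (+ q) (+ ∣ W ∣) ⟩
  + suc q ℤ.- + suc ∣ W ∣
    ∎
  where
  open ≡.≡-Reasoning
  identity : ∀ q u → 0ℤ ℤ.+ (q ℤ.- u) ≡ (1ℤ ℤ.+ q) ℤ.- (1ℤ ℤ.+ u)
  identity = solve-∀
∑-∉ {suc q} (outside ∷ W) = begin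
  ∑ (allFin (suc q)) (λ c → ⟦ ¬? (c ∈? (outside ∷ W)) ⟧)
    ≡⟨ ∑-allFin-suc q (λ c → ⟦ ¬? (c ∈? (outside ∷ W)) ⟧) ⟩
  1ℤ ℤ.+ ∑ (allFin q) (λ c → ⟦ ¬? (suc c ∈? (outside ∷ W)) ⟧)
    ≡⟨ cong (ℤ._+_ 1ℤ) (trans (∑-cong (allFin q) λ c → ⟦⟧-cong (¬? (suc c ∈? (outside ∷ W))) (¬? (c ∈? W)) (_∘ there) (_∘ drop-there)) (∑-∉ W)) ⟩
  1ℤ ℤ.+ (+ q ℤ.- + ∣ W ∣)
    ≡⟨ ℤ.+-assoc 1ℤ (+ q) (ℤ.- + ∣ W ∣) ⟨
  + suc q ℤ.- + ∣ W ∣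
    ∎
  where open ≡.≡-Reasoning

-- The number of used colours is j; the next vertex reuses one of them or takes one of q - j new ones.
addVertex : ℤ → (ℕ → ℤ) → (ℕ → ℤ)
addVertex q φ j = + j ℤ.* φ j ℤ.+ (q ℤ.- + j) ℤ.* φ (suc j)

addVertices : ℤ → ℕ → (ℕ → ℤ) → (ℕ → ℤ)
addVertices q zero    φ = φ
addVertices q (suc m) φ = addVertex q (addVertices q m φ)

-- `addVertices` applies the new `addVertex` outermost; the induction for the Stirling expansion
-- needs it innermost, next to `φ`.
addVertices-comm : ∀ q m φ j → addVertices q m (addVertex q φ) j ≡ addVertices q (suc m) φ j
addVertices-comm q zero    φ j = refl
addVertices-comm q (suc m) φ j = cong₂ (λ a b → + j ℤ.* a ℤ.+ (q ℤ.- + j) ℤ.* b)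
  (addVertices-comm q m φ j) (addVertices-comm q m φ (suc j))

-- The colours in `U` leave its size unchanged and the others raise it by one, so the sum depends on
-- `U` only through its size.
∑-∪⁅⁆ : ∀ {q} (U : Subset q) φ → ∑ (allFin q) (λ c → φ ∣ U ∪ ⁅ c ⁆ ∣) ≡ addVertex (+ q) φ ∣ U ∣
∑-∪⁅⁆ [] φ = sym (trans (ℤ.+-identityˡ _) refl)
∑-∪⁅⁆ {suc q} (inside ∷ U) φ = begin
  ∑ (allFin (suc q)) (λ c → φ ∣ (inside ∷ U) ∪ ⁅ c ⁆ ∣)
    ≡⟨ ∑-allFin-suc q (λ c → φ ∣ (inside ∷ U) ∪ ⁅ c ⁆ ∣) ⟩
  φ (suc ∣ U ∪ ⊥ ∣) ℤ.+ ∑ (allFin q) (λ c → φ (suc ∣ U ∪ ⁅ c ⁆ ∣))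
    ≡⟨ cong₂ ℤ._+_ (cong (λ U → φ (suc ∣ U ∣)) (∪-identityʳ U)) (∑-∪⁅⁆ U (φ ∘ suc)) ⟩
  φ (suc ∣ U ∣) ℤ.+ (+ ∣ U ∣ ℤ.* φ (suc ∣ U ∣) ℤ.+ (+ q ℤ.- + ∣ U ∣) ℤ.* φ (suc (suc ∣ U ∣)))
    ≡⟨ identity (+ q) (+ ∣ U ∣) (φ (suc ∣ U ∣)) (φ (suc (suc ∣ U ∣))) ⟩
  addVertex (+ suc q) φ (suc ∣ U ∣)
    ∎
  where
  open ≡.≡-Reasoning
  identity : ∀ q u a b → a ℤ.+ (u ℤ.* a ℤ.+ (q ℤ.- u) ℤ.* b) ≡
             (1ℤ ℤ.+ u) ℤ.* a ℤ.+ ((1ℤ ℤ.+ q) ℤ.- (1ℤ ℤ.+ u)) ℤ.* b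
  identity = solve-∀
∑-∪⁅⁆ {suc q} (outside ∷ U) φ = begin
  ∑ (allFin (suc q)) (λ c → φ ∣ (outside ∷ U) ∪ ⁅ c ⁆ ∣)
    ≡⟨ ∑-allFin-suc q (λ c → φ ∣ (outside ∷ U) ∪ ⁅ c ⁆ ∣) ⟩
  φ (suc ∣ U ∪ ⊥ ∣) ℤ.+ ∑ (allFin q) (λ c → φ ∣ U ∪ ⁅ c ⁆ ∣)
    ≡⟨ cong₂ ℤ._+_ (cong (λ U → φ (suc ∣ U ∣)) (∪-identityʳ U)) (∑-∪⁅⁆ U φ) ⟩
  φ (suc ∣ U ∣) ℤ.+ (+ ∣ U ∣ ℤ.* φ ∣ U ∣ ℤ.+ (+ q ℤ.- + ∣ U ∣) ℤ.* φ (suc ∣ U ∣))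
    ≡⟨ identity (+ q) (+ ∣ U ∣) (φ ∣ U ∣) (φ (suc ∣ U ∣)) ⟩
  addVertex (+ suc q) φ ∣ U ∣
    ∎
  where
  open ≡.≡-Reasoning
  identity : ∀ q u a b → b ℤ.+ (u ℤ.* a ℤ.+ (q ℤ.- u) ℤ.* b) ≡ u ℤ.* a ℤ.+ ((1ℤ ℤ.+ q) ℤ.- u) ℤ.* b
  identity = solve-∀

used : ∀ {q n} → Subset q → Vec (Fin q) n → Subset q
used U []      = U
used U (c ∷ g) = used (U ∪ ⁅ c ⁆) g

∈-used⁺ : ∀ {q n} (U : Subset q) (g : Vec (Fin q) n) {c} → c ∈ U ⊎ (∃ λ i → lookup g i ≡ c) → c ∈ used U g
∈-used⁺ U []      (inj₁ c∈U)            = c∈U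
∈-used⁺ U (x ∷ g) (inj₁ c∈U)            = ∈-used⁺ _ g (inj₁ (x∈p∪q⁺ (inj₁ c∈U)))
∈-used⁺ U (x ∷ g) (inj₂ (zero  , refl)) = ∈-used⁺ _ g (inj₁ (x∈p∪q⁺ (inj₂ (x∈⁅x⁆ x))))
∈-used⁺ U (x ∷ g) (inj₂ (suc i , eq))   = ∈-used⁺ _ g (inj₂ (i , eq))

∈-used⁻ : ∀ {q n} (U : Subset q) (g : Vec (Fin q) n) {c} → c ∈ used U g → c ∈ U ⊎ (∃ λ i → lookup g i ≡ c)
∈-used⁻ U []      c∈ = inj₁ c∈
∈-used⁻ U (x ∷ g) c∈ with ∈-used⁻ (U ∪ ⁅ x ⁆) g c∈
... | inj₂ (i , eq) = inj₂ (suc i , eq)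
... | inj₁ c∈∪ with x∈p∪q⁻ U ⁅ x ⁆ c∈∪
...   | inj₁ c∈U = inj₁ c∈U
...   | inj₂ c∈x = inj₂ (zero , sym (x∈⁅y⁆⇒x≡y x c∈x))

∑-used : ∀ {q} m (U : Subset q) φ → ∑ (colourings q m) (λ g → φ ∣ used U g ∣) ≡ addVertices (+ q) m φ ∣ U ∣
∑-used         zero    U φ = ℤ.+-identityʳ _
∑-used {q = q} (suc m) U φ = begin
  ∑ (colourings q (suc m)) (λ g → φ ∣ used U g ∣)
    ≡⟨ ∑-cartesianProductWith _∷_ (allFin q) (colourings q m) _ ⟩
  ∑ (allFin q) (λ c → ∑ (colourings q m) (λ g → φ ∣ used (U ∪ ⁅ c ⁆) g ∣))
    ≡⟨ ∑-cong (allFin q) (λ c → ∑-used m (U ∪ ⁅ c ⁆) φ) ⟩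
  ∑ (allFin q) (λ c → addVertices (+ q) m φ ∣ U ∪ ⁅ c ⁆ ∣)
    ≡⟨ ∑-∪⁅⁆ U (addVertices (+ q) m φ) ⟩
  addVertices (+ q) (suc m) φ ∣ U ∣
    ∎
  where open ≡.≡-Reasoning

fallingFactorial : ℤ → ℕ → ℤ
fallingFactorial q zero    = 1ℤ
fallingFactorial q (suc k) = (q ℤ.- + k) ℤ.* fallingFactorial q k

-- For constant `φ = 1` this is the classical expansion of q^m in falling factorials. In general k
-- counts the colours in use at the end, and the induction on `m` is the Stirling recurrence:
-- `reuse` and `new` are its two terms.
addVertices-S₂ : ∀ q m φ → addVertices q m φ 0 ≡
                 ∑ (upTo (suc m)) (λ k → S₂ m k ℤ.* (fallingFactorial q k ℤ.* φ k))
addVertices-S₂ q zero    φ = sym (trans (ℤ.+-identityʳ _) (trans (ℤ.*-identityˡ _) (ℤ.*-identityˡ _)))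
addVertices-S₂ q (suc m) φ = begin
  addVertices q (suc m) φ 0
    ≡⟨ addVertices-comm q m φ 0 ⟨
  addVertices q m (addVertex q φ) 0
    ≡⟨ addVertices-S₂ q m (addVertex q φ) ⟩
  ∑ (upTo (suc m)) (λ k → S₂ m k ℤ.* (f k ℤ.* (+ k ℤ.* φ k ℤ.+ (q ℤ.- + k) ℤ.* φ (suc k))))
    ≡⟨ ∑-cong (upTo (suc m)) (λ k → distribute (S₂ m k) (f k) (+ k) (φ k) (q ℤ.- + k) (φ (suc k))) ⟩
  ∑ (upTo (suc m)) (λ k → reuse k ℤ.+ new k)
    ≡⟨ ∑-+ (upTo (suc m)) reuse new ⟩
  ∑ (upTo (suc m)) reuse ℤ.+ ∑ (upTo (suc m)) new
    ≡⟨ cong (ℤ._+ ∑ (upTo (suc m)) new) shift ⟩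
  ∑ (upTo (suc m)) (reuse ∘ suc) ℤ.+ ∑ (upTo (suc m)) new
    ≡⟨ ∑-+ (upTo (suc m)) (reuse ∘ suc) new ⟨
  ∑ (upTo (suc m)) (λ k → reuse (suc k) ℤ.+ new k)
    ≡⟨ ∑-cong (upTo (suc m)) (λ k → trans
         (collect (+ suc k) (S₂ m (suc k)) (q ℤ.- + k) (f k) (φ (suc k)) (S₂ m k))
         (cong (ℤ._* (f (suc k) ℤ.* φ (suc k))) (sym (S₂-suc-suc m k)))) ⟩
  ∑ (upTo (suc m)) (λ k → S₂ (suc m) (suc k) ℤ.* (f (suc k) ℤ.* φ (suc k)))
    ≡⟨ trans (cong (ℤ._+ rest) (cong (ℤ._* (f 0 ℤ.* φ 0)) (S₂-suc-0 m))) (ℤ.+-identityˡ rest) ⟨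
  S₂ (suc m) 0 ℤ.* (f 0 ℤ.* φ 0) ℤ.+ rest
    ≡⟨ ∑-upTo-head (suc m) (λ k → S₂ (suc m) k ℤ.* (f k ℤ.* φ k)) ⟨
  ∑ (upTo (suc (suc m))) (λ k → S₂ (suc m) k ℤ.* (f k ℤ.* φ k))
    ∎
  where
  open ≡.≡-Reasoning

  f : ℕ → ℤ
  f = fallingFactorial q

  reuse new : ℕ → ℤ
  reuse k = + k ℤ.* (S₂ m k ℤ.* (f k ℤ.* φ k))
  new   k = S₂ m k ℤ.* (f (suc k) ℤ.* φ (suc k))

  rest : ℤ
  rest = ∑ (upTo (suc m)) (λ k → S₂ (suc m) (suc k) ℤ.* (f (suc k) ℤ.* φ (suc k)))

  distribute : ∀ s f k a c b → s ℤ.* (f ℤ.* (k ℤ.* a ℤ.+ c ℤ.* b)) ≡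
               k ℤ.* (s ℤ.* (f ℤ.* a)) ℤ.+ s ℤ.* ((c ℤ.* f) ℤ.* b)
  distribute = solve-∀

  collect : ∀ k s c f b t → k ℤ.* (s ℤ.* ((c ℤ.* f) ℤ.* b)) ℤ.+ t ℤ.* ((c ℤ.* f) ℤ.* b) ≡
            (k ℤ.* s ℤ.+ t) ℤ.* ((c ℤ.* f) ℤ.* b)
  collect = solve-∀

  -- Both boundary terms vanish: `reuse 0` has the factor `+ 0`, and `reuse (suc m)` has the factor
  -- `S₂ m (suc m)`, which is zero.
  shift : ∑ (upTo (suc m)) reuse ≡ ∑ (upTo (suc m)) (reuse ∘ suc)
  shift = begin
    ∑ (upTo (suc m)) reuse               ≡⟨ ℤ.+-identityʳ _ ⟨
    ∑ (upTo (suc m)) reuse ℤ.+ 0ℤ        ≡⟨ cong (ℤ._+_ (∑ (upTo (suc m)) reuse)) (trans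
                                              (cong (λ s → + suc m ℤ.* (s ℤ.* (f (suc m) ℤ.* φ (suc m))))
                                                 (S₂-> m (suc m) ℕ.≤-refl))
                                              (ℤ.*-zeroʳ (+ suc m))) ⟨
    ∑ (upTo (suc m)) reuse ℤ.+ reuse (suc m)  ≡⟨ ∑-upTo-last (suc m) reuse ⟨
    ∑ (upTo (suc (suc m))) reuse         ≡⟨ ∑-upTo-head (suc m) reuse ⟩
    0ℤ ℤ.+ ∑ (upTo (suc m)) (reuse ∘ suc) ≡⟨ ℤ.+-identityˡ _ ⟩
    ∑ (upTo (suc m)) (reuse ∘ suc)       ∎

module _ (m n : ℕ) {ℓ} (_≼_ : Rel (Fin (m ℕ.* n)) ℓ) (≼-isTotalOrder : IsTotalOrder _≡_ _≼_) where

  open ChromaticPolynomial (K m n) _≼_ ≼-isTotalOrder using (proper?)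

  module _ {q} (g : Vec (Fin q) m) (h : Vec (Fin q) n) where

    proper⇒unused : (∀ e → ¬ Colouring.Mono (K m n) (lookup (g Vec.++ h)) e) →
                    ∀ j → ¬ lookup h j ∈ used ⊥ g
    proper⇒unused proper j j∈ with ∈-used⁻ ⊥ g j∈
    ... | inj₁ ∈⊥       = ∉⊥ ∈⊥
    ... | inj₂ (i , eq) = proper (combine i j) (subst
      (λ (i , j) → lookup (g Vec.++ h) (i ↑ˡ n) ≡ lookup (g Vec.++ h) (m ↑ʳ j))
      (sym (Fin.remQuot-combine i j))
      (trans (Vec.lookup-++ˡ g h i) (trans eq (sym (Vec.lookup-++ʳ g h j)))))

    unused⇒proper : (∀ j → ¬ lookup h j ∈ used ⊥ g) →
                    ∀ e → ¬ Colouring.Mono (K m n) (lookup (g Vec.++ h)) e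
    unused⇒proper unused e mono = unused j (∈-used⁺ ⊥ g (inj₂ (i ,
      trans (sym (Vec.lookup-++ˡ g h i)) (trans mono (Vec.lookup-++ʳ g h j)))))
      where
      i = proj₁ (remQuot {m} n e)
      j = proj₂ (remQuot {m} n e)

  chromatic-K : ∀ q → ∑ (colourings q (m ℕ.+ n)) (λ f → ⟦ proper? f ⟧) ≡
    ∑ (upTo (suc m)) (λ k → S₂ m k ℤ.* (fallingFactorial (+ q) k ℤ.* (+ q ℤ.- + k) ℤ.^ n))
  chromatic-K q = begin
    ∑ (colourings q (m ℕ.+ n)) (λ f → ⟦ proper? f ⟧)
      ≡⟨ ∑-tuples-++ (allFin q) m _ ⟩
    ∑ (colourings q m) (λ g → ∑ (colourings q n) (λ h → ⟦ proper? (g Vec.++ h) ⟧))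
      ≡⟨ ∑-cong (colourings q m) (λ g → ∑-cong (colourings q n) λ h →
           ⟦⟧-cong (proper? (g Vec.++ h)) (Fin.all? λ j → ¬? (lookup h j ∈? used ⊥ g))
             (proper⇒unused g h) (unused⇒proper g h)) ⟩
    ∑ (colourings q m) (λ g → ∑ (colourings q n) (λ h → ⟦ Fin.all? (λ j → ¬? (lookup h j ∈? used ⊥ g)) ⟧))
      ≡⟨ ∑-cong (colourings q m) (λ g → trans
           (∑-tuples-all (λ c → ¬? (c ∈? used ⊥ g)) (allFin q) n)
           (cong (ℤ._^ n) (∑-∉ (used ⊥ g)))) ⟩
    ∑ (colourings q m) (λ g → (+ q ℤ.- + ∣ used ⊥ g ∣) ℤ.^ n)
      ≡⟨ ∑-used m ⊥ (λ j → (+ q ℤ.- + j) ℤ.^ n) ⟩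
    addVertices (+ q) m (λ j → (+ q ℤ.- + j) ℤ.^ n) ∣ ⊥ {q} ∣
      ≡⟨ cong (addVertices (+ q) m (λ j → (+ q ℤ.- + j) ℤ.^ n)) (∣⊥∣≡0 q) ⟩
    addVertices (+ q) m (λ j → (+ q ℤ.- + j) ℤ.^ n) 0
      ≡⟨ addVertices-S₂ (+ q) m _ ⟩
    ∑ (upTo (suc m)) (λ k → S₂ m k ℤ.* (fallingFactorial (+ q) k ℤ.* (+ q ℤ.- + k) ℤ.^ n))
      ∎
    where open ≡.≡-Reasoning

-- Homogenisation

module ⊗-semigroup = CommutativeSemigroupProperties (CommutativeRing.*-commutativeSemigroup seriesRing)
module ⊕-semigroup = CommutativeSemigroupProperties 𝕊.+-commutativeSemigroup

const-+ : ∀ a b → const (a ℤ.+ b) ≗ const a ⊕ const b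
const-+ a b zero    = refl
const-+ a b (suc _) = refl

const-* : ∀ a b → const (a ℤ.* b) ≗ const a ⊗ const b
const-* a b zero    = refl
const-* a b (suc i) = sym (trans (const-⊗ a (const b) (suc i)) (ℤ.*-zeroʳ a))

const-∑ : ∀ (xs : List A) f → const (∑ xs f) ≗ ∑ˢ.∑ xs (const ∘ f)
const-∑ []       f = λ _ → refl
const-∑ (x ∷ xs) f = 𝕊.trans (const-+ (f x) (∑ xs f)) (𝕊.+-congˡ {const (f x)} (const-∑ xs f))

^ˢ-+ : ∀ f i j → f ^ˢ (i ℕ.+ j) ≗ f ^ˢ i ⊗ f ^ˢ j
^ˢ-+ f zero    j = 𝕊.sym (⊗-identityˡ (f ^ˢ j))
^ˢ-+ f (suc i) j = 𝕊.trans (𝕊.*-congˡ {f} (^ˢ-+ f i j)) (𝕊.sym (⊗-assoc f (f ^ˢ i) (f ^ˢ j)))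

module Homogenisation (x y : Series) where

  eval : ∀ {n} → Vec ℤ n → ℤ → ℤ
  eval []      q = 0ℤ
  eval (c ∷ p) q = c ℤ.+ q ℤ.* eval p q

  -- For coefficients c_0, ..., c_d this is the sum of c_i x^i y^(d-i). The formal degree is the
  -- length of the vector less one, so leading zeros count.
  homogenise : ∀ {n} → Vec ℤ n → Series
  homogenise                []      = 0ˢ
  homogenise {n = suc n} (c ∷ p) = const c ⊗ y ^ˢ n ⊕ x ⊗ homogenise p

  -- The series s is the homogenisation in x and y of the polynomial function a of degree at most d.
  record Homogenises (d : ℕ) (a : ℤ → ℤ) (s : Series) : Set where
    constructor form
    field
      coefficients : Vec ℤ (suc d)
      evaluates    : ∀ q → a q ≡ eval coefficients q
      homogenises  : s ≗ homogenise coefficients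

  H-resp : ∀ {d a a′ s s′} → (∀ q → a′ q ≡ a q) → s′ ≗ s → Homogenises d a s → Homogenises d a′ s′
  H-resp a≡ s≗ (form p ev hom) = form p (λ q → trans (a≡ q) (ev q)) (𝕊.trans s≗ hom)

  H-degree : ∀ {d d′ a s} → d ≡ d′ → Homogenises d a s → Homogenises d′ a s
  H-degree refl H = H

  H-1 : Homogenises 0 (λ _ → 1ℤ) 1ˢ
  H-1 = form (1ℤ ∷ []) (λ q → sym (cong (ℤ._+_ 1ℤ) (ℤ.*-zeroʳ q)))
             (𝕊.sym (𝕊.trans (𝕊.+-cong (⊗-identityˡ 1ˢ) (𝕊.zeroʳ x)) (𝕊.+-identityʳ 1ˢ)))

  H-zero : ∀ d → Homogenises d (λ _ → 0ℤ) 0ˢ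
  H-zero d = form (Vec.replicate (suc d) 0ℤ) (eval-zero (suc d)) (homogenise-zero (suc d))
    where
    eval-zero : ∀ n q → 0ℤ ≡ eval (Vec.replicate n 0ℤ) q
    eval-zero zero    q = refl
    eval-zero (suc n) q = sym (trans (ℤ.+-identityˡ _)
      (trans (cong (ℤ._*_ q) (sym (eval-zero n q))) (ℤ.*-zeroʳ q)))

    homogenise-zero : ∀ n → 0ˢ ≗ homogenise (Vec.replicate n 0ℤ)
    homogenise-zero zero    = 𝕊.refl {0ˢ}
    homogenise-zero (suc n) = 𝕊.sym (𝕊.trans
      (𝕊.+-cong (𝕊.zeroˡ (y ^ˢ n))
                (𝕊.trans (𝕊.*-congˡ {x} (𝕊.sym (homogenise-zero n))) (𝕊.zeroʳ x)))
      (𝕊.+-identityʳ 0ˢ))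

  H-+ : ∀ {d a a′ s s′} → Homogenises d a s → Homogenises d a′ s′ →
        Homogenises d (λ q → a q ℤ.+ a′ q) (s ⊕ s′)
  H-+ (form p ev hom) (form p′ ev′ hom′) =
    form (Vec.zipWith ℤ._+_ p p′)
         (λ q → trans (cong₂ ℤ._+_ (ev q) (ev′ q)) (eval-+ p p′ q))
         (𝕊.trans (𝕊.+-cong hom hom′) (homogenise-+ p p′))
    where
    rearrange : ∀ c c′ q e e′ → (c ℤ.+ q ℤ.* e) ℤ.+ (c′ ℤ.+ q ℤ.* e′) ≡ (c ℤ.+ c′) ℤ.+ q ℤ.* (e ℤ.+ e′)
    rearrange = solve-∀

    eval-+ : ∀ {n} (p p′ : Vec ℤ n) q → eval p q ℤ.+ eval p′ q ≡ eval (Vec.zipWith ℤ._+_ p p′) q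
    eval-+ []      []        q = refl
    eval-+ (c ∷ p) (c′ ∷ p′) q = trans (rearrange c c′ q (eval p q) (eval p′ q))
      (cong (λ e → (c ℤ.+ c′) ℤ.+ q ℤ.* e) (eval-+ p p′ q))

    homogenise-+ : ∀ {n} (p p′ : Vec ℤ n) →
                   homogenise p ⊕ homogenise p′ ≗ homogenise (Vec.zipWith ℤ._+_ p p′)
    homogenise-+ []      []        = 𝕊.+-identityʳ 0ˢ
    homogenise-+ {n = suc n} (c ∷ p) (c′ ∷ p′) = 𝕊.trans
      (⊕-semigroup.interchange (const c ⊗ y ^ˢ n) (x ⊗ homogenise p) (const c′ ⊗ y ^ˢ n) (x ⊗ homogenise p′))
      (𝕊.+-cong
        (𝕊.trans (𝕊.sym (⊗-distribʳ (y ^ˢ n) (const c) (const c′)))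
                 (𝕊.*-congʳ {y ^ˢ n} (𝕊.sym (const-+ c c′))))
        (𝕊.trans (𝕊.sym (𝕊.distribˡ x (homogenise p) (homogenise p′)))
                 (𝕊.*-congˡ {x} (homogenise-+ p p′))))

  H-scale : ∀ {d a s} k → Homogenises d a s → Homogenises d (λ q → k ℤ.* a q) (const k ⊗ s)
  H-scale k (form p ev hom) =
    form (Vec.map (k ℤ.*_) p)
         (λ q → trans (cong (ℤ._*_ k) (ev q)) (eval-scale p q))
         (𝕊.trans (𝕊.*-congˡ {const k} hom) (homogenise-scale p))
    where
    rearrange : ∀ k c q e → k ℤ.* (c ℤ.+ q ℤ.* e) ≡ k ℤ.* c ℤ.+ q ℤ.* (k ℤ.* e)
    rearrange = solve-∀

    eval-scale : ∀ {n} (p : Vec ℤ n) q → k ℤ.* eval p q ≡ eval (Vec.map (k ℤ.*_) p) q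
    eval-scale []      q = ℤ.*-zeroʳ k
    eval-scale (c ∷ p) q = trans (rearrange k c q (eval p q))
      (cong (λ e → k ℤ.* c ℤ.+ q ℤ.* e) (eval-scale p q))

    homogenise-scale : ∀ {n} (p : Vec ℤ n) → const k ⊗ homogenise p ≗ homogenise (Vec.map (k ℤ.*_) p)
    homogenise-scale [] = 𝕊.zeroʳ (const k)
    homogenise-scale {n = suc n} (c ∷ p) = 𝕊.trans
      (𝕊.distribˡ (const k) (const c ⊗ y ^ˢ n) (x ⊗ homogenise p))
      (𝕊.+-cong
        (𝕊.trans (𝕊.sym (⊗-assoc (const k) (const c) (y ^ˢ n)))
                 (𝕊.*-congʳ {y ^ˢ n} (𝕊.sym (const-* k c))))
        (𝕊.trans (⊗-semigroup.x∙yz≈y∙xz (const k) x (homogenise p))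
                 (𝕊.*-congˡ {x} (homogenise-scale p))))

  H-x : ∀ {d a s} → Homogenises d a s → Homogenises (suc d) (λ q → q ℤ.* a q) (x ⊗ s)
  H-x {d} (form p ev hom) = form (0ℤ ∷ p)
    (λ q → trans (cong (ℤ._*_ q) (ev q)) (sym (ℤ.+-identityˡ _)))
    (𝕊.trans (𝕊.*-congˡ {x} hom)
      (𝕊.sym (𝕊.trans (𝕊.+-congʳ {x ⊗ homogenise p} (𝕊.zeroˡ (y ^ˢ suc d))) (𝕊.+-identityˡ (x ⊗ homogenise p)))))

  -- The function stays the same; only its formal degree grows, by a zero leading coefficient. This
  -- is how terms of different degrees are brought to a common one.
  H-y : ∀ {d a s} → Homogenises d a s → Homogenises (suc d) a (y ⊗ s)
  H-y (form p ev hom) = form (p Vec.∷ʳ 0ℤ)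
    (λ q → trans (ev q) (eval-∷ʳ p q))
    (𝕊.trans (𝕊.*-congˡ {y} hom) (homogenise-∷ʳ p))
    where
    eval-∷ʳ : ∀ {n} (p : Vec ℤ n) q → eval p q ≡ eval (p Vec.∷ʳ 0ℤ) q
    eval-∷ʳ []      q = sym (trans (ℤ.+-identityˡ _) (ℤ.*-zeroʳ q))
    eval-∷ʳ (c ∷ p) q = cong (λ e → c ℤ.+ q ℤ.* e) (eval-∷ʳ p q)

    homogenise-∷ʳ : ∀ {n} (p : Vec ℤ n) → y ⊗ homogenise p ≗ homogenise (p Vec.∷ʳ 0ℤ)
    homogenise-∷ʳ [] = 𝕊.trans (𝕊.zeroʳ y) (𝕊.sym (𝕊.trans
      (𝕊.+-cong (𝕊.zeroˡ 1ˢ) (𝕊.zeroʳ x)) (𝕊.+-identityʳ 0ˢ)))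
    homogenise-∷ʳ {n = suc n} (c ∷ p) = 𝕊.trans
      (𝕊.distribˡ y (const c ⊗ y ^ˢ n) (x ⊗ homogenise p))
      (𝕊.+-cong (⊗-semigroup.x∙yz≈y∙xz y (const c) (y ^ˢ n))
        (𝕊.trans (⊗-semigroup.x∙yz≈y∙xz y x (homogenise p))
                 (𝕊.*-congˡ {x} (homogenise-∷ʳ p))))

  H-x^ : ∀ {d a s} k → Homogenises d a s → Homogenises (k ℕ.+ d) (λ q → q ℤ.^ k ℤ.* a q) (x ^ˢ k ⊗ s)
  H-x^ {a = a} {s} zero H = H-resp (λ q → ℤ.*-identityˡ (a q)) (⊗-identityˡ s) H
  H-x^ {a = a} {s} (suc k) H =
    H-resp (λ q → ℤ.*-assoc q _ (a q)) (⊗-assoc x (x ^ˢ k) s) (H-x (H-x^ k H))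

  H-y^ : ∀ {d a s} k → Homogenises d a s → Homogenises (k ℕ.+ d) a (y ^ˢ k ⊗ s)
  H-y^ {s = s} zero    H = H-resp (λ _ → refl) (⊗-identityˡ s) H
  H-y^ {s = s} (suc k) H = H-resp (λ _ → refl) (⊗-assoc y (y ^ˢ k) s) (H-y (H-y^ k H))

  -- The homogenisation of the linear polynomial q - a.
  factor : ℤ → Series
  factor a = x ⊕ const (ℤ.- a) ⊗ y

  H-factor : ∀ {d a s} k → Homogenises d a s →
             Homogenises (suc d) (λ q → (q ℤ.- k) ℤ.* a q) (factor k ⊗ s)
  H-factor {a = a} {s} k H = H-resp
    (λ q → ℤ.*-distribʳ-+ (a q) q (ℤ.- k))
    (𝕊.trans (⊗-distribʳ s x (const (ℤ.- k) ⊗ y)) (𝕊.+-congˡ {x ⊗ s} (⊗-assoc (const (ℤ.- k)) y s)))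
    (H-+ (H-x H) (H-scale (ℤ.- k) (H-y H)))

  H-factor^ : ∀ {d a s} k n → Homogenises d a s →
              Homogenises (n ℕ.+ d) (λ q → (q ℤ.- k) ℤ.^ n ℤ.* a q) (factor k ^ˢ n ⊗ s)
  H-factor^ {a = a} {s} k zero    H = H-resp (λ q → ℤ.*-identityˡ (a q)) (⊗-identityˡ s) H
  H-factor^ {a = a} {s} k (suc n) H = H-resp (λ q → ℤ.*-assoc (q ℤ.- k) _ (a q))
    (⊗-assoc (factor k) (factor k ^ˢ n) s) (H-factor k (H-factor^ k n H))

  H-∑ : ∀ {d} (xs : List A) {a : A → ℤ → ℤ} {s} → (∀ {x} → x ∈ˡ xs → Homogenises d (a x) (s x)) →
        Homogenises d (λ q → ∑ xs (λ x → a x q)) (∑ˢ.∑ xs s)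
  H-∑ []       H = H-zero _
  H-∑ (x ∷ xs) H = H-+ (H (here refl)) (H-∑ xs (H ∘ there))

  private
    n≡1+n*j⇒n≡0 : ∀ n j → n ≡ suc n ℕ.* j → n ≡ 0
    n≡1+n*j⇒n≡0 n zero    eq = trans eq (ℕ.*-zeroʳ (suc n))
    n≡1+n*j⇒n≡0 n (suc j) eq =
      contradiction (ℕ.≤-trans (ℕ.m≤m*n (suc n) (suc j)) (ℕ.≤-reflexive (sym eq))) (ℕ.<-irrefl refl)

  -- Every positive integer divides the difference of the constant coefficients.
  eval-injective : ∀ {n} (p p′ : Vec ℤ n) → (∀ k → eval p (+ suc k) ≡ eval p′ (+ suc k)) → p ≡ p′
  eval-injective []      []        eq = refl
  eval-injective (c ∷ p) (c′ ∷ p′) eq = cong₂ _∷_ c≡c′ (eval-injective p p′ λ k →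
    -- Once the constant coefficients are removed, the argument must be cancelled, so only positive
    -- arguments are used.
    ℤ.*-cancelˡ-≡ (+ suc k) _ _ (+-cancelˡ c _ _
      (trans (eq k) (cong (ℤ._+ + suc k ℤ.* eval p′ (+ suc k)) (sym c≡c′)))))
    where
    -- At the argument `+ suc D` the difference of the constant coefficients is divisible by a
    -- number larger than its own absolute value, so it is zero.
    D : ℕ
    D = ℤ.∣ c ℤ.- c′ ∣

    e : ℤ
    e = eval p′ (+ suc D) ℤ.- eval p (+ suc D)

    move : ∀ c c′ q e e′ → c ℤ.+ q ℤ.* e ≡ c′ ℤ.+ q ℤ.* e′ → c ℤ.- c′ ≡ q ℤ.* (e′ ℤ.- e)
    move c c′ q e e′ eq = begin
      c ℤ.- c′                                     ≡⟨ i₁ c c′ q e ⟩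
      (c ℤ.+ q ℤ.* e) ℤ.- c′ ℤ.- q ℤ.* e           ≡⟨ cong (λ t → t ℤ.- c′ ℤ.- q ℤ.* e) eq ⟩
      (c′ ℤ.+ q ℤ.* e′) ℤ.- c′ ℤ.- q ℤ.* e         ≡⟨ i₂ c′ q e e′ ⟩
      q ℤ.* (e′ ℤ.- e)                             ∎
      where
      open ≡.≡-Reasoning
      i₁ : ∀ c c′ q e → c ℤ.- c′ ≡ (c ℤ.+ q ℤ.* e) ℤ.- c′ ℤ.- q ℤ.* e
      i₁ = solve-∀
      i₂ : ∀ c′ q e e′ → (c′ ℤ.+ q ℤ.* e′) ℤ.- c′ ℤ.- q ℤ.* e ≡ q ℤ.* (e′ ℤ.- e)
      i₂ = solve-∀

    c≡c′ : c ≡ c′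
    c≡c′ = ℤ.i-j≡0⇒i≡j c c′ (ℤ.∣i∣≡0⇒i≡0 (n≡1+n*j⇒n≡0 D ℤ.∣ e ∣ (trans
      (cong ℤ.∣_∣ (move c c′ (+ suc D) (eval p (+ suc D)) (eval p′ (+ suc D)) (eq D)))
      (ℤ.abs-* (+ suc D) e))))

  -- This turns an identity of counts, known for every number of colours, into an identity of
  -- series. Both sides must be given the same formal degree `d`.
  homogenisation-unique : ∀ {d a a′ s s′} → Homogenises d a s → Homogenises d a′ s′ →
                          (∀ q → a (+ q) ≡ a′ (+ q)) → s ≗ s′
  homogenisation-unique (form p ev hom) (form p′ ev′ hom′) eq =
    𝕊.trans hom (𝕊.trans (𝕊.reflexive (cong homogenise (eval-injective p p′ λ k →
      trans (sym (ev (+ suc k))) (trans (eq (suc k)) (ev′ (+ suc k)))))) (𝕊.sym hom′))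

-- The h-polynomial

w : Series
w = 1ˢ ⊖ z

const-⟦⟧-cong : (P? : Dec P) {f g : Series} → (P → f ≗ g) → const ⟦ P? ⟧ ⊗ f ≗ const ⟦ P? ⟧ ⊗ g
const-⟦⟧-cong (yes p)          f≗g = 𝕊.*-congˡ {1ˢ} (f≗g p)
const-⟦⟧-cong (no _)  {f} {g} _   = 𝕊.trans (𝕊.zeroˡ f) (𝕊.sym (𝕊.zeroˡ g))

∑-range : ∀ a b f → ∑[ a to b ] f ≡ ∑ˢ.∑ (upTo (suc b ℕ.∸ a)) (λ i → f (a ℕ.+ i))
∑-range a b f = trans (foldr-∑ (range a b)) (∑ˢ.∑-map (a ℕ.+_) (upTo (suc b ℕ.∸ a)) f)
  where
  foldr-∑ : ∀ xs → List.foldr _⊕_ 0ˢ (List.map f xs) ≡ ∑ˢ.∑ xs f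
  foldr-∑ []       = refl
  foldr-∑ (x ∷ xs) = cong (f x ⊕_) (foldr-∑ xs)

∏-range-suc : ∀ b f → ∏[ 1 to suc b ] f ≗ f (suc b) ⊗ ∏[ 1 to b ] f
∏-range-suc b f = 𝕊.trans
  (𝕊.reflexive (cong (λ xs → List.foldr _⊗_ 1ˢ (List.map f xs))
    (trans (cong (List.map suc) (sym (List.upTo-∷ʳ b))) (List.map-++ suc (upTo b) (b ∷ [])))))
  (snoc (range 1 b) (suc b))
  where
  ∏ : List ℕ → Series
  ∏ xs = List.foldr _⊗_ 1ˢ (List.map f xs)

  snoc : ∀ xs x → ∏ (xs ++ x ∷ []) ≗ f x ⊗ ∏ xs
  snoc []       x = 𝕊.refl {f x ⊗ 1ˢ}
  snoc (y ∷ xs) x = 𝕊.trans (𝕊.*-congˡ {f y} (snoc xs x)) (⊗-semigroup.x∙yz≈y∙xz (f y) (f x) (∏ xs))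

const-⊗-^ : ∀ c f n → (const c ⊗ f) ^ˢ n ≗ const (c ℤ.^ n) ⊗ f ^ˢ n
const-⊗-^ c f zero    = 𝕊.sym (⊗-identityˡ 1ˢ)
const-⊗-^ c f (suc n) = 𝕊.trans (𝕊.*-congˡ {const c ⊗ f} (const-⊗-^ c f n))
  (𝕊.trans (⊗-semigroup.interchange (const c) f (const (c ℤ.^ n)) (f ^ˢ n))
           (𝕊.*-congʳ {f ^ˢ suc n} (𝕊.sym (const-* c (c ℤ.^ n)))))

-1^n*-1^n : ∀ n → -1ℤ ℤ.^ n ℤ.* -1ℤ ℤ.^ n ≡ 1ℤ
-1^n*-1^n zero    = refl
-1^n*-1^n (suc n) = trans (square (-1ℤ ℤ.^ n)) (-1^n*-1^n n)
  where
  square : ∀ a → (-1ℤ ℤ.* a) ℤ.* (-1ℤ ℤ.* a) ≡ a ℤ.* a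
  square = solve-∀

pos-^ : ∀ q n → + (q ℕ.^ n) ≡ (+ q) ℤ.^ n
pos-^ q zero    = refl
pos-^ q (suc n) = trans (ℤ.pos-* q (q ℕ.^ n)) (cong (ℤ._*_ (+ q)) (pos-^ q n))

-- The substitution q = (z - 1)/z, homogenised with x = 1 - z and y = -z.
open Homogenisation w (const -1ℤ ⊗ z)

module FacePolynomial (G : Graph) {ℓ} (_≼_ : Rel (Fin (Graph.#E G)) ℓ)
  (≼-isTotalOrder : IsTotalOrder _≡_ _≼_) (1≤#V : 1 ℕ.≤ Graph.#V G) where

  open Graph G
  open BrokenCircuitComplex G _≼_ ≼-isTotalOrder
  open ChromaticPolynomial G _≼_ ≼-isTotalOrder

  r : ℕ
  r = #V ℕ.∸ 1

  1+r≡#V : suc r ≡ #V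
  1+r≡#V = ℕ.m+[n∸m]≡n 1≤#V

  -- With at least one vertex there is at least one component, so a forest has at most `#V ∸ 1`
  -- edges. This makes the truncated differences `r ∸ ∣ S ∣` genuine.
  face-≤r : ∀ {S} → IsFace S → ∣ S ∣ ℕ.≤ r
  face-≤r {S} face with face-size face
  ... | zero  , _    , class , _ = contradiction (class (fromℕ< 1≤#V)) λ ()
  ... | suc k , size , _     , _ = subst (∣ S ∣ ℕ.≤_) (cong (ℕ._∸ 1) size) (ℕ.m≤n+m ∣ S ∣ k)

  -- The exponent `N` is `r` for the h-polynomial and `#V` for its multiple by `w`, the form that
  -- can be compared with the chromatic polynomial.
  faceTerm : ℕ → Subset #E → Series
  faceTerm N S = const ⟦ isFace? S ⟧ ⊗ (z ^ˢ ∣ S ∣ ⊗ w ^ˢ (N ℕ.∸ ∣ S ∣))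

  facePolynomial : ℕ → Series
  facePolynomial N = ∑ˢ.∑ (subsets #E) (faceTerm N)

  hPolynomial-faces : hPolynomial ≗ facePolynomial r
  hPolynomial-faces = begin
    hPolynomial
      ≡⟨ ∑-range 0 r (λ i → const (+ faceNumber i) ⊗ z ^ˢ i ⊗ w ^ˢ (r ℕ.∸ i)) ⟩
    ∑ˢ.∑ (upTo (suc r)) (λ i → const (+ faceNumber i) ⊗ z ^ˢ i ⊗ w ^ˢ (r ℕ.∸ i))
      ≈⟨ ∑ˢ.∑-cong (upTo (suc r)) expand ⟩
    ∑ˢ.∑ (upTo (suc r)) (λ i → ∑ˢ.∑ (subsets #E) (λ S → term i S))
      ≈⟨ ∑ˢ.∑-swap (upTo (suc r)) (subsets #E) term ⟩
    ∑ˢ.∑ (subsets #E) (λ S → ∑ˢ.∑ (upTo (suc r)) (λ i → term i S))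
      ≈⟨ ∑ˢ.∑-cong (subsets #E) (λ S → collapse S (isFace? S)) ⟩
    facePolynomial r
      ∎
    where
    open SetoidReasoning 𝕊.setoid

    power : ℕ → Series
    power i = z ^ˢ i ⊗ w ^ˢ (r ℕ.∸ i)

    term : ℕ → Subset #E → Series
    term i S = const ⟦ ∣ S ∣ ℕ.≟ i ⟧ ⊗ (const ⟦ isFace? S ⟧ ⊗ power i)

    expand : ∀ i → const (+ faceNumber i) ⊗ z ^ˢ i ⊗ w ^ˢ (r ℕ.∸ i) ≗ ∑ˢ.∑ (subsets #E) (λ S → term i S)
    expand i = begin
      const (+ faceNumber i) ⊗ z ^ˢ i ⊗ w ^ˢ (r ℕ.∸ i)
        ≈⟨ ⊗-assoc (const (+ faceNumber i)) (z ^ˢ i) (w ^ˢ (r ℕ.∸ i)) ⟩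
      const (+ faceNumber i) ⊗ power i
        ≡⟨ cong (λ c → const c ⊗ power i)
             (length-filter (λ S → (∣ S ∣ ℕ.≟ i) ×-dec isFace? S) (subsets #E)) ⟩
      const (∑ (subsets #E) (λ S → ⟦ (∣ S ∣ ℕ.≟ i) ×-dec isFace? S ⟧)) ⊗ power i
        ≈⟨ 𝕊.*-congʳ {power i} (const-∑ (subsets #E) _) ⟩
      ∑ˢ.∑ (subsets #E) (λ S → const ⟦ (∣ S ∣ ℕ.≟ i) ×-dec isFace? S ⟧) ⊗ power i
        ≈⟨ ∑ˢ.∑-*ʳ (subsets #E) (power i) _ ⟨
      ∑ˢ.∑ (subsets #E) (λ S → const ⟦ (∣ S ∣ ℕ.≟ i) ×-dec isFace? S ⟧ ⊗ power i)
        ≈⟨ ∑ˢ.∑-cong (subsets #E) (λ S → 𝕊.trans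
             (𝕊.*-congʳ {power i} (𝕊.trans
               (𝕊.reflexive (cong const (⟦⟧-× (∣ S ∣ ℕ.≟ i) (isFace? S))))
               (const-* ⟦ ∣ S ∣ ℕ.≟ i ⟧ ⟦ isFace? S ⟧)))
             (⊗-assoc (const ⟦ ∣ S ∣ ℕ.≟ i ⟧) (const ⟦ isFace? S ⟧) (power i))) ⟩
      ∑ˢ.∑ (subsets #E) (λ S → term i S)
        ∎

    collapse : ∀ S (face? : Dec (IsFace S)) →
      ∑ˢ.∑ (upTo (suc r)) (λ i → const ⟦ ∣ S ∣ ℕ.≟ i ⟧ ⊗ (const ⟦ face? ⟧ ⊗ power i)) ≗
      const ⟦ face? ⟧ ⊗ power ∣ S ∣
    collapse S (no _) = 𝕊.trans
      (∑ˢ.∑-zero (upTo (suc r)) λ i → 𝕊.trans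
        (𝕊.*-congˡ {const ⟦ ∣ S ∣ ℕ.≟ i ⟧} (𝕊.zeroˡ (power i))) (𝕊.zeroʳ (const ⟦ ∣ S ∣ ℕ.≟ i ⟧)))
      (𝕊.sym (𝕊.zeroˡ (power ∣ S ∣)))
    collapse S (yes face) = 𝕊.trans
      (∑ˢ.∑-single (λ i → const ⟦ ∣ S ∣ ℕ.≟ i ⟧ ⊗ (1ˢ ⊗ power i))
        (List.upTo⁺ (suc r)) (∈-upTo⁺ (ℕ.s≤s (face-≤r face)))
        (λ {i} _ i≢ → 𝕊.trans
          (𝕊.*-congʳ {1ˢ ⊗ power i} (𝕊.reflexive (cong const (⟦⟧-no (∣ S ∣ ℕ.≟ i) (i≢ ∘ sym)))))
          (𝕊.zeroˡ (1ˢ ⊗ power i))))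
      (𝕊.trans
        (𝕊.*-congʳ {1ˢ ⊗ power ∣ S ∣} (𝕊.reflexive (cong const (⟦⟧-yes (∣ S ∣ ℕ.≟ ∣ S ∣) refl))))
        (⊗-identityˡ (1ˢ ⊗ power ∣ S ∣)))

  -- The chromatic polynomial has degree `#V`, one more than `r`; the extra factor `w` makes up the
  -- difference in every face term, since `∣ S ∣` is at most `r`.
  w⊗facePolynomial : w ⊗ facePolynomial r ≗ facePolynomial #V
  w⊗facePolynomial = 𝕊.trans (𝕊.sym (∑ˢ.∑-*ˡ (subsets #E) w (faceTerm r)))
    (∑ˢ.∑-cong (subsets #E) λ S → 𝕊.trans
      (⊗-semigroup.x∙yz≈y∙xz w (const ⟦ isFace? S ⟧) (z ^ˢ ∣ S ∣ ⊗ w ^ˢ (r ℕ.∸ ∣ S ∣)))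
      (const-⟦⟧-cong (isFace? S) λ face → 𝕊.trans
        (⊗-semigroup.x∙yz≈y∙xz w (z ^ˢ ∣ S ∣) (w ^ˢ (r ℕ.∸ ∣ S ∣)))
        (𝕊.*-congˡ {z ^ˢ ∣ S ∣} (𝕊.reflexive (cong (w ^ˢ_)
          (trans (sym (ℕ.+-∸-assoc 1 (face-≤r face))) (cong (ℕ._∸ ∣ S ∣) 1+r≡#V)))))))

  signedFaces : ℤ → ℤ
  signedFaces q = ∑ (subsets #E) (λ S → ⟦ isFace? S ⟧ ℤ.* (sign S ℤ.* q ℤ.^ (#V ℕ.∸ ∣ S ∣)))

  -- The sign of `S` in the chromatic polynomial meets the sign of y^|S| = (-z)^|S|, and the two
  -- cancel: the signed count becomes the unsigned sum of z^|S| (1-z)^(#V-|S|).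
  H-faces : Homogenises #V signedFaces (facePolynomial #V)
  H-faces = H-∑ (subsets #E) λ {S} _ → H-face S (isFace? S)
    where
    H-face : ∀ S (face? : Dec (IsFace S)) →
      Homogenises #V (λ q → ⟦ face? ⟧ ℤ.* (sign S ℤ.* q ℤ.^ (#V ℕ.∸ ∣ S ∣)))
                     (const ⟦ face? ⟧ ⊗ (z ^ˢ ∣ S ∣ ⊗ w ^ˢ (#V ℕ.∸ ∣ S ∣)))
    H-face S (no _)     = H-resp (λ _ → refl) (𝕊.zeroˡ (z ^ˢ ∣ S ∣ ⊗ w ^ˢ (#V ℕ.∸ ∣ S ∣))) (H-zero #V)
    H-face S (yes face) = H-scale 1ℤ (H-resp
      (λ q → cong (ℤ._*_ (sign S)) (sym (ℤ.*-identityʳ _)))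
      powers
      (H-scale (sign S) (H-degree
        (trans (cong (∣ S ∣ ℕ.+_) (ℕ.+-identityʳ _)) (ℕ.m+[n∸m]≡n (face-≤ face)))
        (H-y^ ∣ S ∣ (H-x^ (#V ℕ.∸ ∣ S ∣) H-1)))))
      where
      open SetoidReasoning 𝕊.setoid
      i = ∣ S ∣
      W = w ^ˢ (#V ℕ.∸ ∣ S ∣)

      powers : z ^ˢ i ⊗ W ≗ const (sign S) ⊗ ((const -1ℤ ⊗ z) ^ˢ i ⊗ (W ⊗ 1ˢ))
      powers = begin
        z ^ˢ i ⊗ W
          ≈⟨ 𝕊.*-congʳ {W} (⊗-identityˡ (z ^ˢ i)) ⟨
        (1ˢ ⊗ z ^ˢ i) ⊗ W
          ≈⟨ 𝕊.*-congʳ {W} (𝕊.*-congʳ {z ^ˢ i} (𝕊.trans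
               (𝕊.reflexive (cong const (sym (-1^n*-1^n i)))) (const-* (sign S) (sign S)))) ⟩
        ((const (sign S) ⊗ const (sign S)) ⊗ z ^ˢ i) ⊗ W
          ≈⟨ 𝕊.*-congʳ {W} (⊗-assoc (const (sign S)) (const (sign S)) (z ^ˢ i)) ⟩
        (const (sign S) ⊗ (const (sign S) ⊗ z ^ˢ i)) ⊗ W
          ≈⟨ ⊗-assoc (const (sign S)) (const (sign S) ⊗ z ^ˢ i) W ⟩
        const (sign S) ⊗ ((const (sign S) ⊗ z ^ˢ i) ⊗ W)
          ≈⟨ 𝕊.*-congˡ {const (sign S)} (𝕊.*-cong (𝕊.sym (const-⊗-^ -1ℤ z i)) (𝕊.sym (𝕊.*-identityʳ W))) ⟩
        const (sign S) ⊗ ((const -1ℤ ⊗ z) ^ˢ i ⊗ (W ⊗ 1ˢ))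
          ∎

  chromatic-signedFaces : ∀ q → ∑ (colourings q #V) (λ f → ⟦ proper? f ⟧) ≡ signedFaces (+ q)
  chromatic-signedFaces q = trans (chromatic q) (∑-cong (subsets #E) λ S →
    cong (λ c → ⟦ isFace? S ⟧ ℤ.* (sign S ℤ.* c)) (pos-^ q (#V ℕ.∸ ∣ S ∣)))

-- The homogenised chromatic polynomial of the complete bipartite graph

fallingProduct : ℕ → Series
fallingProduct zero    = 1ˢ
fallingProduct (suc k) = factor (+ k) ⊗ fallingProduct k

H-fallingProduct : ∀ k → Homogenises k (λ q → fallingFactorial q k) (fallingProduct k)
H-fallingProduct zero    = H-1
H-fallingProduct (suc k) = H-factor (+ k) (H-fallingProduct k)

linear : ℕ → Series
linear a = 1ˢ ⊕ const (+ a) ⊗ z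

-- (1 - z) + (k+1)z = 1 + kz. This is the origin of the shift by one that turns (q - k)^n into the
-- power of 1 + (k-1)z.
factor-suc : ∀ k → factor (+ suc k) ≗ linear k
factor-suc k i = begin
  (1ˢ i ℤ.- z i) ℤ.+ (const (ℤ.- + suc k) ⊗ (const -1ℤ ⊗ z)) i
    ≡⟨ cong (ℤ._+_ (1ˢ i ℤ.- z i)) (trans (const-⊗ (ℤ.- + suc k) (const -1ℤ ⊗ z) i)
         (cong (ℤ._*_ (ℤ.- + suc k)) (const-⊗ -1ℤ z i))) ⟩
  (1ˢ i ℤ.- z i) ℤ.+ (ℤ.- (1ℤ ℤ.+ + k)) ℤ.* (-1ℤ ℤ.* z i)
    ≡⟨ identity (1ˢ i) (z i) (+ k) ⟩
  1ˢ i ℤ.+ + k ℤ.* z i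
    ≡⟨ cong (ℤ._+_ (1ˢ i)) (const-⊗ (+ k) z i) ⟨
  linear k i
    ∎
  where
  open ≡.≡-Reasoning
  identity : ∀ u v k → (u ℤ.- v) ℤ.+ (ℤ.- (1ℤ ℤ.+ k)) ℤ.* (-1ℤ ℤ.* v) ≡ u ℤ.+ k ℤ.* v
  identity = solve-∀

linear-0 : linear 0 ≗ 1ˢ
linear-0 = 𝕊.trans (𝕊.+-congˡ {1ˢ} (𝕊.zeroˡ z)) (𝕊.+-identityʳ 1ˢ)

-- The factor for a = 0 is `w`, the one for a = 1 is 1, and the remaining ones are `linear 1` up to
-- `linear (k ∸ 1)`. Truncated subtraction makes the product empty in the two smallest cases, as it
-- should be.
fallingProduct-suc : ∀ k → fallingProduct (suc k) ≗ w ⊗ ∏[ 1 to suc k ℕ.∸ 2 ] linear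
fallingProduct-suc zero = 𝕊.*-congʳ {1ˢ} (𝕊.trans (𝕊.+-congˡ {w} (𝕊.zeroˡ (const -1ℤ ⊗ z))) (𝕊.+-identityʳ w))
fallingProduct-suc (suc zero) = 𝕊.trans
  (𝕊.*-cong (𝕊.trans (factor-suc 0) linear-0) (fallingProduct-suc 0))
  (⊗-identityˡ (w ⊗ 1ˢ))
fallingProduct-suc (suc (suc k)) = 𝕊.trans
  (𝕊.*-cong (factor-suc (suc k)) (fallingProduct-suc (suc k)))
  (𝕊.trans (⊗-semigroup.x∙yz≈y∙xz (linear (suc k)) w (∏[ 1 to k ] linear))
           (𝕊.*-congˡ {w} (𝕊.sym (∏-range-suc k linear))))

bipartiteTerm : ℕ → ℕ → ℕ → Series
bipartiteTerm m n k =
  const (S₂ m k) ⊗ ((const -1ℤ ⊗ z) ^ˢ (m ℕ.∸ k) ⊗ (factor (+ k) ^ˢ n ⊗ fallingProduct k))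

-- The k-th summand has degree n + k, and the padding `(const -1ℤ ⊗ z) ^ˢ (m ∸ k)` brings it to m +
-- n; here k ≤ m is needed.
H-bipartite : ∀ m n → Homogenises (m ℕ.+ n)
  (λ q → ∑ (upTo (suc m)) (λ k → S₂ m k ℤ.* (fallingFactorial q k ℤ.* (q ℤ.- + k) ℤ.^ n)))
  (∑ˢ.∑ (upTo (suc m)) (bipartiteTerm m n))
H-bipartite m n = H-∑ (upTo (suc m)) (λ {k} → H-term k)
  where
  degree : ∀ k → k ℕ.≤ m → (m ℕ.∸ k) ℕ.+ (n ℕ.+ k) ≡ m ℕ.+ n
  degree k k≤m = begin
    (m ℕ.∸ k) ℕ.+ (n ℕ.+ k)  ≡⟨ cong ((m ℕ.∸ k) ℕ.+_) (ℕ.+-comm n k) ⟩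
    (m ℕ.∸ k) ℕ.+ (k ℕ.+ n)  ≡⟨ ℕ.+-assoc (m ℕ.∸ k) k n ⟨
    (m ℕ.∸ k) ℕ.+ k ℕ.+ n    ≡⟨ cong (ℕ._+ n) (ℕ.m∸n+n≡m k≤m) ⟩
    m ℕ.+ n                  ∎
    where open ≡.≡-Reasoning

  H-term : ∀ k → k ∈ˡ upTo (suc m) → Homogenises (m ℕ.+ n)
    (λ q → S₂ m k ℤ.* (fallingFactorial q k ℤ.* (q ℤ.- + k) ℤ.^ n)) (bipartiteTerm m n k)
  H-term k k∈ = H-scale (S₂ m k) (H-resp
    (λ q → ℤ.*-comm (fallingFactorial q k) ((q ℤ.- + k) ℤ.^ n)) (λ _ → refl)
    (H-degree (degree k (ℕ.≤-pred (∈-upTo⁻ k∈)))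
      (H-y^ (m ℕ.∸ k) (H-factor^ (+ k) n (H-fallingProduct k)))))

hTerm : ℕ → ℕ → ℕ → Series
hTerm m n k = const (-1ℤ ℤ.^ (m ℕ.+ k) ℤ.* S₂ m k) ⊗ z ^ˢ (m ℕ.∸ k) ⊗ ∏[ 1 to k ℕ.∸ 2 ] linear ⊗ linear (k ℕ.∸ 1) ^ˢ n

^ˢ-cong : ∀ {f g} n → f ≗ g → f ^ˢ n ≗ g ^ˢ n
^ˢ-cong zero    f≗g = 𝕊.refl {1ˢ}
^ˢ-cong (suc n) f≗g = 𝕊.*-cong f≗g (^ˢ-cong n f≗g)

bipartiteTerm-suc : ∀ m n k → suc k ℕ.≤ m → bipartiteTerm m n (suc k) ≗ w ⊗ hTerm m n (suc k)
bipartiteTerm-suc m n k k<m = begin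
  bipartiteTerm m n (suc k)
    ≈⟨ 𝕊.*-congˡ {α} (𝕊.*-cong (const-⊗-^ -1ℤ z j) (𝕊.*-cong (^ˢ-cong n (factor-suc k)) (fallingProduct-suc k))) ⟩
  α ⊗ ((β ⊗ γ) ⊗ (δ ⊗ (w ⊗ π)))
    ≈⟨ 𝕊.*-congˡ {α} (𝕊.*-congˡ {β ⊗ γ} (⊗-semigroup.x∙yz≈y∙zx δ w π)) ⟩
  α ⊗ ((β ⊗ γ) ⊗ (w ⊗ (π ⊗ δ)))
    ≈⟨ 𝕊.*-congˡ {α} (⊗-semigroup.x∙yz≈y∙xz (β ⊗ γ) w (π ⊗ δ)) ⟩
  α ⊗ (w ⊗ ((β ⊗ γ) ⊗ (π ⊗ δ)))
    ≈⟨ ⊗-semigroup.x∙yz≈y∙xz α w ((β ⊗ γ) ⊗ (π ⊗ δ)) ⟩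
  w ⊗ (α ⊗ ((β ⊗ γ) ⊗ (π ⊗ δ)))
    ≈⟨ 𝕊.*-congˡ {w} (⊗-assoc α (β ⊗ γ) (π ⊗ δ)) ⟨
  w ⊗ ((α ⊗ (β ⊗ γ)) ⊗ (π ⊗ δ))
    ≈⟨ 𝕊.*-congˡ {w} (⊗-assoc (α ⊗ (β ⊗ γ)) π δ) ⟨
  w ⊗ (((α ⊗ (β ⊗ γ)) ⊗ π) ⊗ δ)
    ≈⟨ 𝕊.*-congˡ {w} (𝕊.*-congʳ {δ} (𝕊.*-congʳ {π} (𝕊.trans
         (⊗-semigroup.x∙yz≈yx∙z α β γ) (𝕊.*-congʳ {γ} (𝕊.sym (const-* σ (S₂ m (suc k)))))))) ⟩
  w ⊗ (((const (σ ℤ.* S₂ m (suc k)) ⊗ γ) ⊗ π) ⊗ δ)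
    ≡⟨ cong (λ σ → w ⊗ (((const (σ ℤ.* S₂ m (suc k)) ⊗ γ) ⊗ π) ⊗ δ)) σ≡ ⟩
  w ⊗ hTerm m n (suc k)
    ∎
  where
  open SetoidReasoning 𝕊.setoid
  j = m ℕ.∸ suc k
  σ = -1ℤ ℤ.^ j
  α = const (S₂ m (suc k))
  β = const σ
  γ = z ^ˢ j
  δ = linear k ^ˢ n
  π = ∏[ 1 to suc k ℕ.∸ 2 ] linear

  -- The exponents m - (k+1) and m + (k+1) differ by an even number: multiply by the square of
  -- (-1)^(k+1).
  σ≡ : σ ≡ -1ℤ ℤ.^ (m ℕ.+ suc k)
  σ≡ = trans (sym (ℤ.*-identityʳ σ)) (trans (cong (ℤ._*_ σ) (sym (-1^n*-1^n (suc k))))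
    (trans (cong (ℤ._*_ σ) (sym (ℤ.^-distribˡ-+-* -1ℤ (suc k) (suc k))))
    (trans (sym (ℤ.^-distribˡ-+-* -1ℤ j (suc k ℕ.+ suc k)))
      (cong (ℤ._^_ -1ℤ) (trans (sym (ℕ.+-assoc j (suc k) (suc k))) (cong (ℕ._+ suc k) (ℕ.m∸n+n≡m k<m)))))))

module _ (m n : ℕ) (1≤m : 1 ℕ.≤ m)
  {ℓ} (_≼_ : Rel (Fin (m ℕ.* n)) ℓ) (≼-isTotalOrder : IsTotalOrder _≡_ _≼_) where

  open BrokenCircuitComplex (K m n) _≼_ ≼-isTotalOrder using (hPolynomial)
  open FacePolynomial (K m n) _≼_ ≼-isTotalOrder (ℕ.≤-trans 1≤m (ℕ.m≤m+n m n))

  -- A nonempty set has no partition into zero blocks. So the term k = 0 drops out, the only one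
  -- whose falling product lacks the factor `w`.
  S₂-0 : S₂ m 0 ≡ 0ℤ
  S₂-0 = trans (cong (λ m → S₂ m 0) (sym (ℕ.m+[n∸m]≡n 1≤m))) (S₂-suc-0 (m ℕ.∸ 1))

  hPolynomial-bipartite : hPolynomial ≗ ∑[ 1 to m ] (hTerm m n)
  -- Both sides are compared after multiplication by `w`, which can be cancelled because its
  -- constant term is 1.
  hPolynomial-bipartite = ⊗-cancelʳ w refl (begin
    hPolynomial ⊗ w
      ≈⟨ ⊗-comm hPolynomial w ⟩
    w ⊗ hPolynomial
      ≈⟨ 𝕊.*-congˡ {w} hPolynomial-faces ⟩
    w ⊗ facePolynomial r
      ≈⟨ w⊗facePolynomial ⟩
    facePolynomial (m ℕ.+ n)
      ≈⟨ homogenisation-unique H-faces (H-bipartite m n) (λ q →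
           trans (sym (chromatic-signedFaces q)) (chromatic-K m n _≼_ ≼-isTotalOrder q)) ⟩
    ∑ˢ.∑ (upTo (suc m)) (bipartiteTerm m n)
      ≡⟨ cong (λ xs → ∑ˢ.∑ xs (bipartiteTerm m n)) (upTo-suc m) ⟩
    bipartiteTerm m n 0 ⊕ ∑ˢ.∑ (List.map suc (upTo m)) (bipartiteTerm m n)
      ≡⟨ cong (bipartiteTerm m n 0 ⊕_) (∑ˢ.∑-map suc (upTo m) (bipartiteTerm m n)) ⟩
    bipartiteTerm m n 0 ⊕ ∑ˢ.∑ (upTo m) (bipartiteTerm m n ∘ suc)
      ≈⟨ 𝕊.+-cong
           (𝕊.trans (𝕊.*-congʳ {rest₀} (𝕊.reflexive (cong const S₂-0))) (𝕊.zeroˡ rest₀))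
           (∑ˢ.∑-cong-∈ (upTo m) (λ k∈ → bipartiteTerm-suc m n _ (∈-upTo⁻ k∈))) ⟩
    0ˢ ⊕ ∑ˢ.∑ (upTo m) (λ k → w ⊗ hTerm m n (suc k))
      ≈⟨ 𝕊.+-identityˡ _ ⟩
    ∑ˢ.∑ (upTo m) (λ k → w ⊗ hTerm m n (suc k))
      ≈⟨ ∑ˢ.∑-*ˡ (upTo m) w (hTerm m n ∘ suc) ⟩
    w ⊗ ∑ˢ.∑ (upTo m) (hTerm m n ∘ suc)
      ≡⟨ cong (w ⊗_) (∑-range 1 m (hTerm m n)) ⟨
    w ⊗ ∑[ 1 to m ] (hTerm m n)
      ≈⟨ ⊗-comm w (∑[ 1 to m ] (hTerm m n)) ⟩
    ∑[ 1 to m ] (hTerm m n) ⊗ w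
      ∎)
    where
    open SetoidReasoning 𝕊.setoid
    rest₀ = (const -1ℤ ⊗ z) ^ˢ m ⊗ (factor (+ 0) ^ˢ n ⊗ fallingProduct 0)

-- Counting monomials by support

nonzero : ℕ → Bool
nonzero zero    = false
nonzero (suc _) = true

support : ∀ {n} → Vec ℕ n → Subset n
support = Vec.map nonzero

bump : ∀ {n} → Vec ℕ (suc n) → Vec ℕ (suc n)
bump (a ∷ α) = suc a ∷ α

bump-injective : ∀ {n} {α β : Vec ℕ (suc n)} → bump α ≡ bump β → α ≡ β
bump-injective {α = _ ∷ _} {β = _ ∷ _} refl = refl

monomials : ∀ n → ℕ → List (Vec ℕ n)
monomials zero    zero    = [] ∷ []
monomials zero    (suc d) = []
monomials (suc n) zero    = List.map (0 ∷_) (monomials n zero)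
monomials (suc n) (suc d) = List.map (0 ∷_) (monomials n (suc d)) ++ List.map bump (monomials (suc n) d)

monomials-unique : ∀ n d → List.Unique (monomials n d)
monomials-unique zero    zero    = [] ∷ []
monomials-unique zero    (suc d) = []
monomials-unique (suc n) zero    = List.map⁺ Vec.∷-injectiveʳ (monomials-unique n zero)
monomials-unique (suc n) (suc d) = List.++⁺
  (List.map⁺ Vec.∷-injectiveʳ (monomials-unique n (suc d)))
  (List.map⁺ bump-injective (monomials-unique (suc n) d))
  (λ (α∈ , α∈′) → disjoint (∈-map⁻ (0 ∷_) α∈) (∈-map⁻ bump α∈′))
  where
  disjoint : ∀ {α : Vec ℕ (suc n)} {xs : List (Vec ℕ n)} {ys : List (Vec ℕ (suc n))} →
             (∃ λ β → β ∈ˡ xs × α ≡ 0 ∷ β) → ¬ ∃ λ β → β ∈ˡ ys × α ≡ bump β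
  disjoint (_ , _ , refl) (_ ∷ _ , _ , ())

∈-monomials : ∀ {n} (α : Vec ℕ n) → α ∈ˡ monomials n (Vec.sum α)
∈-monomials []          = here refl
∈-monomials (zero ∷ α)  = ∈-0∷ (Vec.sum α) (∈-monomials α)
  where
  ∈-0∷ : ∀ {n} {α : Vec ℕ n} d → α ∈ˡ monomials n d → (0 ∷ α) ∈ˡ monomials (suc n) d
  ∈-0∷ zero    α∈ = ∈-map⁺ (0 ∷_) α∈
  ∈-0∷ (suc d) α∈ = ∈-++⁺ˡ (∈-map⁺ (0 ∷_) α∈)
∈-monomials (suc a ∷ α) = ∈-++⁺ʳ (List.map (0 ∷_) (monomials _ _)) (∈-map⁺ bump (∈-monomials (a ∷ α)))

monomials-degree : ∀ n d {α} → α ∈ˡ monomials n d → Vec.sum α ≡ d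
monomials-degree zero    zero    (here refl) = refl
monomials-degree (suc n) zero    α∈ with ∈-map⁻ (0 ∷_) α∈
... | _ , β∈ , refl = monomials-degree n zero β∈
monomials-degree (suc n) (suc d) α∈ with ∈-++⁻ (List.map (0 ∷_) (monomials n (suc d))) α∈
... | inj₁ α∈₁ with ∈-map⁻ (0 ∷_) α∈₁
...   | _ , β∈ , refl = monomials-degree n (suc d) β∈
monomials-degree (suc n) (suc d) α∈ | inj₂ α∈₂ with ∈-map⁻ bump α∈₂
...   | _ ∷ _ , β∈ , refl = cong suc (monomials-degree (suc n) d β∈)

#withSupport : ∀ {n} → Subset n → Series
#withSupport {n} S d = ∑ (monomials n d) (λ α → ⟦ support α ≟ˢ S ⟧)

∑-0∷ : ∀ {n} (S : Subset n) d →
  ∑ (List.map (0 ∷_) (monomials n d)) (λ α → ⟦ support α ≟ˢ (outside ∷ S) ⟧) ≡ #withSupport S d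
∑-0∷ {n} S d = trans (∑-map (0 ∷_) (monomials n d) _) (∑-cong (monomials n d) λ α →
  ⟦⟧-cong (support (0 ∷ α) ≟ˢ (outside ∷ S)) (support α ≟ˢ S) Vec.∷-injectiveʳ (cong (outside ∷_)))

#withSupport-outside : ∀ {n} (S : Subset n) → #withSupport (outside ∷ S) ≗ #withSupport S
#withSupport-outside     S zero    = ∑-0∷ S zero
#withSupport-outside {n} S (suc d) =
  trans (∑-++ (List.map (0 ∷_) (monomials n (suc d))) _ _) (trans
    (cong₂ ℤ._+_ (∑-0∷ S (suc d)) (trans
      (∑-map bump (monomials (suc n) d) _)
      (∑-zero (monomials (suc n) d) λ { α@(_ ∷ _) →
        ⟦⟧-no (support (bump α) ≟ˢ (outside ∷ S)) λ () })))
    (ℤ.+-identityʳ _))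

#withSupport-inside-0 : ∀ {n} (S : Subset n) → #withSupport (inside ∷ S) 0 ≡ 0ℤ
#withSupport-inside-0 {n} S = trans (∑-map (0 ∷_) (monomials n 0) _)
  (∑-zero (monomials n 0) λ α → ⟦⟧-no (support (0 ∷ α) ≟ˢ (inside ∷ S)) λ ())

-- Lower the positive first exponent by one: the result has degree `d`, and the first variable
-- either still occurs in it or has just disappeared.
#withSupport-inside-suc : ∀ {n} (S : Subset n) d →
  #withSupport (inside ∷ S) (suc d) ≡ #withSupport (inside ∷ S) d ℤ.+ #withSupport (outside ∷ S) d
#withSupport-inside-suc {n} S d = begin
  #withSupport (inside ∷ S) (suc d)
    ≡⟨ ∑-++ (List.map (0 ∷_) (monomials n (suc d))) _ _ ⟩
  ∑ (List.map (0 ∷_) (monomials n (suc d))) (λ α → ⟦ support α ≟ˢ (inside ∷ S) ⟧) ℤ.+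
  ∑ (List.map bump (monomials (suc n) d)) (λ α → ⟦ support α ≟ˢ (inside ∷ S) ⟧)
    ≡⟨ cong₂ ℤ._+_
         (trans (∑-map (0 ∷_) (monomials n (suc d)) _) (∑-zero (monomials n (suc d)) λ α →
           ⟦⟧-no (support (0 ∷ α) ≟ˢ (inside ∷ S)) λ ()))
         (∑-map bump (monomials (suc n) d) _) ⟩
  0ℤ ℤ.+ ∑ (monomials (suc n) d) (λ α → ⟦ support (bump α) ≟ˢ (inside ∷ S) ⟧)
    ≡⟨ ℤ.+-identityˡ _ ⟩
  ∑ (monomials (suc n) d) (λ α → ⟦ support (bump α) ≟ˢ (inside ∷ S) ⟧)
    ≡⟨ ∑-cong (monomials (suc n) d) split ⟩
  ∑ (monomials (suc n) d) (λ α → ⟦ support α ≟ˢ (inside ∷ S) ⟧ ℤ.+ ⟦ support α ≟ˢ (outside ∷ S) ⟧)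
    ≡⟨ ∑-+ (monomials (suc n) d) _ _ ⟩
  #withSupport (inside ∷ S) d ℤ.+ #withSupport (outside ∷ S) d
    ∎
  where
  open ≡.≡-Reasoning

  split : ∀ α → ⟦ support (bump α) ≟ˢ (inside ∷ S) ⟧ ≡
                ⟦ support α ≟ˢ (inside ∷ S) ⟧ ℤ.+ ⟦ support α ≟ˢ (outside ∷ S) ⟧
  split (zero ∷ α) = trans
    (⟦⟧-cong ((inside ∷ support α) ≟ˢ (inside ∷ S)) ((outside ∷ support α) ≟ˢ (outside ∷ S))
      (cong (outside ∷_) ∘ Vec.∷-injectiveʳ) (cong (inside ∷_) ∘ Vec.∷-injectiveʳ))
    (sym (trans (cong (ℤ._+ ⟦ support (0 ∷ α) ≟ˢ (outside ∷ S) ⟧)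
      (⟦⟧-no ((outside ∷ support α) ≟ˢ (inside ∷ S)) λ ())) (ℤ.+-identityˡ _)))
  split (suc a ∷ α) = sym (trans
    (cong (ℤ._+_ ⟦ (inside ∷ support α) ≟ˢ (inside ∷ S) ⟧)
      (⟦⟧-no ((inside ∷ support α) ≟ˢ (outside ∷ S)) λ ()))
    (ℤ.+-identityʳ _))

z-⊗-suc : ∀ f d → (z ⊗ f) (suc d) ≡ f d
z-⊗-suc f d = trans (ℤ.+-identityˡ _) (trans (⊗-cong z∘suc≗1 (λ _ → refl) d) (⊗-identityˡ f d))
  where
  z∘suc≗1 : z ∘ suc ≗ 1ˢ
  z∘suc≗1 zero    = refl
  z∘suc≗1 (suc _) = refl

w⊗f≗f⊖z⊗f : ∀ f → w ⊗ f ≗ f ⊖ z ⊗ f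
w⊗f≗f⊖z⊗f f = 𝕊.trans (⊗-distribʳ f 1ˢ (λ i → ℤ.- z i))
  (𝕊.+-cong (⊗-identityˡ f) (𝕊.sym (-‿distribˡ-* z f)))
  where open RingProperties 𝕊.ring using (-‿distribˡ-*)

-- A variable that must occur contributes z + z^2 + ... = z/(1-z); the denominator is cleared, so
-- that no inverse series is required.
w⊗#withSupport-inside : ∀ {n} (S : Subset n) → w ⊗ #withSupport (inside ∷ S) ≗ z ⊗ #withSupport S
w⊗#withSupport-inside S zero = trans (w⊗f≗f⊖z⊗f (#withSupport (inside ∷ S)) 0)
  (cong (λ c → c ℤ.- 0ℤ) (#withSupport-inside-0 S))
w⊗#withSupport-inside S (suc d) = begin
  (w ⊗ c) (suc d)                                      ≡⟨ w⊗f≗f⊖z⊗f c (suc d) ⟩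
  c (suc d) ℤ.- (z ⊗ c) (suc d)                        ≡⟨ cong₂ ℤ._-_ (#withSupport-inside-suc S d) (z-⊗-suc c d) ⟩
  c d ℤ.+ #withSupport (outside ∷ S) d ℤ.- c d         ≡⟨ cancel (c d) _ ⟩
  #withSupport (outside ∷ S) d                         ≡⟨ #withSupport-outside S d ⟩
  #withSupport S d                                     ≡⟨ z-⊗-suc (#withSupport S) d ⟨
  (z ⊗ #withSupport S) (suc d)                         ∎
  where
  open ≡.≡-Reasoning
  c = #withSupport (inside ∷ S)
  cancel : ∀ x y → x ℤ.+ y ℤ.- x ≡ y
  cancel = solve-∀

w^∣S∣⊗#withSupport : ∀ {n} (S : Subset n) → w ^ˢ ∣ S ∣ ⊗ #withSupport S ≗ z ^ˢ ∣ S ∣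
w^∣S∣⊗#withSupport [] = 𝕊.trans (⊗-identityˡ (#withSupport [])) λ { zero → refl ; (suc _) → refl }
w^∣S∣⊗#withSupport (outside ∷ S) =
  𝕊.trans (𝕊.*-congˡ {w ^ˢ ∣ S ∣} (#withSupport-outside S)) (w^∣S∣⊗#withSupport S)
w^∣S∣⊗#withSupport (inside ∷ S) = begin
  (w ⊗ w ^ˢ ∣ S ∣) ⊗ c           ≈⟨ ⊗-semigroup.xy∙z≈y∙xz w (w ^ˢ ∣ S ∣) c ⟩
  w ^ˢ ∣ S ∣ ⊗ (w ⊗ c)           ≈⟨ 𝕊.*-congˡ {w ^ˢ ∣ S ∣} (w⊗#withSupport-inside S) ⟩
  w ^ˢ ∣ S ∣ ⊗ (z ⊗ #withSupport S)  ≈⟨ ⊗-semigroup.x∙yz≈y∙xz (w ^ˢ ∣ S ∣) z (#withSupport S) ⟩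
  z ⊗ (w ^ˢ ∣ S ∣ ⊗ #withSupport S)  ≈⟨ 𝕊.*-congˡ {z} (w^∣S∣⊗#withSupport S) ⟩
  z ⊗ z ^ˢ ∣ S ∣                 ∎
  where
  open SetoidReasoning 𝕊.setoid
  c = #withSupport (inside ∷ S)

subsets-unique : ∀ n → List.Unique (subsets n)
subsets-unique zero    = [] ∷ []
subsets-unique (suc n) = List.++⁺
  (List.map⁺ Vec.∷-injectiveʳ (subsets-unique n))
  (List.map⁺ Vec.∷-injectiveʳ (subsets-unique n))
  (λ (S∈ , S∈′) → disjoint (∈-map⁻ (outside ∷_) S∈) (∈-map⁻ (inside ∷_) S∈′))
  where
  disjoint : ∀ {S : Subset (suc n)} {xs ys : List (Subset n)} →
             (∃ λ T → T ∈ˡ xs × S ≡ outside ∷ T) → ¬ ∃ λ T → T ∈ˡ ys × S ≡ inside ∷ T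
  disjoint (_ , _ , refl) (_ , _ , ())

∈-subsets : ∀ {n} (S : Subset n) → S ∈ˡ subsets n
∈-subsets []            = here refl
∈-subsets (outside ∷ S) = ∈-++⁺ˡ (∈-map⁺ (outside ∷_) (∈-subsets S))
∈-subsets (inside  ∷ S) = ∈-++⁺ʳ (List.map (outside ∷_) (subsets _)) (∈-map⁺ (inside ∷_) (∈-subsets S))

-- Whether a monomial is counted depends only on its support, so the monomials are grouped by it.
length-filter-support : ∀ {n} {F : Subset n → Set p} (F? : Decidable F) d →
  + length (filter (F? ∘ support) (monomials n d)) ≡ ∑ (subsets n) (λ S → ⟦ F? S ⟧ ℤ.* #withSupport S d)
length-filter-support {n = n} F? d = begin
  + length (filter (F? ∘ support) (monomials n d))
    ≡⟨ length-filter (F? ∘ support) (monomials n d) ⟩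
  ∑ (monomials n d) (λ α → ⟦ F? (support α) ⟧)
    ≡⟨ ∑-cong (monomials n d) (λ α → sym (trans
         (∑-single (term α) (subsets-unique n) (∈-subsets (support α)) (λ {S} _ S≢ →
           trans (cong (ℤ._*_ ⟦ F? S ⟧) (⟦⟧-no (support α ≟ˢ S) (S≢ ∘ sym))) (ℤ.*-zeroʳ ⟦ F? S ⟧)))
         (trans (cong (ℤ._*_ ⟦ F? (support α) ⟧) (⟦⟧-yes (support α ≟ˢ support α) refl)) (ℤ.*-identityʳ _)))) ⟩
  ∑ (monomials n d) (λ α → ∑ (subsets n) (term α))
    ≡⟨ ∑-swap (monomials n d) (subsets n) term ⟩
  ∑ (subsets n) (λ S → ∑ (monomials n d) (λ α → term α S))
    ≡⟨ ∑-cong (subsets n) (λ S → ∑-*ˡ (monomials n d) ⟦ F? S ⟧ _) ⟩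
  ∑ (subsets n) (λ S → ⟦ F? S ⟧ ℤ.* #withSupport S d)
    ∎
  where
  open ≡.≡-Reasoning
  term : Vec ℕ n → Subset n → ℤ
  term α S = ⟦ F? S ⟧ ℤ.* ⟦ support α ≟ˢ S ⟧

-- Face monomials and the quotient by a power of 1 - z

module FaceMonomials (G : Graph) {ℓ} (_≼_ : Rel (Fin (Graph.#E G)) ℓ)
  (≼-isTotalOrder : IsTotalOrder _≡_ _≼_) (1≤#V : 1 ℕ.≤ Graph.#V G) where

  open Graph G
  open BrokenCircuitComplex G _≼_ ≼-isTotalOrder
  open FacePolynomial G _≼_ ≼-isTotalOrder 1≤#V

  faceMonomials : ℕ → List (Vec ℕ #E)
  faceMonomials d = filter (isFace? ∘ support) (monomials #E d)

  -- By uniqueness of the quotient it is enough to multiply the counting series by `w ^ˢ r`. For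
  -- each face `S`, the part `w ^ˢ ∣ S ∣` clears the denominator of its generating function and
  -- `w ^ˢ (r ∸ ∣ S ∣)` remains.
  hPolynomial÷w^r : hPolynomial ÷ w ^ˢ r ≗ λ d → + length (faceMonomials d)
  hPolynomial÷w^r = ÷-unique (w^n-0 r) (begin
    (λ d → + length (faceMonomials d)) ⊗ w ^ˢ r
      ≈⟨ 𝕊.*-congʳ {w ^ˢ r} (λ d → trans (length-filter-support isFace? d) (sym (trans
           (∑ˢ-at (subsets #E) _ d)
           (∑-cong (subsets #E) λ S → const-⊗ ⟦ isFace? S ⟧ (#withSupport S) d)))) ⟩
    ∑ˢ.∑ (subsets #E) (λ S → const ⟦ isFace? S ⟧ ⊗ #withSupport S) ⊗ w ^ˢ r
      ≈⟨ ∑ˢ.∑-*ʳ (subsets #E) (w ^ˢ r) _ ⟨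
    ∑ˢ.∑ (subsets #E) (λ S → (const ⟦ isFace? S ⟧ ⊗ #withSupport S) ⊗ w ^ˢ r)
      ≈⟨ ∑ˢ.∑-cong (subsets #E) (λ S → 𝕊.trans
           (⊗-assoc (const ⟦ isFace? S ⟧) (#withSupport S) (w ^ˢ r))
           (const-⟦⟧-cong (isFace? S) (clear S))) ⟩
    facePolynomial r
      ≈⟨ hPolynomial-faces ⟨
    hPolynomial
      ∎)
    where
    open SetoidReasoning 𝕊.setoid

    w^n-0 : ∀ n → (w ^ˢ n) 0 ≡ 1ℤ
    w^n-0 zero    = refl
    w^n-0 (suc n) = cong (ℤ._*_ 1ℤ) (w^n-0 n)

    clear : ∀ S → IsFace S → #withSupport S ⊗ w ^ˢ r ≗ z ^ˢ ∣ S ∣ ⊗ w ^ˢ (r ℕ.∸ ∣ S ∣)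
    clear S face = begin
      #withSupport S ⊗ w ^ˢ r
        ≡⟨ cong (λ n → #withSupport S ⊗ w ^ˢ n) (ℕ.m+[n∸m]≡n (face-≤r face)) ⟨
      #withSupport S ⊗ w ^ˢ (∣ S ∣ ℕ.+ (r ℕ.∸ ∣ S ∣))
        ≈⟨ 𝕊.*-congˡ {#withSupport S} (^ˢ-+ w ∣ S ∣ (r ℕ.∸ ∣ S ∣)) ⟩
      #withSupport S ⊗ (w ^ˢ ∣ S ∣ ⊗ w ^ˢ (r ℕ.∸ ∣ S ∣))
        ≈⟨ ⊗-semigroup.x∙yz≈yx∙z (#withSupport S) (w ^ˢ ∣ S ∣) (w ^ˢ (r ℕ.∸ ∣ S ∣)) ⟩
      (w ^ˢ ∣ S ∣ ⊗ #withSupport S) ⊗ w ^ˢ (r ℕ.∸ ∣ S ∣)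
        ≈⟨ 𝕊.*-congʳ {w ^ˢ (r ℕ.∸ ∣ S ∣)} (w^∣S∣⊗#withSupport S) ⟩
      z ^ˢ ∣ S ∣ ⊗ w ^ˢ (r ℕ.∸ ∣ S ∣)
        ∎

-- Quotients by squarefree monomial ideals

unique-lookup-injective : ∀ {xs : List A} → List.Unique xs → ∀ {i j} →
                          List.lookup xs i ≡ List.lookup xs j → i ≡ j
unique-lookup-injective (x≢ ∷ u) {zero}  {zero}  eq = refl
unique-lookup-injective (x≢ ∷ u) {zero}  {suc j} eq = contradiction eq (All.lookup x≢ (∈-lookup j))
unique-lookup-injective (x≢ ∷ u) {suc i} {zero}  eq = contradiction (sym eq) (All.lookup x≢ (∈-lookup i))
unique-lookup-injective (x≢ ∷ u) {suc i} {suc j} eq = cong suc (unique-lookup-injective u eq)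

infixl 6 _+ᵛ_ _∸ᵛ_

_+ᵛ_ _∸ᵛ_ : ∀ {n} → Vec ℕ n → Vec ℕ n → Vec ℕ n
_+ᵛ_ = Vec.zipWith ℕ._+_
_∸ᵛ_ = Vec.zipWith ℕ._∸_

+ᵛ-∸ᵛ : ∀ {n} (β δ : Vec ℕ n) → (β +ᵛ δ) ∸ᵛ β ≡ δ
+ᵛ-∸ᵛ []      []      = refl
+ᵛ-∸ᵛ (b ∷ β) (d ∷ δ) = cong₂ _∷_ (ℕ.m+n∸m≡n b d) (+ᵛ-∸ᵛ β δ)

indicator : ∀ {n} → Subset n → Vec ℕ n
indicator = Vec.map (λ s → if s then 1 else 0)

support-indicator : ∀ {n} (B : Subset n) → support (indicator B) ≡ B
support-indicator []            = refl
support-indicator (inside  ∷ B) = cong (inside ∷_) (support-indicator B)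
support-indicator (outside ∷ B) = cong (outside ∷_) (support-indicator B)

∸ᵛ-indicator : ∀ {n} (B : Subset n) β → B ⊆ support β → (β ∸ᵛ indicator B) +ᵛ indicator B ≡ β
∸ᵛ-indicator []            []          B⊆ = refl
∸ᵛ-indicator (outside ∷ B) (b ∷ β)     B⊆ = cong₂ _∷_ (ℕ.+-identityʳ b) (∸ᵛ-indicator B β (drop-∷-⊆ B⊆))
∸ᵛ-indicator (inside  ∷ B) (zero ∷ β)  B⊆ = contradiction (B⊆ here) λ ()
∸ᵛ-indicator (inside  ∷ B) (suc b ∷ β) B⊆ = cong₂ _∷_ (ℕ.+-comm b 1) (∸ᵛ-indicator B β (drop-∷-⊆ B⊆))

support-+ᵛʳ : ∀ {n} (β γ : Vec ℕ n) → support γ ⊆ support (β +ᵛ γ)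
support-+ᵛʳ (zero  ∷ β) (suc c ∷ γ) here       = here
support-+ᵛʳ (suc b ∷ β) (suc c ∷ γ) here       = here
support-+ᵛʳ (b     ∷ β) (c     ∷ γ) (there x∈) = there (support-+ᵛʳ β γ x∈)

module SquarefreeMonomialIdeal {c ℓ₁ ℓ₂} (𝕜 : HeytingField c ℓ₁ ℓ₂) {N : ℕ}
  {g} {Gens : Subset N → Set g} (gens? : Decidable Gens)
  (face? : Decidable (λ S → ∀ B → Gens B → ¬ B ⊆ S)) where

  open Polynomials 𝕜 N
  open Quotient Gens
  open CommutativeRing (HeytingCommutativeRing.commutativeRing (HeytingField.heytingCommutativeRing 𝕜))
    using (Carrier; _≈_; _+_; _*_; -_; 0#; 1#; +-cong; +-congˡ; +-congʳ; *-congˡ; +-assoc; +-identityˡ; +-identityʳ;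
           *-identityʳ; -‿cong; -‿inverseʳ; zeroʳ; distribˡ; ring; setoid; reflexive)
    renaming (refl to ≈-refl; sym to ≈-sym; trans to ≈-trans)
  open RingProperties ring using (-0#≈0#; -‿+-comm)

  IsFace : Subset N → Set _
  IsFace S = ∀ B → Gens B → ¬ B ⊆ S

  infix 9 [_]_

  [_]_ : Dec P → Carrier → Carrier
  [ P? ] a = if does P? then a else 0#

  []-cong : (P? : Dec P) {a b : Carrier} → a ≈ b → [ P? ] a ≈ [ P? ] b
  []-cong (yes _) a≈b = a≈b
  []-cong (no _)  _   = ≈-refl

  []-yes : (P? : Dec P) {a : Carrier} → P → [ P? ] a ≈ a
  []-yes (yes _) _ = ≈-refl
  []-yes (no ¬p) p = contradiction p ¬p

  []-no : (P? : Dec P) {a : Carrier} → ¬ P → [ P? ] a ≈ 0#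
  []-no (yes p) ¬p = contradiction p ¬p
  []-no (no _)  _  = ≈-refl

  _≟ᵐ_ : (α β : Monomial) → Dec (α ≡ β)
  _≟ᵐ_ = Vec.≡-dec ℕ._≟_

  zero+zero : ∀ {a b : Carrier} → a ≈ 0# → b ≈ 0# → a + b ≈ 0#
  zero+zero a≈0 b≈0 = ≈-trans (+-cong a≈0 b≈0) (+-identityˡ 0#)

  coeff-++ : ∀ p q α → coeff (p +ₚ q) α ≈ coeff p α + coeff q α
  coeff-++ []            q α = ≈-sym (+-identityˡ _)
  coeff-++ ((a , β) ∷ p) q α = ≈-trans (+-congˡ (coeff-++ p q α)) (≈-sym (+-assoc _ _ _))

  coeff-neg : ∀ p α → coeff (0ₚ -ₚ p) α ≈ - coeff p α
  coeff-neg []            α = ≈-sym -0#≈0#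
  coeff-neg ((a , β) ∷ p) α = ≈-trans (+-cong (neg-[] (β ≟ᵐ α)) (coeff-neg p α)) (-‿+-comm _ _)
    where
    neg-[] : (P? : Dec P) → [ P? ] (- a) ≈ - ([ P? ] a)
    neg-[] (yes _) = ≈-refl
    neg-[] (no _)  = ≈-sym -0#≈0#

  -- Multiplication by a monomial only shifts exponents, and the shift by `β` is injective, with
  -- left inverse subtraction of `β`.
  coeff-term-*-hit : ∀ a β p γ → coeff (((a , β) ∷ []) *ₚ p) (β +ᵛ γ) ≈ a * coeff p γ
  coeff-term-*-hit a β []            γ = ≈-sym (zeroʳ a)
  coeff-term-*-hit a β ((b , δ) ∷ p) γ =
    ≈-trans (+-cong (shift ((β +ᵛ δ) ≟ᵐ (β +ᵛ γ)) (δ ≟ᵐ γ)) (coeff-term-*-hit a β p γ))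
            (≈-sym (distribˡ a _ _))
    where
    shift : (eq? : Dec (β +ᵛ δ ≡ β +ᵛ γ)) (eq′? : Dec (δ ≡ γ)) → [ eq? ] (a * b) ≈ a * ([ eq′? ] b)
    shift eq?      (yes refl) = []-yes eq? refl
    shift eq? (no δ≢γ) = ≈-trans
      ([]-no eq? λ eq → δ≢γ (trans (sym (+ᵛ-∸ᵛ β δ)) (trans (cong (_∸ᵛ β) eq) (+ᵛ-∸ᵛ β γ))))
      (≈-sym (zeroʳ a))

  coeff-term-*-miss : ∀ a β p α → (∀ γ → β +ᵛ γ ≢ α) → coeff (((a , β) ∷ []) *ₚ p) α ≈ 0#
  coeff-term-*-miss a β []            α miss = ≈-refl
  coeff-term-*-miss a β ((b , δ) ∷ p) α miss =
    zero+zero ([]-no ((β +ᵛ δ) ≟ᵐ α) (miss δ)) (coeff-term-*-miss a β p α miss)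

  coeff-cartesianProductWith-∷ : ∀ (f : (s t : Carrier × Monomial) → Carrier × Monomial) t q p α →
    coeff (List.cartesianProductWith f (t ∷ q) p) α ≈
    coeff (List.cartesianProductWith f (t ∷ []) p) α + coeff (List.cartesianProductWith f q p) α
  coeff-cartesianProductWith-∷ f t q p α = ≈-trans (coeff-++ (List.map (f t) p) _ α)
    (+-congʳ (≈-sym (≈-trans (coeff-++ (List.map (f t) p) [] α) (+-identityʳ _))))

  -- The description of the ideal by coefficients. It is proved in both directions, so that
  -- membership can be tested monomial by monomial although polynomials are formal sums with
  -- repetitions.
  Vanishes : Poly → Set _
  Vanishes p = ∀ α → IsFace (support α) → coeff p α ≈ 0#

  -- At `α`, a term with exponent `β` picks out the coefficient of `p` at `α ∸ᵛ β` if `β` divides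
  -- `α`, and nothing otherwise. A divisor of a face monomial again has a face as support, as
  -- subsets of faces are faces.
  vanishes-* : ∀ q {p} → Vanishes p → Vanishes (q *ₚ p)
  vanishes-* []            v α face = ≈-refl
  vanishes-* ((a , β) ∷ q) {p} v α face =
    ≈-trans (coeff-cartesianProductWith-∷ _ (a , β) q p α) (zero+zero (term ((β +ᵛ (α ∸ᵛ β)) ≟ᵐ α)) (vanishes-* q {p} v α face))
    where
    -- The subtraction is truncated, so this equation is precisely the test whether `β` divides `α`.
    term : Dec (β +ᵛ (α ∸ᵛ β) ≡ α) → coeff (((a , β) ∷ []) *ₚ p) α ≈ 0#
    term (yes eq) = subst (λ α → coeff (((a , β) ∷ []) *ₚ p) α ≈ 0#) eq (≈-trans
      (coeff-term-*-hit a β p (α ∸ᵛ β))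
      (≈-trans (*-congˡ (v (α ∸ᵛ β) λ B gB B⊆ → face B gB λ x∈ →
         subst (λ α → _ ∈ support α) eq (support-+ᵛʳ β (α ∸ᵛ β) (B⊆ x∈)))) (zeroʳ a)))
    term (no neq) = coeff-term-*-miss a β p α λ γ eq → neq
      (subst (λ α → β +ᵛ (α ∸ᵛ β) ≡ α) eq (cong (β +ᵛ_) (+ᵛ-∸ᵛ β γ)))

  ideal⇒vanishes : ∀ {p} → Ideal p → Vanishes p
  ideal⇒vanishes (generator {B} gB) α face = zero+zero
    ([]-no (indicator B ≟ᵐ α) λ { refl → face B gB (subst (_ ∈_) (sym (support-indicator B))) }) ≈-refl
  ideal⇒vanishes zero α face = ≈-refl
  ideal⇒vanishes (sum {p} {q} i j) α face =
    ≈-trans (coeff-++ p q α) (zero+zero (ideal⇒vanishes i α face) (ideal⇒vanishes j α face))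
  ideal⇒vanishes (multiple q {p} i) α face = vanishes-* q {p} (ideal⇒vanishes i) α face
  ideal⇒vanishes (resp eq i) α face = ≈-trans (≈-sym (eq α)) (ideal⇒vanishes i α face)

  -- Filtering terms instead of coefficients is sound, because all occurrences of one monomial are
  -- kept or dropped together.
  nonfaceTerms : Poly → Poly
  nonfaceTerms = filter (λ t → ¬? (face? (support (proj₂ t))))

  coeff-nonfaceTerms-face : ∀ p α → IsFace (support α) → coeff (nonfaceTerms p) α ≈ 0#
  coeff-nonfaceTerms-face []            α face = ≈-refl
  coeff-nonfaceTerms-face ((a , β) ∷ p) α face with face? (support β)
  ... | yes _     = coeff-nonfaceTerms-face p α face
  ... | no  ¬face = zero+zero ([]-no (β ≟ᵐ α) λ { refl → ¬face face }) (coeff-nonfaceTerms-face p α face)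

  coeff-nonfaceTerms-nonface : ∀ p α → ¬ IsFace (support α) → coeff (nonfaceTerms p) α ≈ coeff p α
  coeff-nonfaceTerms-nonface []            α ¬face = ≈-refl
  coeff-nonfaceTerms-nonface ((a , β) ∷ p) α ¬face with face? (support β)
  ... | no  _    = +-congˡ (coeff-nonfaceTerms-nonface p α ¬face)
  ... | yes face = ≈-trans (coeff-nonfaceTerms-nonface p α ¬face) (≈-sym (≈-trans
    (+-congʳ ([]-no (β ≟ᵐ α) λ { refl → ¬face face })) (+-identityˡ _)))

  -- Decidability of the generators turns the failure of being a face into an actual generator `B`
  -- inside the support. Its squarefree monomial divides the term, with cofactor exponent
  -- `β ∸ᵛ indicator B`.
  nonface-term∈ideal : ∀ a β → ¬ IsFace (support β) → Ideal ((a , β) ∷ [])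
  nonface-term∈ideal a β ¬face with anySubset? (λ B → gens? B ×-dec (B ⊆? support β))
  ... | no none = contradiction (λ B gB B⊆ → none (B , gB , λ {x} → B⊆ {x})) ¬face
  ... | yes (B , gB , B⊆) = resp
    (λ α → +-congʳ (≈-trans ([]-cong (((β ∸ᵛ indicator B) +ᵛ indicator B) ≟ᵐ α) (*-identityʳ a))
      (reflexive (cong (λ β → [ β ≟ᵐ α ] a) (∸ᵛ-indicator B β B⊆)))))
    (multiple ((a , β ∸ᵛ indicator B) ∷ []) (generator gB))

  nonfaceTerms∈ideal : ∀ p → Ideal (nonfaceTerms p)
  nonfaceTerms∈ideal []            = zero
  nonfaceTerms∈ideal ((a , β) ∷ p) with face? (support β)
  ... | yes _     = nonfaceTerms∈ideal p
  ... | no  ¬face = sum (nonface-term∈ideal a β ¬face) (nonfaceTerms∈ideal p)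

  -- If no face monomial has a nonzero coefficient, `p` has the same coefficients as the sum of its
  -- nonface terms, each of which is in the ideal.
  vanishes⇒ideal : ∀ {p} → Vanishes p → Ideal p
  vanishes⇒ideal {p} v = resp
    (λ α → agree α (face? (support α)))
    (nonfaceTerms∈ideal p)
    where
    agree : ∀ α → Dec (IsFace (support α)) → coeff (nonfaceTerms p) α ≈ coeff p α
    agree α (yes face) = ≈-trans (coeff-nonfaceTerms-face p α face) (≈-sym (v α face))
    agree α (no ¬face) = coeff-nonfaceTerms-nonface p α ¬face

  term : Monomial → Poly
  term α = (1# , α) ∷ []

  coeff-combination-miss : ∀ {n} (a : Fin n → Carrier) (m : Fin n → Monomial) α →
    (∀ i → m i ≢ α) → coeff (linearCombination a (term ∘ m)) α ≈ 0#
  coeff-combination-miss {zero}  a m α miss = ≈-refl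
  coeff-combination-miss {suc n} a m α miss = zero+zero
    ([]-no (m zero ≟ᵐ α) (miss zero)) (coeff-combination-miss (a ∘ suc) (m ∘ suc) α (miss ∘ suc))

  coeff-combination-hit : ∀ {n} (a : Fin n → Carrier) (m : Fin n → Monomial) →
    (∀ {i j} → m i ≡ m j → i ≡ j) → ∀ i → coeff (linearCombination a (term ∘ m)) (m i) ≈ a i
  coeff-combination-hit {suc n} a m inj zero = ≈-trans
    (+-cong (≈-trans ([]-yes (m zero ≟ᵐ m zero) refl) (*-identityʳ (a zero)))
            (coeff-combination-miss (a ∘ suc) (m ∘ suc) (m zero) λ i eq → contradiction (inj eq) λ ()))
    (+-identityʳ (a zero))
  coeff-combination-hit {suc n} a m inj (suc i) = ≈-trans
    (+-cong ([]-no (m zero ≟ᵐ m (suc i)) λ eq → contradiction (inj eq) λ ())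
            (coeff-combination-hit (a ∘ suc) (m ∘ suc) (Fin.suc-injective ∘ inj) i))
    (+-identityˡ (a (suc i)))

  faceMonomials-basis : ∀ d → let ms = filter (face? ∘ support) (monomials N d) in
                        IsBasis d (term ∘ List.lookup ms)
  faceMonomials-basis d = homogeneous , independent , spanning
    where
    ms : List Monomial
    ms = filter (face? ∘ support) (monomials N d)

    m : Fin (length ms) → Monomial
    m = List.lookup ms

    m-degree : ∀ i → Vec.sum (m i) ≡ d
    m-degree i = monomials-degree N d (proj₁ (∈-filter⁻ (face? ∘ support) {xs = monomials N d} (∈-lookup i)))

    m-face : ∀ i → IsFace (support (m i))
    m-face i = proj₂ (∈-filter⁻ (face? ∘ support) {xs = monomials N d} (∈-lookup i))

    m-injective : ∀ {i j} → m i ≡ m j → i ≡ j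
    m-injective = unique-lookup-injective (List.filter⁺ (face? ∘ support) (monomials-unique N d))

    m-surjective : ∀ α → Vec.sum α ≡ d → IsFace (support α) → ∃ λ i → m i ≡ α
    m-surjective α refl face =
      let α∈ = ∈-filter⁺ (face? ∘ support) (∈-monomials α) face in
      Any.index α∈ , sym (Any.lookup-index α∈)

    homogeneous : ∀ i → IsHomogeneous d (term (m i))
    homogeneous i α sum≢d = zero+zero ([]-no (m i ≟ᵐ α) λ { refl → sum≢d (m-degree i) }) ≈-refl

    independent : ∀ a → linearCombination a (term ∘ m) ∼ 0ₚ → ∀ i → a i ≈ 0#
    independent a rel i = begin
      a i                                                  ≈⟨ coeff-combination-hit a m m-injective i ⟨
      coeff combination (m i)                              ≈⟨ +-identityʳ _ ⟨
      coeff combination (m i) + 0#                         ≈⟨ coeff-++ combination [] (m i) ⟨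
      coeff (combination -ₚ 0ₚ) (m i)                      ≈⟨ ideal⇒vanishes rel (m i) (m-face i) ⟩
      0#                                                   ∎
      where
      open SetoidReasoning setoid
      combination = linearCombination a (term ∘ m)

    spanning : ∀ p → IsHomogeneous d p → ∃ λ a → p ∼ linearCombination a (term ∘ m)
    spanning p hom = coefficients , vanishes⇒ideal λ α face → ≈-trans
      (coeff-++ p (0ₚ -ₚ combination) α)
      (≈-trans (+-congˡ (≈-trans (coeff-neg combination α) (-‿cong (agree α face (Vec.sum α ℕ.≟ d)))))
               (-‿inverseʳ (coeff p α)))
      where
      -- The coordinates of `p` are its own coefficients at the face monomials. In degrees other
      -- than `d` both sides vanish, and monomials whose support is not a face are not inspected by
      -- `Vanishes`.
      coefficients : Fin (length ms) → Carrier
      coefficients i = coeff p (m i)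

      combination : Poly
      combination = linearCombination coefficients (term ∘ m)

      agree : ∀ α → IsFace (support α) → Dec (Vec.sum α ≡ d) → coeff combination α ≈ coeff p α
      agree α face (no sum≢d) = ≈-trans
        (coeff-combination-miss coefficients m α λ { i refl → sum≢d (m-degree i) }) (≈-sym (hom α sum≢d))
      agree α face (yes sum≡d) with m-surjective α sum≡d face
      ... | i , refl = coeff-combination-hit coefficients m m-injective i

-- The h-polynomial and the Hilbert series for the complete bipartite graph

open import Data.Integer.Base using () renaming (_*_ to _*ℤ_; _^_ to _^ℤ_)
open import Data.Nat.Base using (_+_; _*_; _∸_; _≤_)

theorem6p4 :
    ∀ {c ℓ₁ ℓ₂ ℓ} (𝕜 : HeytingField c ℓ₁ ℓ₂)
    (m n : ℕ) → 1 ≤ m → 1 ≤ n →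
    (_≼_ : Rel (Fin (m * n)) ℓ) (≼-isTotalOrder : IsTotalOrder _≡_ _≼_) →
    let open BrokenCircuitComplex (K m n) _≼_ ≼-isTotalOrder using (hPolynomial)
        open StanleyReisner 𝕜 (K m n) _≼_ ≼-isTotalOrder using (IsHilbertSeries)
    in
    (hPolynomial ≗
      ∑[ 1 to m ] (λ k →
        const (-1ℤ ^ℤ (m + k) *ℤ + stirling₂ m k)
          ⊗ z ^ˢ (m ∸ k)
          ⊗ ∏[ 1 to k ∸ 2 ] (λ a → 1ˢ ⊕ const (+ a) ⊗ z)
          ⊗ (1ˢ ⊕ const (+ (k ∸ 1)) ⊗ z) ^ˢ n))
    × IsHilbertSeries (hPolynomial ÷ (1ˢ ⊖ z) ^ˢ (m + n ∸ 1))
theorem6p4 𝕜 m n 1≤m _ _≼_ ≼-isTotalOrder =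
  hPolynomial-bipartite m n 1≤m _≼_ ≼-isTotalOrder ,
  -- The dimension in degree `d` is the number of face monomials. For `K m n` the exponent `r`
  -- computes to `m + n ∸ 1`, so `hPolynomial÷w^r` has the required denominator.
  λ d → length (faceMonomials d) , hPolynomial÷w^r d , _ , faceMonomials-basis d
  where
  open BrokenCircuitComplex (K m n) _≼_ ≼-isTotalOrder using (isBrokenCircuit?; isFace?)
  open FaceMonomials (K m n) _≼_ ≼-isTotalOrder (ℕ.≤-trans 1≤m (ℕ.m≤m+n m n))
  open SquarefreeMonomialIdeal 𝕜 isBrokenCircuit? isFace?
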